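{- Let $H$ be a galaxy with spiders (as defined in the context). Then $H$ satisfies the Erdős–Hajnal property: there exists $\epsilon(H)>0$ such that every tournament $T$ on $n$ vertices that does not contain $H$ as an induced subtournament contains a transitive subtournament on at least $n^{\epsilon(H)}$ vertices.
   Context: A tournament is transitive if it has no directed cycle. For an ordering $\theta=(v_1,\dots,v_n)$ of the vertices of a tournament $T$, an arc $(v_i,v_j)$ is backward under $\theta$ if $i>j$ (otherwise forward). A vertex $v_j$ is between $v_i$ and $v_k$ under $\theta$ if $i<j<k$ or $k<j<i$; for a vertex set $N$, its left (right) point is its vertex with smallest (largest) index in $\theta$. $B(T,\theta)$ is the undirected graph on $V(T)$ whose edges are the pairs joined by a backward arc. Stars. A tournament $S$ with ordering $(v_1,\dots,v_n)$ is a right star if its backward arcs under this ordering are exactly $(v_n,v_i)$ for all $i\le n-1$ (center $v_n$, leaves $v_1,\dots,v_{n-1}$), and a left star if its backward arcs are exactly $(v_i,v_1)$ for all $i\ge 2$ (center $v_1$, leaves $v_2,\dots,v_n$); a star is a left or right star (for $n=2$ either vertex may be taken as center). A star of $T$ under $\theta$ is an induced subtournament which is a star whose star ordering is the restriction of $\theta$ to its vertex set. A tournament $T$ is a galaxy under $\theta$ if $V(T)$ is the disjoint union of $V(S_1),\dots,V(S_l),X$ where $S_1,\dots,S_l$ are the stars of $T$ under $\theta$ (all backward arcs lie inside some $V(S_i)$), every $x\in X$ is an isolated vertex of $B(T,\theta)$, and no center of a star is between leaves of another star under $\theta$. Spiders. A tournament with ordering $(1,\dots,m,m+1,\dots,m+5,m+6,\dots,n)$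 is a middle spider if its backward arcs are exactly $(m+4,m+1)$, $(m+5,m+2)$, $(m+1,i)$ for $i=1,\dots,m$, and $(i,m+5)$ for $i=m+6,\dots,n$; its legs are $1,\dots,m$ (incident to center $m+1$) and $m+6,\dots,n$ (incident to center $m+5$), its interior vertices are $m+1,\dots,m+5$, its petals $m+2,m+3,m+4$, its centers $m+1,m+5$. A tournament with ordering $(1,\dots,n)$ is a right spider if its backward arcs are exactly $(n,n-3)$, $(n-1,n-4)$, $(n,i)$ for $i\in X_1$ and $(n-4,i)$ for $i\in X_2$, where $X_1\cup X_2=\{1,\dots,n-5\}$, $X_1\cap X_2=\emptyset$; legs $1,\dots,n-5$ (those in $X_1$ incident to center $n$, those in $X_2$ to center $n-4$), interior vertices $n-4,\dots,n$, petals $n-3,n-2,n-1$, centers $n-4,n$. A tournament with ordering $(1,\dots,n)$ is a left spider if its backward arcs are exactly $(4,1)$, $(5,2)$, $(i,5)$ for $i\in X_1$ and $(i,1)$ for $i\in X_2$, where $X_1\cup X_2=\{6,\dots,n\}$, $X_1\cap X_2=\emptyset$; legs $6,\dots,n$ (those in $X_1$ incident to center $5$, those in $X_2$ to center $1$), interior vertices $1,\dots,5$, petals $2,3,4$, centers $1,5$. A spider is a middle, left or right spider. A spider of $T$ under $\theta$ is an induced subtournament which is a spider, whose spider ordering is the restriction of $\theta$ to its vertices, and whose interior vertices are consecutive under $\theta$. Super galaxy ordering. An ordering $\theta$ of $V(H)$ is a super galaxy ordering if $V(H)$ is the disjoint union of $V(\mathcal S_1),\dots,V(\mathcal S_l),X$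 where $\mathcal S_1,\dots,\mathcal S_l$ are the spiders of $H$ under $\theta$ (all backward arcs of $H$ under $\theta$ lie inside some $V(\mathcal S_i)$ or inside $X$), $H|X$ is a galaxy under the restriction $\bar\theta$ of $\theta$ to $X$, no interior vertex of a spider is between leaves of a star of $H|X$ under $\bar\theta$, no center of a star of $H|X$ under $\bar\theta$ is between two legs of a spider incident to the same center of that spider, and for $1\le i<j\le l$ every vertex of $\mathcal S_i$ precedes every vertex of $\mathcal S_j$ under $\theta$. Contracting graph. Its vertices are the sets $N_1,\dots,N_f$: the sets of legs of the spiders $\mathcal S_1,\dots,\mathcal S_l$ incident to a common center, the sets of petals of the spiders, and the sets of leaves of the stars $Q_1,\dots,Q_m$ of $H|X$ under $\bar\theta$. $N_i$ and $N_j$ are adjacent if some vertex of $N_i$ is between the left point and the right point of $N_j$, or vice versa. For each connected component $C$, let $\mathcal Z(C)$ be the union of the sets $N_i$ in $C$; $P_\theta(H)$ is the collection of the sets $\mathcal Z(C)$ over all components $C$. Galaxy with spiders. A tournament $H$ is a galaxy with spiders if it has a super galaxy ordering $\theta$ such that whenever $v,v'$ are legs of distinct spiders $\mathcal S_i,\mathcal S_j$ and $v\in M\in P_\theta(H)$, then $v'\notin M$, unless no center of a star of $H|X$ is between a center of $\mathcal S_i$ and a center of $\mathcal S_j$ (in which case $v,v'$ may lie in the same set of $P_\theta(H)$). -}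

module Defs where

open import Data.Nat using (ℕ; zero; suc; _<_; _≤_; _^_)
open import Data.Fin using (Fin; toℕ; inject₁; fromℕ) renaming (zero to fzero; suc to fsuc)
open import Data.Fin.Subset using (Subset; _∈_; _∉_)
open import Data.Fin.Permutation using (Permutation′; _⟨$⟩ʳ_)
open import Data.Bool using (Bool; true; false; not)
open import Data.List using (List; []; _∷_; _++_; lookup; length; map; concatMap)
open import Data.Product using (Σ; ∃; _×_; _,_)
open import Data.Sum using (_⊎_)
open import Data.Empty using (⊥)
open import Relation.Nullary using (¬_)
open import Relation.Binary.PropositionalEquality using (_≡_; _≢_; refl; sym; trans; cong)
open import Relation.Binary.Construct.Closure.ReflexiveTransitive using (Star)
open import Function.Definitions using (Injective)

-- Tournaments on vertex set Fin n (adj u v = true : arc from u to v)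

record Tournament (n : ℕ) : Set where
  field
    adj    : Fin n → Fin n → Bool
    irrefl : ∀ i → adj i i ≡ false
    tour   : ∀ i j → i ≢ j → adj i j ≡ not (adj j i)

open Tournament public

Arc : ∀ {n} → Tournament n → Fin n → Fin n → Set
Arc T u v = adj T u v ≡ true

HasDirectedCycle : ∀ {n} → Tournament n → Set
HasDirectedCycle {n} T =
  Σ ℕ λ k → Σ (Fin (suc k) → Fin n) λ c →
    ((i : Fin k) → Arc T (c (inject₁ i)) (c (fsuc i))) × Arc T (c (fromℕ k)) (c fzero)

IsTransitive : ∀ {n} → Tournament n → Set
IsTransitive T = ¬ HasDirectedCycle T

induce : ∀ {m n} (T : Tournament n) (f : Fin m → Fin n) → Injective _≡_ _≡_ f → Tournament m
induce T f inj = record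
  { adj    = λ i j → adj T (f i) (f j)
  ; irrefl = λ i → irrefl T (f i)
  ; tour   = λ i j i≢j → tour T (f i) (f j) (λ e → i≢j (inj e))
  }

ContainsInduced : ∀ {n k} → Tournament n → Tournament k → Set
ContainsInduced {n} {k} T H =
  Σ (Fin k → Fin n) λ f → Injective _≡_ _≡_ f × (∀ i j → adj H i j ≡ adj T (f i) (f j))

HasTransitiveSub : ∀ {n} → Tournament n → ℕ → Set
HasTransitiveSub {n} T m =
  Σ (Fin m → Fin n) λ f → Σ (Injective _≡_ _≡_ f) λ inj → IsTransitive (induce T f inj)

-- Erdős–Hajnal property, with ε = p / q (p, q ≥ 1):
-- |S| ≥ n^(p/q)  ⇔  n^p ≤ |S|^q
ErdosHajnal : ∀ {k} → Tournament k → Set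
ErdosHajnal H =
  Σ ℕ λ p → Σ ℕ λ q → 1 ≤ p × 1 ≤ q ×
    (∀ n (T : Tournament n) → ¬ ContainsInduced T H →
       Σ ℕ λ m → HasTransitiveSub T m × (n ^ p ≤ m ^ q))

_⇔′_ : Set → Set → Set
A ⇔′ B = (A → B) × (B → A)

module Ordered {k : ℕ} (H : Tournament k) (θ : Permutation′ k) where

  pos : Fin k → ℕ
  pos v = toℕ (θ ⟨$⟩ʳ v)

  _≺_ : Fin k → Fin k → Set
  u ≺ v = pos u < pos v

  Backward : Fin k → Fin k → Set
  Backward u w = Arc H u w × w ≺ u

  Between : Fin k → Fin k → Fin k → Set
  Between a v b = (a ≺ v × v ≺ b) ⊎ (b ≺ v × v ≺ a)

  record StarData : Set where
    field
      center : Fin k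
      leaves : Subset k

  open StarData public

  InStar : StarData → Fin k → Set
  InStar s v = v ≡ center s ⊎ v ∈ leaves s

  StarBase : StarData → Set
  StarBase s = center s ∉ leaves s × ∃ (λ l → l ∈ leaves s)

  IsRightStar : StarData → Set
  IsRightStar s = StarBase s
    × (∀ l → l ∈ leaves s → l ≺ center s)
    × (∀ u w → InStar s u → InStar s w →
         Backward u w ⇔′ (u ≡ center s × w ∈ leaves s))

  IsLeftStar : StarData → Set
  IsLeftStar s = StarBase s
    × (∀ l → l ∈ leaves s → center s ≺ l)
    × (∀ u w → InStar s u → InStar s w →
         Backward u w ⇔′ (u ∈ leaves s × w ≡ center s))

  IsStar : StarData → Set
  IsStar s = IsRightStar s ⊎ IsLeftStar s

  -- Spiders: interior i1 ≺ i2 ≺ i3 ≺ i4 ≺ i5 (centers i1, i5; petals i2,i3,i4),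
  -- legsA = legs incident to center i1, legsB = legs incident to center i5.

  record SpiderData : Set where
    field
      i1 i2 i3 i4 i5 : Fin k
      legsA legsB : Subset k

  open SpiderData public

  Interior : SpiderData → Fin k → Set
  Interior s v = v ≡ i1 s ⊎ v ≡ i2 s ⊎ v ≡ i3 s ⊎ v ≡ i4 s ⊎ v ≡ i5 s

  Petal : SpiderData → Fin k → Set
  Petal s v = v ≡ i2 s ⊎ v ≡ i3 s ⊎ v ≡ i4 s

  IsCenterOf : SpiderData → Fin k → Set
  IsCenterOf s v = v ≡ i1 s ⊎ v ≡ i5 s

  IsLeg : SpiderData → Fin k → Set
  IsLeg s v = v ∈ legsA s ⊎ v ∈ legsB s

  InSpider : SpiderData → Fin k → Set
  InSpider s v = Interior s v ⊎ IsLeg s v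

  SpiderBase : SpiderData → Set
  SpiderBase s =
      i1 s ≺ i2 s × i2 s ≺ i3 s × i3 s ≺ i4 s × i4 s ≺ i5 s
    × (∀ v → i1 s ≺ v → v ≺ i5 s → Petal s v)
    × (∀ v → v ∈ legsA s → v ∈ legsB s → ⊥)

  IsMiddleSpider : SpiderData → Set
  IsMiddleSpider s = SpiderBase s
    × (∀ l → l ∈ legsA s → l ≺ i1 s)
    × (∀ l → l ∈ legsB s → i5 s ≺ l)
    × (∀ u w → InSpider s u → InSpider s w →
         Backward u w ⇔′
           ((u ≡ i4 s × w ≡ i1 s) ⊎ (u ≡ i5 s × w ≡ i2 s)
            ⊎ (u ≡ i1 s × w ∈ legsA s) ⊎ (u ∈ legsB s × w ≡ i5 s)))

  IsRightSpider : SpiderData → Set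
  IsRightSpider s = SpiderBase s
    × (∀ l → l ∈ legsA s → l ≺ i1 s)
    × (∀ l → l ∈ legsB s → l ≺ i1 s)
    × (∀ u w → InSpider s u → InSpider s w →
         Backward u w ⇔′
           ((u ≡ i5 s × w ≡ i2 s) ⊎ (u ≡ i4 s × w ≡ i1 s)
            ⊎ (u ≡ i5 s × w ∈ legsB s) ⊎ (u ≡ i1 s × w ∈ legsA s)))

  IsLeftSpider : SpiderData → Set
  IsLeftSpider s = SpiderBase s
    × (∀ l → l ∈ legsA s → i5 s ≺ l)
    × (∀ l → l ∈ legsB s → i5 s ≺ l)
    × (∀ u w → InSpider s u → InSpider s w →
         Backward u w ⇔′
           ((u ≡ i4 s × w ≡ i1 s) ⊎ (u ≡ i5 s × w ≡ i2 s)
            ⊎ (u ∈ legsB s × w ≡ i5 s) ⊎ (u ∈ legsA s × w ≡ i1 s)))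

  IsSpider : SpiderData → Set
  IsSpider s = IsMiddleSpider s ⊎ IsRightSpider s ⊎ IsLeftSpider s

  record SuperGalaxy : Set where
    field
      spiders : List SpiderData
      stars   : List StarData

    sp : Fin (length spiders) → SpiderData
    sp = lookup spiders

    st : Fin (length stars) → StarData
    st = lookup stars

    InX : Fin k → Set
    InX v = ∀ i → ¬ InSpider (sp i) v

    field
      spidersOK   : ∀ i → IsSpider (sp i)
      spidersDisj : ∀ i j v → InSpider (sp i) v → InSpider (sp j) v → i ≡ j
      backwardCov : ∀ u w → Backward u w →
                      (Σ (Fin (length spiders)) λ i → InSpider (sp i) u × InSpider (sp i) w)
                      ⊎ (InX u × InX w)
      -- H|X is a galaxy under the restriction of θ, with stars Q_j = st j
      starsOK     : ∀ j → IsStar (st j)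
      starsInX    : ∀ j v → InStar (st j) v → InX v
      starsDisj   : ∀ j j' v → InStar (st j) v → InStar (st j') v → j ≡ j'
      backwardX   : ∀ u w → InX u → InX w → Backward u w →
                      Σ (Fin (length stars)) λ j → InStar (st j) u × InStar (st j) w
      isolatedX   : ∀ x → InX x → (∀ j → ¬ InStar (st j) x) →
                      ∀ y → ¬ Backward x y × ¬ Backward y x
      galaxyCtr   : ∀ j j' → j ≢ j' → ∀ a b → a ∈ leaves (st j') → b ∈ leaves (st j') →
                      ¬ Between a (center (st j)) b
      interiorLv  : ∀ i j v a b → Interior (sp i) v → a ∈ leaves (st j) → b ∈ leaves (st j) →
                      ¬ Between a v b
      centerLegs  : ∀ i j a b → ((a ∈ legsA (sp i) × b ∈ legsA (sp i)) ⊎ (a ∈ legsB (sp i) × b ∈ legsB (sp i))) →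
                      ¬ Between a (center (st j)) b
      spiderOrder : ∀ i j → toℕ i < toℕ j → ∀ u v → InSpider (sp i) u → InSpider (sp j) v → u ≺ v

    spiderNodes : SpiderData → List (Fin k → Set)
    spiderNodes s = (λ v → v ∈ legsA s) ∷ (λ v → v ∈ legsB s) ∷ Petal s ∷ []

    nodes : List (Fin k → Set)
    nodes = concatMap spiderNodes spiders ++ map (λ q v → v ∈ leaves q) stars

    nd : Fin (length nodes) → Fin k → Set
    nd = lookup nodes

    InsideSpan : (Fin k → Set) → (Fin k → Set) → Set
    InsideSpan N M = Σ (Fin k) λ v → N v × Σ (Fin k) λ a → Σ (Fin k) λ b → M a × M b × a ≺ v × v ≺ b

    CAdj : Fin (length nodes) → Fin (length nodes) → Set
    CAdj i j = InsideSpan (nd i) (nd j) ⊎ InsideSpan (nd j) (nd i)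

    Connected : Fin (length nodes) → Fin (length nodes) → Set
    Connected = Star CAdj

    SameBlock : Fin k → Fin k → Set
    SameBlock v v' = Σ (Fin (length nodes)) λ i → Σ (Fin (length nodes)) λ j →
                       nd i v × nd j v' × Connected i j

    GalaxyWithSpidersCond : Set
    GalaxyWithSpidersCond =
      ∀ i j → i ≢ j → ∀ v v' → IsLeg (sp i) v → IsLeg (sp j) v' → SameBlock v v' →
        ∀ q c c' → IsCenterOf (sp i) c → IsCenterOf (sp j) c' → ¬ Between c (center (st q)) c'

GalaxyWithSpiders : ∀ {k} → Tournament k → Set
GalaxyWithSpiders {k} H =
  Σ (Permutation′ k) λ θ → Σ (Ordered.SuperGalaxy H θ) λ sg →
    Ordered.SuperGalaxy.GalaxyWithSpidersCond sg

{-# OPTIONS --safe #-}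
module Submission where

-- Fix an H-free tournament T. By induction on the size m of a vertex set U we find in U a chain (a list in
-- which every vertex beats all later ones) of length at least m^(1/q). If U has none, then every subset of
-- linear size carries a chain of almost maximal length, so no subset of linear size is complete to or from a
-- linear subset or a chain of proportional length.
--
-- As T is H-free, U contains arbitrarily many linear sets E₁, E₂, … in which almost all arcs between Eᵢ and Eⱼ
-- go forward for i < j. A backward triangle in Eᵢ, Eⱼ, Eₗ (i < j < l) consists of one vertex in each set, all
-- three arcs going backward. Consider k = |H| of these sets: up to passing to subsets of proportional size, either
-- no three of them contain a backward triangle, or some three do, robustly (in all subsets of proportional size).
--
-- In the first case put each vertex of H into its own set, in the order θ. The backward graph of θ is a disjoint
-- union of stars (vertex 1 of a spider with its legs and vertex 4, vertex 5 with its legs and vertex 2). A typical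
-- vertex has a backward neighbour in every set, and two backward neighbours of the same vertex are joined forward
-- because there is no backward triangle. So the centres can be chosen one after the other, and H embeds.
--
-- In the second case reorder the interior 1, 2, 3, 4, 5 of every spider as 4, 1, 3, 5, 2. Then 4, 3, 2 form a
-- backward triangle, which is found robustly, and the remaining backward arcs form stars with centres 1, 5 and the
-- centres of the stars of H|X. The leaves of such a star are not separated by any centre or interior vertex, so
-- each maximal run of leaves can be put into pieces of one chain, where leaves are joined forward, while the
-- centres go into linear sets. Again H embeds.

open import Defs
open import Data.Bool using (Bool; true; false; not; _∧_; if_then_else_; T)
open import Data.Bool.Properties using () renaming (_≟_ to _≟B_)
open import Data.Nat
open import Data.Nat.Properties
open import Data.Nat.DivMod using (_/_; _%_; m≡m%n+[m/n]*n; m%n<n; m/n*n≤m; m*n/n≡m; m/n<m; m≥n⇒m/n>0; m<n⇒m/n≡0; /-monoˡ-≤; +-distrib-/-∣ˡ)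
open import Data.Nat.Divisibility using (divides)
open import Data.Nat.Induction using (<-wellFounded)
open import Data.Nat.Tactic.RingSolver using (solve-∀)
open import Data.Fin using (Fin; toℕ; inject₁; fromℕ) renaming (zero to fzero; suc to fsuc)
open import Data.Fin.Permutation using (Permutation′; _⟨$⟩ʳ_; _⟨$⟩ˡ_; inverseˡ)
open import Data.Fin.Properties using (toℕ<n; toℕ-injective) renaming (_≟_ to _≟F_; any? to anyF?)
open import Data.Fin.Subset using () renaming (_∈_ to _∈ₛ_)
open import Data.Fin.Subset.Properties using () renaming (_∈?_ to _∈ₛ?_)
open import Data.List using (List; []; _∷_; _++_; length; map; filter; filterᵇ; take; drop; lookup; upTo; allFin; cartesianProduct)
open import Data.List.Properties using (length-take; length-drop; length-++; length-map; length-upTo; length-tabulate)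
open import Data.List.Membership.Propositional using (_∈_; _∉_; find; lose)
open import Data.List.Membership.Propositional.Properties using
  (∈-allFin; ∈-lookup; ∈-++⁻; ∈-map⁺; ∈-map⁻; ∈-upTo⁺; ∈-upTo⁻; ∈-filter⁺; ∈-filter⁻; ∈-cartesianProduct⁺; ∈-cartesianProduct⁻)
open import Data.List.Relation.Unary.Any using (Any; here; there; any?)
open import Data.List.Relation.Unary.All as All using (All; []; _∷_)
import Data.List.Relation.Unary.All.Properties as AllP
open import Data.List.Relation.Unary.AllPairs using (AllPairs; []; _∷_)
import Data.List.Relation.Unary.AllPairs.Properties as AllPairsP
open import Data.List.Relation.Unary.Unique.Propositional using (Unique)
open import Data.List.Relation.Unary.Unique.Propositional.Properties using (allFin⁺; upTo⁺) renaming (map⁺ to Unique-map⁺)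
open import Data.List.Relation.Binary.Sublist.Propositional using (_⊆_; []; _∷_; _∷ʳ_; ⊆-refl; ⊆-trans)
open import Data.List.Relation.Binary.Sublist.Propositional.Properties using (length-mono-≤; All-resp-⊆; Any-resp-⊆; take-⊆; drop-⊆)
open import Data.Product using (Σ; _×_; _,_; proj₁; proj₂)
open import Data.Sum using (_⊎_; inj₁; inj₂; swap)
open import Data.Empty using (⊥; ⊥-elim)
open import Data.Unit using (⊤; tt)
open import Function using (_∘_; case_of_)
open import Function.Definitions using (Injective)
open import Induction.WellFounded using (Acc; acc)
open import Relation.Nullary using (¬_; Dec; yes; no)
open import Relation.Nullary.Decidable using (⌊_⌋; _×-dec_)
open import Relation.Binary.Definitions using (Tri; tri<; tri≈; tri>)
open import Relation.Binary.PropositionalEquality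

-- Counting in lists

-- Both cases must control how two backward neighbours of one centre are joined, and smoothness says
-- nothing about that. Without backward triangles the order θ settles it. With them, leaves are
-- taken from a chain, and then only one run per star can be handled: at centre 1 the legs and
-- vertex 4 would lie in different places, with no control over the arcs between them. The order 4,
-- 1, 3, 5, 2 makes the arcs from 4 to 1 and from 5 to 2 forward; the price is that 2, 3, 4 become a
-- backward triangle, which is just what the second case supplies. Centres still need linear sets:
-- criticality compares a linear set with a piece of a chain, but says nothing about two pieces of
-- chains. Robustness is required because the components of H are placed one after another and each
-- shrinks the sets left for the others.
--
-- The contradiction for a critical `U` is reached under double negation, which is harmless because
-- the goal is ⊥. The induction itself branches on whether `U` has a chain of a given length, which
-- is decidable.

excluded-middle : ∀ {a} {P : Set a} → ¬ ¬ (P ⊎ ¬ P)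
excluded-middle f = f (inj₂ (λ p → f (inj₁ p)))

all-true : {X : Set} → List X → (X → Bool) → Bool
all-true [] q = true
all-true (x ∷ xs) q = if q x then all-true xs q else false

all-true-∈ : {X : Set} (xs : List X) (q : X → Bool) → all-true xs q ≡ true → ∀ {x} → x ∈ xs → q x ≡ true
all-true-∈ (y ∷ xs) q e i with q y in eq
all-true-∈ (y ∷ xs) q e (here refl) | true = eq
all-true-∈ (y ∷ xs) q e (there i) | true = all-true-∈ xs q e i

module _ {A : Set} where

  # : (A → Bool) → List A → ℕ
  # p xs = length (filterᵇ p xs)

  filterᵇ-⊆ : (p : A → Bool) (xs : List A) → filterᵇ p xs ⊆ xs
  filterᵇ-⊆ p [] = []
  filterᵇ-⊆ p (x ∷ xs) with p x
  ... | true = refl ∷ filterᵇ-⊆ p xs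
  ... | false = x ∷ʳ filterᵇ-⊆ p xs

  filterᵇ-true : (p : A → Bool) (xs : List A) → ∀ {x} → x ∈ filterᵇ p xs → p x ≡ true
  filterᵇ-true p (x ∷ xs) i with p x in eq
  filterᵇ-true p (x ∷ xs) (here refl) | true = eq
  filterᵇ-true p (x ∷ xs) (there i) | true = filterᵇ-true p xs i
  ... | false = filterᵇ-true p xs i

  ∈-filterᵇ : (p : A → Bool) {xs : List A} → ∀ {x} → x ∈ xs → p x ≡ true → x ∈ filterᵇ p xs
  ∈-filterᵇ p {y ∷ xs} (here refl) e rewrite e = here refl
  ∈-filterᵇ p {y ∷ xs} (there i) e with p y
  ... | true = there (∈-filterᵇ p i e)
  ... | false = ∈-filterᵇ p i e

  #-mono : (p : A → Bool) {xs ys : List A} → xs ⊆ ys → # p xs ≤ # p ys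
  #-mono p [] = z≤n
  #-mono p (y ∷ʳ s) with p y
  ... | true = m≤n⇒m≤1+n (#-mono p s)
  ... | false = #-mono p s
  #-mono p {x ∷ _} (refl ∷ s) with p x
  ... | true = s≤s (#-mono p s)
  ... | false = #-mono p s

  #≤length : (p : A → Bool) (xs : List A) → # p xs ≤ length xs
  #≤length p xs = length-mono-≤ (filterᵇ-⊆ p xs)

  #-weaken : (p q : A → Bool) (xs : List A) → (∀ {x} → x ∈ xs → p x ≡ true → q x ≡ true) → # p xs ≤ # q xs
  #-weaken p q [] f = z≤n
  #-weaken p q (x ∷ xs) f with p x in e1 | q x in e2
  ... | true | true = s≤s (#-weaken p q xs (f ∘ there))
  ... | true | false = ⊥-elim (case trans (sym e2) (f (here refl) e1) of λ ())
  ... | false | true = m≤n⇒m≤1+n (#-weaken p q xs (f ∘ there))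
  ... | false | false = #-weaken p q xs (f ∘ there)

  #-strict : (p q : A → Bool) (xs : List A) → (∀ {x} → x ∈ xs → p x ≡ true → q x ≡ true) →
    ∀ {y} → y ∈ xs → p y ≡ false → q y ≡ true → # p xs < # q xs
  #-strict p q (x ∷ xs) f (here refl) py qy rewrite py | qy = s≤s (#-weaken p q xs (f ∘ there))
  #-strict p q (x ∷ xs) f (there i) py qy with p x in e1 | q x in e2
  ... | true | true = s≤s (#-strict p q xs (f ∘ there) i py qy)
  ... | true | false = ⊥-elim (case trans (sym e2) (f (here refl) e1) of λ ())
  ... | false | true = m≤n⇒m≤1+n (#-strict p q xs (f ∘ there) i py qy)
  ... | false | false = #-strict p q xs (f ∘ there) i py qy

  #-none : (p : A → Bool) (xs : List A) → (∀ {x} → x ∈ xs → p x ≡ false) → # p xs ≡ 0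
  #-none p [] f = refl
  #-none p (x ∷ xs) f rewrite f (here refl) = #-none p xs (f ∘ there)

  #-split : (p : A → Bool) (xs : List A) → # p xs + # (not ∘ p) xs ≡ length xs
  #-split p [] = refl
  #-split p (x ∷ xs) with p x
  ... | true = cong suc (#-split p xs)
  ... | false = trans (+-suc _ _) (cong suc (#-split p xs))

  ∈-⊆ : {xs ys : List A} → xs ⊆ ys → ∀ {x} → x ∈ xs → x ∈ ys
  ∈-⊆ s = Any-resp-⊆ s

  AllPairs-⊆ : ∀ {R : A → A → Set} {xs ys} → xs ⊆ ys → AllPairs R ys → AllPairs R xs
  AllPairs-⊆ [] [] = []
  AllPairs-⊆ (y ∷ʳ s) (_ ∷ ps) = AllPairs-⊆ s ps
  AllPairs-⊆ (refl ∷ s) (p ∷ ps) = All-resp-⊆ s p ∷ AllPairs-⊆ s ps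

  nonempty : (xs : List A) → 0 < length xs → Σ A (_∈ xs)
  nonempty (x ∷ xs) _ = x , here refl

  -- A union bound with denominators cleared: every entry of `xs` costs at most `b / c` elements of
  -- `as`.
  survivors : {X : Set} (xs : List X) (Q : X → A → Bool) (c b : ℕ) (as : List A) →
    (∀ {x} → x ∈ xs → c * # (not ∘ Q x) as ≤ b) →
    c * length as ≤ c * # (λ a → all-true xs (λ x → Q x a)) as + length xs * b
  survivors [] Q c b as f = ≤-trans (*-monoʳ-≤ c (≤-reflexive (sym (all as)))) (m≤m+n _ 0)
    where
    all : ∀ as → # (λ a → true) as ≡ length as
    all [] = refl
    all (a ∷ as) = cong suc (all as)
  survivors (x ∷ xs) Q c b as f = begin
    c * length as ≤⟨ survivors xs Q c b as (f ∘ there) ⟩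
    c * # P as + length xs * b ≤⟨ +-monoˡ-≤ _ (*-monoʳ-≤ c (step as)) ⟩
    c * (# P' as + # (not ∘ Q x) as) + length xs * b ≡⟨ cong (_+ length xs * b) (*-distribˡ-+ c (# P' as) _) ⟩
    c * # P' as + c * # (not ∘ Q x) as + length xs * b ≤⟨ +-monoˡ-≤ _ (+-monoʳ-≤ (c * # P' as) (f (here refl))) ⟩
    c * # P' as + b + length xs * b ≡⟨ +-assoc (c * # P' as) b _ ⟩
    c * # P' as + (b + length xs * b) ∎
    where
    open ≤-Reasoning
    P P' : A → Bool
    P a = all-true xs (λ x → Q x a)
    P' a = all-true (x ∷ xs) (λ x → Q x a)
    step : ∀ as → # P as ≤ # P' as + # (not ∘ Q x) as
    step [] = z≤n
    step (a ∷ as) with Q x a | P a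
    ... | true | true = s≤s (step as)
    ... | true | false = step as
    ... | false | true = ≤-trans (s≤s (step as)) (≤-reflexive (sym (+-suc _ _)))
    ... | false | false = ≤-trans (step as) (+-monoʳ-≤ (# P' as) (n≤1+n _))

  -- Fewer than `c` conditions, each failing on at most a `1 / c` fraction, cannot exhaust a
  -- nonempty list.
  select : {X : Set} (xs : List X) (Q : X → A → Bool) (c : ℕ) (as : List A) →
    length xs < c → 0 < length as →
    (∀ {x} → x ∈ xs → c * # (not ∘ Q x) as ≤ length as) →
    Σ A λ a → a ∈ as × (∀ {x} → x ∈ xs → Q x a ≡ true)
  select xs Q c as lt pos f = proj₁ ne , ∈-⊆ (filterᵇ-⊆ P as) (proj₂ ne) ,
      all-true-∈ xs _ (filterᵇ-true P as (proj₂ ne))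
    where
    P : A → Bool
    P a = all-true xs (λ x → Q x a)
    positive : 0 < # P as
    positive = n≢0⇒n>0 λ e → <⇒≱ (*-monoˡ-< (length as) {{>-nonZero pos}} lt)
      (≤-trans (survivors xs Q c (length as) as f)
        (≤-reflexive (cong (_+ length xs * length as) (trans (cong (c *_) e) (*-zeroʳ c)))))
    ne : Σ A (_∈ filterᵇ P as)
    ne = nonempty (filterᵇ P as) positive

  -- Double counting the pairs of R in A × B: at most half of B has more than twice the average degree.
  markov : (R : A → A → Bool) (ℓ : ℕ) (as bs : List A) →
    (∀ {a} → a ∈ as → ℓ * # (R a) bs ≤ length bs) →
    Σ (List A) λ bs' → bs' ⊆ bs × length bs ≤ 2 * length bs' ×
      (∀ {b} → b ∈ bs' → ℓ * # (λ a → R a b) as ≤ 2 * length as)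
  markov R ℓ as bs f = filterᵇ good bs , filterᵇ-⊆ good bs , half , λ i → ≤ᵇ⇒≤ _ _ (subst T (sym (filterᵇ-true good bs i)) _)
    where
    good : A → Bool
    good b = (ℓ * # (λ a → R a b) as) ≤ᵇ (2 * length as)
    cross : List A → List A → ℕ
    cross [] bs = 0
    cross (a ∷ as) bs = # (R a) bs + cross as bs
    exchange : ∀ x y z → x + (y + z) ≡ y + (x + z)
    exchange = solve-∀
    cross-∷ : ∀ as b bs → cross as (b ∷ bs) ≡ # (λ a → R a b) as + cross as bs
    cross-∷ [] b bs = refl
    cross-∷ (a ∷ as) b bs with R a b
    ... | true = cong suc (trans (cong (# (R a) bs +_) (cross-∷ as b bs)) (exchange (# (R a) bs) (# (λ a → R a b) as) (cross as bs)))
    ... | false = trans (cong (# (R a) bs +_) (cross-∷ as b bs)) (exchange (# (R a) bs) (# (λ a → R a b) as) (cross as bs))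
    upper : ∀ as → (∀ {a} → a ∈ as → ℓ * # (R a) bs ≤ length bs) → ℓ * cross as bs ≤ length as * length bs
    upper [] g = ≤-reflexive (*-zeroʳ ℓ)
    upper (a ∷ as) g = ≤-trans (≤-reflexive (*-distribˡ-+ ℓ (# (R a) bs) _)) (+-mono-≤ (g (here refl)) (upper as (g ∘ there)))
    lower : ∀ bs → 2 * length as * # (not ∘ good) bs ≤ ℓ * cross as bs
    lower [] = ≤-trans (≤-reflexive (*-zeroʳ (2 * length as))) z≤n
    lower (b ∷ bs) with good b in e
    ... | true = ≤-trans (lower bs) (*-monoʳ-≤ ℓ (≤-trans (m≤n+m _ _) (≤-reflexive (sym (cross-∷ as b bs)))))
    ... | false = begin
      2 * length as * suc (# (not ∘ good) bs) ≡⟨ *-suc (2 * length as) _ ⟩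
      2 * length as + 2 * length as * # (not ∘ good) bs ≤⟨ +-mono-≤ big (lower bs) ⟩
      ℓ * # (λ a → R a b) as + ℓ * cross as bs ≡⟨ sym (*-distribˡ-+ ℓ (# (λ a → R a b) as) _) ⟩
      ℓ * (# (λ a → R a b) as + cross as bs) ≡⟨ cong (ℓ *_) (sym (cross-∷ as b bs)) ⟩
      ℓ * cross as (b ∷ bs) ∎
      where
      open ≤-Reasoning
      big : 2 * length as ≤ ℓ * # (λ a → R a b) as
      big = ≮⇒≥ λ lt → subst T e (≤⇒≤ᵇ (<⇒≤ lt))
    bad-half : 2 * # (not ∘ good) bs ≤ length bs
    -- The factor `length as` cannot be cancelled when it is 0, but then every `b` is good.
    bad-half with length as ≟ 0
    ... | yes e = ≤-trans (*-monoʳ-≤ 2 (≤-reflexive (#-none _ bs λ {b} _ → cong not (g0 b)))) z≤n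
      where
      g0 : ∀ b → good b ≡ true
      g0 b rewrite n≤0⇒n≡0 (subst (# (λ a → R a b) as ≤_) e (#≤length _ as)) | *-zeroʳ ℓ = refl
    ... | no ne = *-cancelˡ-≤ (length as) {{≢-nonZero ne}} (begin
      length as * (2 * # (not ∘ good) bs) ≡⟨ trans (sym (*-assoc (length as) 2 _)) (cong (_* # (not ∘ good) bs) (*-comm (length as) 2)) ⟩
      2 * length as * # (not ∘ good) bs ≤⟨ lower bs ⟩
      ℓ * cross as bs ≤⟨ upper as f ⟩
      length as * length bs ∎)
      where open ≤-Reasoning
    half : length bs ≤ 2 * # good bs
    half = +-cancelʳ-≤ (length bs) _ _ (begin
      length bs + length bs ≡⟨ cong₂ _+_ (sym (#-split good bs)) (sym (#-split good bs)) ⟩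
      # good bs + # (not ∘ good) bs + (# good bs + # (not ∘ good) bs) ≡⟨ shuffle (# good bs) (# (not ∘ good) bs) ⟩
      2 * # good bs + 2 * # (not ∘ good) bs ≤⟨ +-monoʳ-≤ (2 * # good bs) bad-half ⟩
      2 * # good bs + length bs ∎)
      where
      open ≤-Reasoning
      shuffle : ∀ x y → x + y + (x + y) ≡ 2 * x + 2 * y
      shuffle = solve-∀

  piece : ℕ → ℕ → List A → List A
  piece p j xs = take p (drop (j * p) xs)

  piece-⊆ : ∀ p j xs → piece p j xs ⊆ xs
  piece-⊆ p j xs = ⊆-trans (take-⊆ p _) (drop-⊆ (j * p) xs)

  length-piece : ∀ p j xs → suc j * p ≤ length xs → length (piece p j xs) ≡ p
  length-piece p j xs le = trans (length-take p _) (m≤n⇒m⊓n≡m (subst (p ≤_) (sym (length-drop (j * p) xs))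
    (≤-trans (≤-reflexive (sym (m+n∸n≡m p (j * p)))) (∸-monoˡ-≤ (j * p) le))))

  take-drop-≤ : ∀ {R : A → A → Set} a b xs → AllPairs R xs → a ≤ b →
    ∀ {x y} → x ∈ take a xs → y ∈ drop b xs → R x y
  take-drop-≤ (suc a) (suc b) (z ∷ xs) (h ∷ hs) (s≤s le) (here refl) j = All.lookup h (∈-⊆ (drop-⊆ b xs) j)
  take-drop-≤ (suc a) (suc b) (z ∷ xs) (h ∷ hs) (s≤s le) (there i) j = take-drop-≤ a b xs hs le i j

  take-of-drop : ∀ p a xs {x : A} → x ∈ take p (drop a xs) → x ∈ take (p + a) xs
  take-of-drop p zero xs {x} i = subst (λ z → x ∈ take z xs) (sym (+-identityʳ p)) i
  take-of-drop zero (suc a) (y ∷ xs) ()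
  take-of-drop (suc p) (suc a) (y ∷ xs) {x} i = there (subst (λ z → x ∈ take z xs) (sym (+-suc p a)) (take-of-drop (suc p) a xs i))

  piece-AllPairs : ∀ {R : A → A → Set} p {j j'} xs → AllPairs R xs → j < j' →
    ∀ {x y} → x ∈ piece p j xs → y ∈ piece p j' xs → R x y
  piece-AllPairs p {j} {j'} xs h lt i i' =
    take-drop-≤ (p + j * p) (j' * p) xs h (*-monoˡ-≤ p lt) (take-of-drop p (j * p) xs i) (∈-⊆ (take-⊆ p _) i')

-- Smooth pairs and smooth families

eqᵇ : Bool → Bool → Bool
eqᵇ true b = b
eqᵇ false b = not b

eqᵇ-true : ∀ {a b} → eqᵇ a b ≡ true → a ≡ b
eqᵇ-true {true} {true} e = refl
eqᵇ-true {false} {false} e = refl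

true≢false : true ≡ false → ⊥
true≢false ()

not-true : ∀ {b} → not b ≡ true → b ≡ false
not-true {false} e = refl

not-false : ∀ {b} → not b ≡ false → b ≡ true
not-false {true} e = refl

≤ᵇ-false : ∀ {m n} → (m ≤ᵇ n) ≡ false → n < m
≤ᵇ-false {m} {n} e = ≰⇒> λ le → subst T e (≤⇒≤ᵇ le)

≤ᵇ-true : ∀ {m n} → (m ≤ᵇ n) ≡ true → m ≤ n
≤ᵇ-true {m} {n} e = ≤ᵇ⇒≤ m n (subst T (sym e) _)

≤-chain-* : ∀ a b {x y z} → x ≤ a * y → y ≤ b * z → x ≤ a * b * z
≤-chain-* a b {x} {y} {z} p q = ≤-trans p (≤-trans (*-monoʳ-≤ a q) (≤-reflexive (sym (*-assoc a b z))))

∈⇒0<length : ∀ {A : Set} {x : A} {xs} → x ∈ xs → 0 < length xs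
∈⇒0<length (here _) = s≤s z≤n
∈⇒0<length (there _) = s≤s z≤n

update : ∀ {k} {A : Set} → (Fin k → A) → Fin k → A → Fin k → A
update f h v x with x ≟F h
... | yes _ = v
... | no _ = f x

update-same : ∀ {k} {A : Set} (f : Fin k → A) h v → update f h v h ≡ v
update-same f h v with h ≟F h
... | yes _ = refl
... | no ne = ⊥-elim (ne refl)

update-other : ∀ {k} {A : Set} (f : Fin k → A) h v {x} → x ≢ h → update f h v x ≡ f x
update-other f h v {x} ne with x ≟F h
... | yes e = ⊥-elim (ne e)
... | no _ = refl

-- Rounding down loses at most a factor 2 once the quotient is positive. This is the 2 in the
-- constants that come from cutting a list into equal blocks.
m≤2d[m/d] : ∀ m d .{{_ : NonZero d}} → d ≤ m → m ≤ 2 * d * (m / d)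
m≤2d[m/d] m d le = begin
  m ≡⟨ m≡m%n+[m/n]*n m d ⟩
  m % d + m / d * d ≤⟨ +-monoˡ-≤ _ (<⇒≤ (m%n<n m d)) ⟩
  d + m / d * d ≤⟨ +-monoˡ-≤ _ (≤-trans (≤-reflexive (sym (*-identityˡ d))) (*-monoˡ-≤ d (m≥n⇒m/n>0 le))) ⟩
  m / d * d + m / d * d ≡⟨ lemma (m / d) d ⟩
  2 * d * (m / d) ∎
  where
  open ≤-Reasoning
  lemma : ∀ x d → x * d + x * d ≡ 2 * d * x
  lemma = solve-∀

module Smoothness {n : ℕ} (T : Tournament n) where

  -- A precedes B, and every vertex has the wrong direction to at most a 1/ℓ fraction of the other set.
  record Smooth (ℓ : ℕ) (A B : List (Fin n)) : Set where
    constructor smooth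
    field
      out : ∀ {v} → v ∈ A → ℓ * # (λ w → not (adj T v w)) B ≤ length B
      inn : ∀ {w} → w ∈ B → ℓ * # (λ v → not (adj T v w)) A ≤ length A
      dis : ∀ {v} → v ∈ A → v ∈ B → ⊥

  open Smooth public

  private
    shrink-# : ∀ K ℓ (p : Fin n → Bool) {B B'} → B' ⊆ B → length B ≤ K * length B' →
      K * ℓ * # p B ≤ length B → ℓ * # p B' ≤ length B'
    shrink-# zero ℓ p {B} {B'} s le h = ≤-trans (≤-reflexive (trans (cong (ℓ *_) zero#) (*-zeroʳ ℓ))) z≤n
      where
      zero# : # p B' ≡ 0
      zero# = n≤0⇒n≡0 (≤-trans (#≤length p B') (≤-trans (length-mono-≤ s) le))
    shrink-# K@(suc _) ℓ p {B} {B'} s le h = *-cancelˡ-≤ K (begin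
      K * (ℓ * # p B') ≡⟨ sym (*-assoc K ℓ _) ⟩
      K * ℓ * # p B' ≤⟨ *-monoʳ-≤ (K * ℓ) (#-mono p s) ⟩
      K * ℓ * # p B ≤⟨ h ⟩
      length B ≤⟨ le ⟩
      K * length B' ∎)
      where open ≤-Reasoning

  -- The number of wrong arcs can only drop while the sets shrink by at most `K`, so the fraction of
  -- wrong arcs grows by at most `K`.
  Smooth-⊆ : ∀ K ℓ {A B A' B'} → Smooth (K * ℓ) A B → A' ⊆ A → B' ⊆ B →
    length A ≤ K * length A' → length B ≤ K * length B' → Smooth ℓ A' B'
  Smooth-⊆ K ℓ S sa sb la lb = smooth
    (λ i → shrink-# K ℓ _ sb lb (out S (∈-⊆ sa i)))
    (λ i → shrink-# K ℓ _ sa la (inn S (∈-⊆ sb i)))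
    (λ i j → dis S (∈-⊆ sa i) (∈-⊆ sb j))

  -- One-sided information suffices: averaging discards at most half of `B`. The factor in `2 * ℓ`
  -- pays both for the smaller `B'` and for allowing twice the average degree. `A` is kept whole,
  -- which matters when `A` is a short chain.
  markov-after : ∀ ℓ {A B} → (∀ {v} → v ∈ A → v ∈ B → ⊥) →
    (∀ {v} → v ∈ A → 2 * ℓ * # (λ w → not (adj T v w)) B ≤ length B) →
    Σ (List (Fin n)) λ B' → B' ⊆ B × length B ≤ 2 * length B' × Smooth ℓ A B'
  markov-after ℓ {A} {B} d f = let (B' , s , h , g) = markov (λ v w → not (adj T v w)) (2 * ℓ) A B f in B' , s , h , smooth
    (λ i → shrink-# 2 ℓ _ s h (f i))
    (λ i → *-cancelˡ-≤ 2 (≤-trans (≤-reflexive (sym (*-assoc 2 ℓ _))) (g i)))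
    (λ i j → d i (∈-⊆ s j))

  reverse : ∀ {v w} → v ≢ w → not (adj T w v) ≡ adj T v w
  reverse ne = sym (tour T _ _ ne)

  markov-before : ∀ ℓ {A B} → (∀ {v} → v ∈ A → v ∈ B → ⊥) →
    (∀ {v} → v ∈ A → 2 * ℓ * # (adj T v) B ≤ length B) →
    Σ (List (Fin n)) λ B' → B' ⊆ B × length B ≤ 2 * length B' × Smooth ℓ B' A
  markov-before ℓ {A} {B} d f = mk (markov (adj T) (2 * ℓ) A B f)
    where
    mk : (Σ (List (Fin n)) λ B' → B' ⊆ B × length B ≤ 2 * length B' ×
           (∀ {b} → b ∈ B' → 2 * ℓ * # (λ a → adj T a b) A ≤ 2 * length A)) →
         Σ (List (Fin n)) λ B' → B' ⊆ B × length B ≤ 2 * length B' × Smooth ℓ B' A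
    mk (B' , s , h , g) = B' , s , h , smooth
      (λ {w} i → *-cancelˡ-≤ 2 (≤-trans (*-monoʳ-≤ 2 (*-monoʳ-≤ ℓ
          (#-weaken _ _ A λ {v} j e → trans (sym (reverse λ { refl → d j (∈-⊆ s i) })) e)))
        (≤-trans (≤-reflexive (sym (*-assoc 2 ℓ _))) (g i))))
      (λ {v} i → ≤-trans (*-monoʳ-≤ ℓ (#-weaken _ _ B' λ {w} j e → trans (sym (reverse λ { refl → d i (∈-⊆ s j) })) e))
        (shrink-# 2 ℓ _ s h (f i)))
      (λ i j → d j (∈-⊆ s i))

-- The factors: `2 * k` for cutting a list into `k` blocks, `(2 * ℓ) ^ k` for the restrictions to
-- vertices that agree with those already chosen, `suc k` for the pigeonhole over the remaining
-- vertices of H, and 2 for `markov`.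
pairConst : ℕ → ℕ → ℕ
pairConst k ℓ = 2 * k * (2 * ℓ) ^ k * suc k * 2

structureConst : ℕ → ℕ → ℕ → ℕ
structureConst k zero ℓ = 1
structureConst k (suc r) ℓ = pairConst k (structureConst k r ℓ * ℓ) * structureConst k r ℓ

module SmoothPairs {n k : ℕ} (T : Tournament n) (H : Tournament k) (free : ¬ ContainsInduced T H) where
  open Smoothness T

  -- Injectivity is automatic: two distinct vertices of H with the same image would have no arc
  -- between them.
  realises⇒contains : (f : Fin k → Fin n) → (∀ i j → adj H i j ≡ adj T (f i) (f j)) → ContainsInduced T H
  realises⇒contains f e = f , inj , e
    where
    inj : ∀ {i j} → f i ≡ f j → i ≡ j
    inj {i} {j} eq with i ≟F j
    ... | yes p = p
    ... | no ne = ⊥-elim (true≢false (trans (sym (not-false' (trans (sym (tour H i j ne)) (f0 i j eq)))) (f0 j i (sym eq))))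
      where
      f0 : ∀ i j → f i ≡ f j → adj H i j ≡ false
      f0 i j eq = trans (e i j) (trans (cong (adj T (f i)) (sym eq)) (irrefl T (f i)))
      not-false' : ∀ {b} → not b ≡ false → b ≡ true
      not-false' = not-false

  SmoothPair : ℕ → ℕ → List (Fin n) → Set
  SmoothPair ℓ κ A = Σ (List (Fin n)) λ B → Σ (List (Fin n)) λ C →
    B ⊆ A × C ⊆ A × Smooth ℓ B C × length A ≤ κ * length B × length A ≤ κ * length C

  private
    -- If a copy of H cannot be extended greedily, many candidates for one vertex fail for the same other set W h',
    -- and together with W h' they form a smooth pair.
    module Greedy (ℓ κ : ℕ) .{{_ : NonZero ℓ}} (A : List (Fin n)) (v₀ : Fin n) (v₀∈A : v₀ ∈ A)
                  (noPair : ¬ SmoothPair ℓ κ A) where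
      c = suc k
      L = 2 * ℓ

      instance
        L≢0 : NonZero L
        L≢0 = m*n≢0 2 ℓ

      posA : 0 < length A
      posA = ∈⇒0<length v₀∈A

      agree : Fin k → Fin k → Fin n → Fin n → Bool
      agree h h' v w = eqᵇ (adj T v w) (adj H h h')

      -- Almost all arcs between `B` and `W` run against the arc that H has between `h` and `h'`, so
      -- the direction of that arc decides which of the two sets comes first.
      few : ∀ (h h' : Fin k) K {B W} → B ⊆ A → W ⊆ A → (∀ {v} → v ∈ B → v ∈ W → ⊥) →
        K * c * 2 ≤ κ → length A ≤ K * c * length B → length A ≤ K * length W →
        (∀ {v} → v ∈ B → L * # (agree h h' v) W ≤ length W) → SmoothPair ℓ κ A
      few h h' K {B} {W} sb sw d hK lb lw f = go (adj H h h') refl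
        where
        lw' : ∀ W' → length W ≤ 2 * length W' → length A ≤ κ * length W'
        lw' W' le = ≤-trans (≤-chain-* K 2 lw le) (*-monoˡ-≤ (length W') (≤-trans (*-monoˡ-≤ 2 (m≤m*n K c)) hK))
        lb' : length A ≤ κ * length B
        lb' = ≤-trans lb (*-monoˡ-≤ (length B) (≤-trans (m≤m*n (K * c) 2) hK))
        go : ∀ b → adj H h h' ≡ b → SmoothPair ℓ κ A
        go true e = mk (markov-before ℓ {B} {W} d (λ i → ≤-trans (*-monoʳ-≤ L (#-weaken _ _ W (λ _ e' → cong₂ eqᵇ e' e))) (f i)))
          where
          mk : (Σ (List (Fin n)) λ W' → W' ⊆ W × length W ≤ 2 * length W' × Smooth ℓ W' B) → SmoothPair ℓ κ A
          mk (W' , s , le , S) = W' , B , ⊆-trans s sw , sb , S , lw' W' le , lb'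
        go false e = mk (markov-after ℓ {B} {W} d (λ i → ≤-trans (*-monoʳ-≤ L (#-weaken _ _ W (λ _ e' → cong₂ eqᵇ (not-true e') e))) (f i)))
          where
          mk : (Σ (List (Fin n)) λ W' → W' ⊆ W × length W ≤ 2 * length W' × Smooth ℓ B W') → SmoothPair ℓ κ A
          mk (W' , s , le , S) = B , W' , sb , ⊆-trans s sw , S , lb' , lw' W' le

      greedy : ∀ hs K (W : Fin k → List (Fin n)) → Unique hs → length hs < c →
        (∀ h → W h ⊆ A) → (∀ {h h'} → h ≢ h' → ∀ {v} → v ∈ W h → v ∈ W h' → ⊥) →
        (∀ {h} → h ∈ hs → length A ≤ K * length (W h)) → K * L ^ length hs * c * 2 ≤ κ →
        Σ (Fin k → Fin n) λ f → (∀ {h} → h ∈ hs → f h ∈ W h) ×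
          (∀ {h h'} → h ∈ hs → h' ∈ hs → adj H h h' ≡ adj T (f h) (f h'))
      greedy [] K W _ _ _ _ _ _ = (λ _ → v₀) , (λ ()) , λ ()
      greedy (h ∷ hs) K W (h∉ ∷ u) len sub dj large hK = f , f∈ , f-adj
        where
        Q : Fin k → Fin n → Bool
        Q h' v = length (W h') ≤ᵇ L * # (agree h h' v) (W h')

        fails : ∀ {h'} → h' ∈ hs → c * # (not ∘ Q h') (W h) ≤ length (W h)
        fails {h'} i = ≮⇒≥ λ lt → noPair (few h h' K {filterᵇ (not ∘ Q h') (W h)} {W h'}
            (⊆-trans (filterᵇ-⊆ _ (W h)) (sub h)) (sub h')
            (λ a b → dj (All.lookup h∉ i) (∈-⊆ (filterᵇ-⊆ _ (W h)) a) b)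
            (≤-trans (*-monoˡ-≤ 2 (*-monoˡ-≤ c (m≤m*n K (L ^ length (h ∷ hs)) {{m^n≢0 L (length (h ∷ hs))}}))) hK)
            (≤-chain-* K c (large (here refl)) (<⇒≤ lt))
            (large (there i))
            (λ a → <⇒≤ (≤ᵇ-false (not-true (filterᵇ-true (not ∘ Q h') (W h) a)))))

        posW : 0 < length (W h)
        posW = n≢0⇒n>0 λ e → <⇒≱ posA (≤-trans (large (here refl)) (≤-reflexive (trans (cong (K *_) e) (*-zeroʳ K))))

        chosen = select hs Q c (W h) (<-trans (n<1+n _) len) posW fails
        v = proj₁ chosen
        v∈ : v ∈ W h
        v∈ = proj₁ (proj₂ chosen)

        W' : Fin k → List (Fin n)
        W' h' = filterᵇ (agree h h' v) (W h')

        W'⊆W : ∀ h' → W' h' ⊆ W h'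
        W'⊆W h' = filterᵇ-⊆ _ (W h')

        rec = greedy hs (K * L) W' u (<-trans (n<1+n _) len) (λ h' → ⊆-trans (W'⊆W h') (sub h'))
          (λ ne a b → dj ne (∈-⊆ (W'⊆W _) a) (∈-⊆ (W'⊆W _) b))
          (λ i → ≤-chain-* K L (large (there i)) (≤ᵇ-true (proj₂ (proj₂ chosen) i)))
          (≤-trans (≤-reflexive (cong (λ z → z * c * 2) (*-assoc K L _))) hK)

        f' = proj₁ rec
        f : Fin k → Fin n
        f = update f' h v

        f-h : f h ≡ v
        f-h = update-same f' h v

        f-hs : ∀ {x} → x ∈ hs → f x ≡ f' x
        f-hs i = update-other f' h v λ e → All.lookup h∉ i (sym e)

        f∈ : ∀ {x} → x ∈ h ∷ hs → f x ∈ W x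
        f∈ (here refl) = subst (_∈ W h) (sym f-h) v∈
        f∈ {x} (there i) = subst (_∈ W x) (sym (f-hs i)) (∈-⊆ (W'⊆W x) (proj₁ (proj₂ rec) i))

        forwards : ∀ {x} → x ∈ hs → adj H h x ≡ adj T v (f' x)
        forwards {x} i = sym (eqᵇ-true (filterᵇ-true (agree h x v) (W x) (proj₁ (proj₂ rec) i)))

        backwards : ∀ {x} → x ∈ hs → adj H x h ≡ adj T (f' x) v
        backwards {x} i = trans (tour H x h (λ e → All.lookup h∉ i (sym e))) (trans (cong not (forwards i))
          (sym (tour T (f' x) v λ e → dj (λ e' → All.lookup h∉ i e') v∈ (subst (_∈ W x) e (∈-⊆ (W'⊆W x) (proj₁ (proj₂ rec) i))))))

        f-adj : ∀ {x y} → x ∈ h ∷ hs → y ∈ h ∷ hs → adj H x y ≡ adj T (f x) (f y)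
        f-adj (here refl) (here refl) = trans (irrefl H h) (sym (irrefl T (f h)))
        f-adj (here refl) (there j) = trans (forwards j) (cong₂ (adj T) (sym f-h) (sym (f-hs j)))
        f-adj (there i) (here refl) = trans (backwards i) (cong₂ (adj T) (sym (f-hs i)) (sym f-h))
        f-adj (there i) (there j) = trans (proj₂ (proj₂ rec) i j) (cong₂ (adj T) (sym (f-hs i)) (sym (f-hs j)))

  -- The empty tournament is contained in every `T`.
  pattern-nonempty : ∀ j → k ≡ j → NonZero j
  pattern-nonempty zero refl = ⊥-elim (free ((λ ()) , (λ {i} → λ { {()} }) , λ ()))
  pattern-nonempty (suc _) _ = _

  -- If there is no pair, the greedy embedding never gets stuck and `T` contains H. The absence of a
  -- pair is refuted without exhibiting one, hence the double negation.
  smooth-pair : ∀ ℓ .{{_ : NonZero ℓ}} A → Unique A → pairConst k ℓ ≤ length A → ¬ ¬ SmoothPair ℓ (pairConst k ℓ) A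
  smooth-pair ℓ A u le noPair = free (realises⇒contains f (λ i j → proj₂ (proj₂ found) (∈-allFin i) (∈-allFin j)))
    where
    instance
      k≢0' : NonZero k
      k≢0' = pattern-nonempty k refl
      L≢0 : NonZero (2 * ℓ)
      L≢0 = m*n≢0 2 ℓ
    κ = pairConst k ℓ
    k≤ : k ≤ length A
    k≤ = ≤-trans (begin
      k ≤⟨ m≤n*m k 2 ⟩
      2 * k ≤⟨ m≤m*n (2 * k) ((2 * ℓ) ^ k) {{m^n≢0 (2 * ℓ) k}} ⟩
      2 * k * (2 * ℓ) ^ k ≤⟨ m≤m*n _ (suc k) ⟩
      2 * k * (2 * ℓ) ^ k * suc k ≤⟨ m≤m*n _ 2 ⟩
      κ ∎) le
      where open ≤-Reasoning
    p = length A / k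
    W : Fin k → List (Fin n)
    W h = piece p (toℕ h) A
    lenW : ∀ h → length (W h) ≡ p
    lenW h = length-piece p (toℕ h) A (≤-trans (*-monoˡ-≤ p (toℕ<n h)) (≤-trans (≤-reflexive (*-comm k p)) (m/n*n≤m (length A) k)))
    W-disjoint : ∀ {h h'} → h ≢ h' → ∀ {v} → v ∈ W h → v ∈ W h' → ⊥
    W-disjoint {h} {h'} ne i j with <-cmp (toℕ h) (toℕ h')
    ... | tri< lt _ _ = piece-AllPairs p A u lt i j refl
    ... | tri≈ _ e _ = ne (toℕ-injective e)
    ... | tri> _ _ gt = piece-AllPairs p A u gt j i refl
    first = nonempty A (≤-trans (>-nonZero⁻¹ k) k≤)
    found = Greedy.greedy ℓ κ A (proj₁ first) (proj₂ first) noPair (allFin k) (2 * k) W (allFin⁺ k)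
      (s≤s (≤-reflexive (length-tabulate {n = k} (λ x → x)))) (λ h → piece-⊆ p (toℕ h) A) W-disjoint
      (λ {h} _ → subst (λ z → length A ≤ 2 * k * z) (sym (lenW h)) (m≤2d[m/d] (length A) k k≤))
      (≤-reflexive (cong (λ z → 2 * k * (2 * ℓ) ^ z * suc k * 2) (length-tabulate {n = k} (λ x → x))))
    f = proj₁ found

  pairConst≢0 : ∀ ℓ .{{_ : NonZero ℓ}} → NonZero (pairConst k ℓ)
  pairConst≢0 ℓ = m*n≢0 _ 2 {{m*n≢0 _ (suc k) {{m*n≢0 (2 * k) _ {{m*n≢0 2 k {{_}} {{pattern-nonempty k refl}}}} {{m^n≢0 (2 * ℓ) k {{m*n≢0 2 ℓ}}}}}}}}

  structureConst≢0 : ∀ r ℓ .{{_ : NonZero ℓ}} → NonZero (structureConst k r ℓ)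
  structureConst≢0 zero ℓ = _
  structureConst≢0 (suc r) ℓ = m*n≢0 _ _ {{pairConst≢0 _ {{m*n≢0 (structureConst k r ℓ) ℓ {{structureConst≢0 r ℓ}}}}}} {{structureConst≢0 r ℓ}}

  Structure : ℕ → ℕ → ℕ → List (Fin n) → Set
  Structure N ℓ κ A = Σ (List (List (Fin n))) λ Es → length Es ≡ N ×
    All (λ E → E ⊆ A × length A ≤ κ * length E) Es × AllPairs (Smooth ℓ) Es

  -- Each level takes a smooth pair and recurses inside both of its sets. Pairs across the two
  -- halves stay smooth because the outer pair was chosen `κ₁` times smoother than needed, `κ₁`
  -- being the loss of the inner level.
  smooth-structure : ∀ r ℓ .{{_ : NonZero ℓ}} A → Unique A → structureConst k r ℓ ≤ length A →
    ¬ ¬ Structure (2 ^ r) ℓ (structureConst k r ℓ) A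
  smooth-structure zero ℓ A u le ne = ne (A ∷ [] , refl , (⊆-refl , ≤-reflexive (sym (*-identityˡ _))) ∷ [] , [] ∷ [])
  smooth-structure (suc r) ℓ A u le ne =
    smooth-pair (κ₁ * ℓ) {{ℓ₁≢0}} A u (≤-trans (m≤m*n κ₂ κ₁ {{κ₁≢0}}) le)
      λ { (B , C , sB , sC , S , lB , lC) →
        smooth-structure r ℓ B (AllPairs-⊆ sB u) (big B lB) λ { (Es , lenE , allE , smE) →
        smooth-structure r ℓ C (AllPairs-⊆ sC u) (big C lC) λ { (Fs , lenF , allF , smF) →
        ne (Es ++ Fs
           , trans (length-++ Es) (trans (cong₂ _+_ lenE lenF) (cong (2 ^ r +_) (sym (+-identityʳ (2 ^ r)))))
           , AllP.++⁺ (All.map (λ { (s , l) → ⊆-trans s sB , ≤-chain-* κ₂ κ₁ lB l }) allE)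
                      (All.map (λ { (s , l) → ⊆-trans s sC , ≤-chain-* κ₂ κ₁ lC l }) allF)
           , AllPairsP.++⁺ smE smF (All.map (λ { (s , l) → All.map (λ { (s' , l') →
               Smooth-⊆ κ₁ ℓ S s s' l l' }) allF }) allE)) } } }
    where
    κ₁ = structureConst k r ℓ
    κ₂ = pairConst k (κ₁ * ℓ)
    κ₁≢0 : NonZero κ₁
    κ₁≢0 = structureConst≢0 r ℓ
    ℓ₁≢0 : NonZero (κ₁ * ℓ)
    ℓ₁≢0 = m*n≢0 κ₁ ℓ {{κ₁≢0}}
    big : ∀ B → length A ≤ κ₂ * length B → κ₁ ≤ length B
    big B l = *-cancelˡ-≤ κ₂ {{pairConst≢0 _ {{ℓ₁≢0}}}} (≤-trans le l)

-- Embedding H component by component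

if-yes : ∀ {P A : Set} (d : Dec P) {x y : A} → P → (if ⌊ d ⌋ then x else y) ≡ x
if-yes (yes _) p = refl
if-yes (no np) p = ⊥-elim (np p)

if-no : ∀ {P A : Set} (d : Dec P) {x y : A} → ¬ P → (if ⌊ d ⌋ then x else y) ≡ y
if-no (yes p) np = ⊥-elim (np p)
if-no (no _) np = refl

module Embedding {n k : ℕ} (T : Tournament n) (H : Tournament k) where

  Realises : (Fin k → Set) → (Fin k → List (Fin n)) → (Fin k → Fin n) → Set
  Realises P F f = (∀ {h} → P h → f h ∈ F h) × (∀ {h h'} → P h → P h' → adj H h h' ≡ adj T (f h) (f h'))

  wrong : Fin k → Fin k → Fin n → Fin n → Bool
  wrong h h' v w = not (eqᵇ (adj T v w) (adj H h h'))

  -- Arcs between different components are right for almost all choices, so a union bound handles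
  -- them. Arcs inside a component are left to `robust`, which has to succeed in any subsets that
  -- keep half of the elements.
  module _ (F : Fin k → List (Fin n)) (comp : Fin k → Fin k)
           (apart : ∀ {h h'} → comp h ≢ comp h' → ∀ {v} → v ∈ F h → v ∈ F h' → ⊥)
           (ℓ : ℕ) .{{ℓ≢0 : NonZero ℓ}} (2k²≤ℓ : 2 * (k * k) ≤ ℓ)
           (mostly : ∀ {h h'} → comp h ≢ comp h' → ∀ {v} → v ∈ F h → ℓ * # (wrong h h' v) (F h') ≤ length (F h'))
           (robust : ∀ c F' → (∀ h → F' h ⊆ F h) → (∀ {h} → comp h ≡ c → length (F h) ≤ 2 * length (F' h)) →
              Σ (Fin k → Fin n) (Realises (λ h → comp h ≡ c) F'))
           (v₀ : Fin n) where

    private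
      -- Each of the j placed components costs every other set at most a fraction k/ℓ; in total at most one half is lost.
      place : ∀ cs j (F' : Fin k → List (Fin n)) → Unique cs → j + length cs ≤ k → (∀ h → F' h ⊆ F h) →
        (∀ {h} → comp h ∈ cs → ℓ * length (F h) ≤ ℓ * length (F' h) + j * (k * length (F h))) →
        Σ (Fin k → Fin n) (Realises (λ h → comp h ∈ cs) F')
      place [] j F' _ _ _ _ = (λ _ → v₀) , (λ ()) , λ ()
      place (c ∷ cs) j F' (c∉ ∷ u) len sub large = f , f∈ , f-adj
        where
        half : ∀ {h} → comp h ≡ c → length (F h) ≤ 2 * length (F' h)
        half {h} e = *-cancelˡ-≤ ℓ (+-cancelʳ-≤ (ℓ * length (F h)) _ _ (begin
          ℓ * length (F h) + ℓ * length (F h) ≡⟨ double (ℓ * length (F h)) ⟩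
          2 * (ℓ * length (F h)) ≤⟨ *-monoʳ-≤ 2 (large (here e)) ⟩
          2 * (ℓ * length (F' h) + j * (k * length (F h))) ≡⟨ regroup ℓ (length (F' h)) j k (length (F h)) ⟩
          ℓ * (2 * length (F' h)) + 2 * (j * k) * length (F h) ≤⟨ +-monoʳ-≤ (ℓ * (2 * length (F' h))) (*-monoˡ-≤ (length (F h))
            (≤-trans (*-monoʳ-≤ 2 (*-monoˡ-≤ k (≤-trans (m≤m+n j _) len))) 2k²≤ℓ)) ⟩
          ℓ * (2 * length (F' h)) + ℓ * length (F h) ∎))
          where
          open ≤-Reasoning
          double : ∀ x → x + x ≡ 2 * x
          double = solve-∀
          regroup : ∀ ℓ a j k b → 2 * (ℓ * a + j * (k * b)) ≡ ℓ * (2 * a) + 2 * (j * k) * b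
          regroup = solve-∀

        here-f = robust c F' sub half
        g = proj₁ here-f

        Q : Fin k → Fin k → Fin n → Bool
        Q h' h w = if ⌊ comp h ≟F c ⌋ then eqᵇ (adj T (g h) w) (adj H h h') else true

        F'' : Fin k → List (Fin n)
        F'' h' = filterᵇ (λ w → all-true (allFin k) (λ h → Q h' h w)) (F' h')

        F''⊆F' : ∀ h → F'' h ⊆ F' h
        F''⊆F' h = filterᵇ-⊆ _ (F' h)

        F''-agrees : ∀ {h h' w} → comp h ≡ c → w ∈ F'' h' → adj H h h' ≡ adj T (g h) w
        F''-agrees {h} {h'} {w} e i = use (all-true-∈ (allFin k) (λ h → Q h' h w) (filterᵇ-true _ (F' h') i) (∈-allFin h))
          where
          use : Q h' h w ≡ true → adj H h h' ≡ adj T (g h) w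
          use q = sym (eqᵇ-true (trans (sym (if-yes (comp h ≟F c) {eqᵇ (adj T (g h) _) (adj H h h')} {true} e)) q))

        few-fail : ∀ {h'} → comp h' ∈ cs → ∀ h → ℓ * # (not ∘ Q h' h) (F' h') ≤ length (F h')
        few-fail {h'} i h = go (comp h ≟F c)
          where
          go : Dec (comp h ≡ c) → ℓ * # (not ∘ Q h' h) (F' h') ≤ length (F h')
          go (yes e) = ≤-trans (*-monoʳ-≤ ℓ (≤-trans
              (#-weaken (not ∘ Q h' h) (wrong h h' (g h)) (F' h') (λ _ q → trans (cong not (sym (if-yes (comp h ≟F c) {eqᵇ (adj T (g h) _) (adj H h h')} {true} e))) q))
              (#-mono _ (sub h'))))
            (mostly (λ e' → All.lookup c∉ i (trans (sym e) e')) (∈-⊆ (sub h) (proj₁ (proj₂ here-f) e)))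
          go (no ne) = ≤-trans (≤-reflexive (trans (cong (ℓ *_)
              (#-none (not ∘ Q h' h) (F' h') λ _ → cong not (if-no (comp h ≟F c) ne))) (*-zeroʳ ℓ))) z≤n

        large' : ∀ {h} → comp h ∈ cs → ℓ * length (F h) ≤ ℓ * length (F'' h) + suc j * (k * length (F h))
        large' {h'} i = begin
          ℓ * length (F h') ≤⟨ large (there i) ⟩
          ℓ * length (F' h') + j * (k * length (F h')) ≤⟨ +-monoˡ-≤ _ (survivors (allFin k) (Q h') ℓ (length (F h')) (F' h') (λ {h} _ → few-fail i h)) ⟩
          ℓ * length (F'' h') + length (allFin k) * length (F h') + j * (k * length (F h')) ≡⟨ cong (λ z → ℓ * length (F'' h') + z * length (F h') + j * (k * length (F h'))) (length-tabulate {n = k} (λ x → x)) ⟩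
          ℓ * length (F'' h') + k * length (F h') + j * (k * length (F h')) ≡⟨ +-assoc (ℓ * length (F'' h')) _ _ ⟩
          ℓ * length (F'' h') + suc j * (k * length (F h')) ∎
          where open ≤-Reasoning

        rec = place cs (suc j) F'' u (≤-trans (≤-reflexive (sym (+-suc j _))) len) (λ h → ⊆-trans (F''⊆F' h) (sub h)) large'
        f' = proj₁ rec

        f : Fin k → Fin n
        f h = if ⌊ comp h ≟F c ⌋ then g h else f' h

        f-c : ∀ {h} → comp h ≡ c → f h ≡ g h
        f-c {h} e = if-yes (comp h ≟F c) e

        f-cs : ∀ {h} → comp h ∈ cs → f h ≡ f' h
        f-cs {h} i = if-no (comp h ≟F c) λ e → All.lookup c∉ i (sym e)

        f∈ : ∀ {h} → comp h ∈ c ∷ cs → f h ∈ F' h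
        f∈ {h} (here e) = subst (_∈ F' h) (sym (f-c e)) (proj₁ (proj₂ here-f) e)
        f∈ {h} (there i) = subst (_∈ F' h) (sym (f-cs i)) (∈-⊆ (F''⊆F' h) (proj₁ (proj₂ rec) i))

        forwards : ∀ {h h'} → comp h ≡ c → comp h' ∈ cs → adj H h h' ≡ adj T (g h) (f' h')
        forwards e i = F''-agrees e (proj₁ (proj₂ rec) i)

        backwards : ∀ {h h'} → comp h ≡ c → comp h' ∈ cs → adj H h' h ≡ adj T (f' h') (g h)
        backwards {h} {h'} e i = trans (tour H h' h (λ eq → All.lookup c∉ i (trans (sym e) (cong comp (sym eq)))))
          (trans (cong not (forwards e i)) (sym (tour T (f' h') (g h) λ eq →
            apart (λ e' → All.lookup c∉ i (trans (sym e) e')) (∈-⊆ (sub h) (proj₁ (proj₂ here-f) e))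
              (subst (_∈ F h') eq (∈-⊆ (⊆-trans (F''⊆F' h') (sub h')) (proj₁ (proj₂ rec) i))))))

        f-adj : ∀ {h h'} → comp h ∈ c ∷ cs → comp h' ∈ c ∷ cs → adj H h h' ≡ adj T (f h) (f h')
        f-adj (here i) (here j) = trans (proj₂ (proj₂ here-f) i j) (cong₂ (adj T) (sym (f-c i)) (sym (f-c j)))
        f-adj (here i) (there j) = trans (forwards i j) (cong₂ (adj T) (sym (f-c i)) (sym (f-cs j)))
        f-adj (there i) (here j) = trans (backwards j i) (cong₂ (adj T) (sym (f-cs i)) (sym (f-c j)))
        f-adj (there i) (there j) = trans (proj₂ (proj₂ rec) i j) (cong₂ (adj T) (sym (f-cs i)) (sym (f-cs j)))

    embed : Σ (Fin k → Fin n) λ f → ∀ h h' → adj H h h' ≡ adj T (f h) (f h')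
    embed = let (f , _ , e) = place (allFin k) 0 F (allFin⁺ k) (≤-reflexive (length-tabulate {n = k} (λ x → x))) (λ _ → ⊆-refl) (λ _ → m≤m+n _ _)
            in f , λ h h' → e (∈-allFin (comp h)) (∈-allFin (comp h'))

  hits : Fin k → Fin k → List (Fin n) → Fin n → Bool
  hits c l B a = not (length (filterᵇ (λ b → eqᵇ (adj T a b) (adj H c l)) B) ≡ᵇ 0)

  hits-witness : ∀ c l B a → hits c l B a ≡ true → Σ (Fin n) λ b → b ∈ B × adj T a b ≡ adj H c l
  hits-witness c l B a e with filterᵇ (λ b → eqᵇ (adj T a b) (adj H c l)) B in eq
  ... | b ∷ _ = b , ∈-⊆ (filterᵇ-⊆ _ B) b∈ , eqᵇ-true (filterᵇ-true _ B b∈)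
    where
    b∈ : b ∈ filterᵇ (λ b → eqᵇ (adj T a b) (adj H c l)) B
    b∈ = subst (b ∈_) (sym eq) (here refl)

  misses : ∀ c l B a → hits c l B a ≡ false → ∀ {b} → b ∈ B → adj T a b ≡ not (adj H c l)
  misses c l B a e {b} i with filterᵇ (λ b → eqᵇ (adj T a b) (adj H c l)) B in eq
  ... | [] = diff (adj T a b) (adj H c l) λ q → empty (subst (b ∈_) eq (∈-filterᵇ _ i q))
    where
    empty : b ∈ [] → ⊥
    empty ()
    diff : ∀ x y → ¬ (eqᵇ x y ≡ true) → x ≡ not y
    diff true true ne = ⊥-elim (ne refl)
    diff true false ne = refl
    diff false true ne = refl
    diff false false ne = ⊥-elim (ne refl)

  -- A union bound gives a vertex for the centre that hits the sets of all leaves at once. Each leaf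
  -- may then be any witness, since `coherent` fixes the arcs between leaves whatever the choice.
  star-robust : (F : Fin k → List (Fin n)) (c : Fin k) (leaf : Fin k → Bool) →
    leaf c ≡ false → 0 < length (F c) →
    (∀ {l} → leaf l ≡ true → ∀ {v} → v ∈ F c → v ∈ F l → ⊥) →
    (∀ {l} → leaf l ≡ true → suc k * # (not ∘ hits c l (F l)) (F c) ≤ length (F c)) →
    (∀ {l l' a b b'} → leaf l ≡ true → leaf l' ≡ true → l ≢ l' → a ∈ F c → b ∈ F l → b' ∈ F l' →
       adj T a b ≡ adj H c l → adj T a b' ≡ adj H c l' → adj H l l' ≡ adj T b b') →
    Σ (Fin k → Fin n) (Realises (λ h → h ≡ c ⊎ leaf h ≡ true) F)
  star-robust F c leaf c-no pos dis few coherent = f , f∈ , f-adj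
    where
    Q : Fin k → Fin n → Bool
    Q l a = if leaf l then hits c l (F l) a else true
    few' : ∀ l → suc k * # (not ∘ Q l) (F c) ≤ length (F c)
    few' l = go (leaf l) refl
      where
      go : ∀ x → leaf l ≡ x → suc k * # (λ a → not (if x then hits c l (F l) a else true)) (F c) ≤ length (F c)
      go true e = few e
      go false e = ≤-trans (≤-reflexive (trans (cong (suc k *_) (#-none _ (F c) λ _ → refl)) (*-zeroʳ (suc k)))) z≤n
    centre = select (allFin k) Q (suc k) (F c) (s≤s (≤-reflexive (length-tabulate {n = k} (λ x → x)))) pos (λ {l} _ → few' l)
    a = proj₁ centre
    a∈ : a ∈ F c
    a∈ = proj₁ (proj₂ centre)
    pick : ∀ l → leaf l ≡ true → Σ (Fin n) λ b → b ∈ F l × adj T a b ≡ adj H c l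
    pick l e = hits-witness c l (F l) a (use (leaf l) e (proj₂ (proj₂ centre) (∈-allFin l)))
      where
      use : ∀ x → x ≡ true → (if x then hits c l (F l) a else true) ≡ true → hits c l (F l) a ≡ true
      use true _ q = q
    -- The flag comes with its equation so that `pick` receives the proof it needs. The value `a`
    -- serves the centre and is a mere default outside the star.
    f₀ : ∀ l x → leaf l ≡ x → Fin n
    f₀ l true e = proj₁ (pick l e)
    f₀ l false e = a
    f : Fin k → Fin n
    f l = f₀ l (leaf l) refl
    f-c : f c ≡ a
    f-c = go (leaf c) refl c-no
      where
      go : ∀ x (e : leaf c ≡ x) → x ≡ false → f₀ c x e ≡ a
      go false e _ = refl
    f-leaf : ∀ {l} → leaf l ≡ true → f l ∈ F l × adj T a (f l) ≡ adj H c l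
    f-leaf {l} = go (leaf l) refl
      where
      go : ∀ x (e : leaf l ≡ x) → x ≡ true → f₀ l x e ∈ F l × adj T a (f₀ l x e) ≡ adj H c l
      go true e _ = proj₂ (pick l e)
    f∈ : ∀ {h} → h ≡ c ⊎ leaf h ≡ true → f h ∈ F h
    f∈ (inj₁ refl) = subst (_∈ F c) (sym f-c) a∈
    f∈ (inj₂ e) = proj₁ (f-leaf e)
    leaf≢c : ∀ {l} → leaf l ≡ true → l ≢ c
    leaf≢c e refl = true≢false (trans (sym e) c-no)
    f-adj : ∀ {h h'} → h ≡ c ⊎ leaf h ≡ true → h' ≡ c ⊎ leaf h' ≡ true → adj H h h' ≡ adj T (f h) (f h')
    f-adj (inj₁ refl) (inj₁ refl) = trans (irrefl H c) (sym (irrefl T (f c)))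
    f-adj {h' = h'} (inj₁ refl) (inj₂ e) = trans (sym (proj₂ (f-leaf e))) (cong (λ z → adj T z (f h')) (sym f-c))
    f-adj {h} (inj₂ e) (inj₁ refl) = trans (tour H h c (leaf≢c e)) (trans (cong not (sym (proj₂ (f-leaf e))))
      (trans (sym (tour T (f h) a λ eq → dis e a∈ (subst (_∈ F h) eq (proj₁ (f-leaf e))))) (cong (adj T (f h)) (sym f-c))))
    f-adj {h} {h'} (inj₂ e) (inj₂ e') = go (h ≟F h')
      where
      go : Dec (h ≡ h') → adj H h h' ≡ adj T (f h) (f h')
      go (yes refl) = trans (irrefl H h) (sym (irrefl T (f h)))
      go (no ne) = coherent e e' ne a∈ (proj₁ (f-leaf e)) (proj₁ (f-leaf e')) (proj₂ (f-leaf e)) (proj₂ (f-leaf e'))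

-- Chains and backward triangles

module Chains {n : ℕ} (T : Tournament n) where

  Chain : List (Fin n) → Set
  Chain = AllPairs (λ a b → adj T a b ≡ true)

  ChainIn : List (Fin n) → (List (Fin n) → Set) → Set
  ChainIn U P = Σ (List (Fin n)) λ C → (∀ {v} → v ∈ C → v ∈ U) × Chain C × P C

  Chain-++ : ∀ {A B} → Chain A → Chain B → (∀ {a b} → a ∈ A → b ∈ B → adj T a b ≡ true) → Chain (A ++ B)
  Chain-++ cA cB f = AllPairsP.++⁺ cA cB (All.tabulate λ i → All.tabulate λ j → f i j)

  ∈-++-elim : ∀ {A B U : List (Fin n)} → (∀ {v} → v ∈ A → v ∈ U) → (∀ {v} → v ∈ B → v ∈ U) → ∀ {v} → v ∈ A ++ B → v ∈ U
  ∈-++-elim {A} f g i with ∈-++⁻ A i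
  ... | inj₁ j = f j
  ... | inj₂ j = g j

  -- Recursion into a large out- or in-neighbourhood of one vertex, which is then put before or
  -- after the chain found there. The logarithmic length is enough to force `s` above any fixed
  -- constant.
  log-chain : ∀ j U → Unique U → 2 ^ j ≤ length U → ChainIn U λ C → length C ≡ j
  log-chain zero U u le = [] , (λ ()) , [] , refl
  log-chain (suc j) [] u le = ⊥-elim (<⇒≱ (m^n>0 2 (suc j)) le)
  log-chain (suc j) (v ∷ xs) (v∉ ∷ u) le = go (2 ^ j ≤? # (adj T v) xs)
    where
    outs = filterᵇ (adj T v) xs
    ins = filterᵇ (not ∘ adj T v) xs
    go : Dec (2 ^ j ≤ # (adj T v) xs) → ChainIn (v ∷ xs) λ C → length C ≡ suc j
    go (yes p) =
      let (C , C⊆ , ch , e) = log-chain j outs (AllPairs-⊆ (filterᵇ-⊆ _ xs) u) p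
      in v ∷ C , (λ { (here e) → here e ; (there i) → there (∈-⊆ (filterᵇ-⊆ _ xs) (C⊆ i)) })
         , All.tabulate (λ i → filterᵇ-true _ xs (C⊆ i)) ∷ ch , cong suc e
    go (no np) =
      let (C , C⊆ , ch , e) = log-chain j ins (AllPairs-⊆ (filterᵇ-⊆ _ xs) u) ins-large
      in C ++ v ∷ [] , ∈-++-elim (λ i → there (∈-⊆ (filterᵇ-⊆ _ xs) (C⊆ i))) (λ { (here e) → here e })
         , Chain-++ ch ([] ∷ []) (λ { {a} i (here refl) → trans (tour T a v λ e → All.lookup v∉ (∈-⊆ (filterᵇ-⊆ _ xs) (C⊆ i)) (sym e))
             (filterᵇ-true _ xs (C⊆ i)) })
         , trans (length-++ C) (trans (+-comm (length C) 1) (cong suc e))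
      where
      ins-large : 2 ^ j ≤ # (not ∘ adj T v) xs
      ins-large = +-cancelˡ-≤ (2 ^ j) _ _ (begin
        2 ^ j + 2 ^ j ≡⟨ cong (2 ^ j +_) (sym (+-identityʳ (2 ^ j))) ⟩
        2 ^ suc j ≤⟨ le ⟩
        suc (length xs) ≡⟨ cong suc (sym (#-split (adj T v) xs)) ⟩
        suc (# (adj T v) xs) + # (not ∘ adj T v) xs ≤⟨ +-monoˡ-≤ _ (≰⇒> np) ⟩
        2 ^ j + # (not ∘ adj T v) xs ∎)
        where open ≤-Reasoning

  -- A decidable form of the existence of a chain: a first vertex is chosen and the search goes on
  -- among its out-neighbours. The induction can branch on it without excluded middle.
  HasChain : ℕ → List (Fin n) → Set
  HasChain zero U = ⊤
  HasChain (suc j) U = Any (λ v → HasChain j (filterᵇ (adj T v) U)) U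

  hasChain? : ∀ j U → Dec (HasChain j U)
  hasChain? zero U = yes tt
  hasChain? (suc j) U = any? (λ v → hasChain? j (filterᵇ (adj T v) U)) U

  HasChain⇒ : ∀ j U → HasChain j U → ChainIn U λ C → length C ≡ j
  HasChain⇒ zero U _ = [] , (λ ()) , [] , refl
  HasChain⇒ (suc j) U h =
    let (v , v∈ , h') = find h
        (C , C⊆ , ch , e) = HasChain⇒ j (filterᵇ (adj T v) U) h'
    in v ∷ C , (λ { (here refl) → v∈ ; (there i) → ∈-⊆ (filterᵇ-⊆ _ U) (C⊆ i) })
       , All.tabulate (λ i → filterᵇ-true _ U (C⊆ i)) ∷ ch , cong suc e

  ⇒HasChain : ∀ j U C → (∀ {v} → v ∈ C → v ∈ U) → Chain C → j ≤ length C → HasChain j U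
  ⇒HasChain zero U C _ _ _ = tt
  ⇒HasChain (suc j) U (v ∷ C) C⊆ (a ∷ ch) (s≤s le) =
    lose (C⊆ (here refl)) (⇒HasChain j (filterᵇ (adj T v) U) C (λ i → ∈-filterᵇ _ (C⊆ (there i)) (All.lookup a i)) ch le)

  open Smoothness T

  SmoothFamily : ℕ → (ℕ → List (Fin n)) → Set
  SmoothFamily ℓ W = ∀ {i j} → i < j → Smooth ℓ (W i) (W j)

  Shrink : ℕ → (ℕ → List (Fin n)) → (ℕ → List (Fin n)) → Set
  Shrink K W W' = ∀ i → W' i ⊆ W i × length (W i) ≤ K * length (W' i)

  Shrink-trans : ∀ K K' {W W' W''} → Shrink K W W' → Shrink K' W' W'' → Shrink (K * K') W W''
  Shrink-trans K K' {W} {W'} {W''} p q i = ⊆-trans (proj₁ (q i)) (proj₁ (p i)) , ≤-chain-* K K' (proj₂ (p i)) (proj₂ (q i))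

  SmoothFamily-Shrink : ∀ K ℓ {W W'} → Shrink K W W' → SmoothFamily (K * ℓ) W → SmoothFamily ℓ W'
  SmoothFamily-Shrink K ℓ p S {i} {j} lt = Smooth-⊆ K ℓ (S lt) (proj₁ (p i)) (proj₁ (p j)) (proj₂ (p i)) (proj₂ (p j))

  SmoothFamily-weaken : ∀ {ℓ ℓ' W} → ℓ ≤ ℓ' → SmoothFamily ℓ' W → SmoothFamily ℓ W
  SmoothFamily-weaken le S lt = smooth
    (λ i → ≤-trans (*-monoˡ-≤ _ le) (out (S lt) i)) (λ i → ≤-trans (*-monoˡ-≤ _ le) (inn (S lt) i)) (dis (S lt))

  Replaced : ℕ → (ℕ → List (Fin n)) → ℕ → List (Fin n) → Set
  Replaced ℓ W i C = Σ (ℕ → List (Fin n)) λ W' → W' i ≡ C ×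
    (∀ {j} → j ≢ i → W' j ⊆ W j × length (W j) ≤ 2 * length (W' j)) × SmoothFamily ℓ W'

  -- `C` may be far too short to inherit smoothness by size. Its vertices still behave well towards
  -- every other set, and by averaging at least half of each other set behaves well towards `C`.
  replace : ∀ ℓ W i C → SmoothFamily (2 * ℓ) W → (∀ {v} → v ∈ C → v ∈ W i) → Replaced ℓ W i C
  replace ℓ W i C S C⊆ = W' , proj₁ (proj₂ (new i)) refl , (λ {j} → proj₁ (proj₂ (proj₂ (new j)))) , family
    where
    New : ℕ → Set
    New j = Σ (List (Fin n)) λ B → (j ≡ i → B ≡ C) × (j ≢ i → B ⊆ W j × length (W j) ≤ 2 * length B) ×
      (j < i → Smooth ℓ B C) × (i < j → Smooth ℓ C B)
    new : ∀ j → New j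
    new j with <-cmp j i
    ... | tri< lt ne ngt = mk (markov-before ℓ {C} {W j} (λ a b → dis (S lt) b (C⊆ a))
          (λ {v} a → ≤-trans (*-monoʳ-≤ (2 * ℓ) (#-weaken _ _ (W j) λ {u} b e →
             trans (reverse λ { refl → dis (S lt) b (C⊆ a) }) e)) (inn (S lt) (C⊆ a))))
      where
      mk : (Σ (List (Fin n)) λ B → B ⊆ W j × length (W j) ≤ 2 * length B × Smooth ℓ B C) → New j
      mk (B , s , h , sm) = B , (λ e → ⊥-elim (ne e)) , (λ _ → s , h) , (λ _ → sm) , λ gt → ⊥-elim (ngt gt)
    ... | tri≈ nlt refl ngt = C , (λ _ → refl) , (λ ne → ⊥-elim (ne refl)) , (λ lt → ⊥-elim (nlt lt)) , λ gt → ⊥-elim (ngt gt)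
    ... | tri> nlt ne gt = mk (markov-after ℓ {C} {W j} (λ a b → dis (S gt) (C⊆ a) b) (λ {v} a → out (S gt) (C⊆ a)))
      where
      mk : (Σ (List (Fin n)) λ B → B ⊆ W j × length (W j) ≤ 2 * length B × Smooth ℓ C B) → New j
      mk (B , s , h , sm) = B , (λ e → ⊥-elim (ne e)) , (λ _ → s , h) , (λ lt → ⊥-elim (nlt lt)) , λ _ → sm
    W' : ℕ → List (Fin n)
    W' j = proj₁ (new j)
    family : SmoothFamily ℓ W'
    family {j} {j'} lt = go (j ≟ i) (j' ≟ i)
      where
      go : Dec (j ≡ i) → Dec (j' ≡ i) → Smooth ℓ (W' j) (W' j')
      go (yes refl) _ = subst (λ X → Smooth ℓ X (W' j')) (sym (proj₁ (proj₂ (new j)) refl)) (proj₂ (proj₂ (proj₂ (proj₂ (new j')))) lt)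
      go (no _) (yes refl) = subst (Smooth ℓ (W' j)) (sym (proj₁ (proj₂ (new j')) refl)) (proj₁ (proj₂ (proj₂ (proj₂ (new j)))) lt)
      go (no ne) (no ne') = let (s , h) = proj₁ (proj₂ (proj₂ (new j))) ne ; (s' , h') = proj₁ (proj₂ (proj₂ (new j'))) ne'
                            in Smooth-⊆ 2 ℓ (S lt) s s' h h'

  TriangleFree : List (Fin n) → List (Fin n) → List (Fin n) → Set
  TriangleFree A B C = ∀ {x y z} → x ∈ A → y ∈ B → z ∈ C → adj T y x ≡ true → adj T z x ≡ true → adj T z y ≡ true → ⊥

  Triangle : List (Fin n) → List (Fin n) → List (Fin n) → Set
  Triangle A B C = Σ (Fin n) λ x → Σ (Fin n) λ y → Σ (Fin n) λ z → x ∈ A × y ∈ B × z ∈ C ×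
    adj T y x ≡ true × adj T z x ≡ true × adj T z y ≡ true

  -- Exhaustive search turns the mere refutation of `TriangleFree` into actual vertices.
  triangle : ∀ {A B C} → ¬ TriangleFree A B C → Triangle A B C
  triangle {A} {B} {C} nf with any? (λ x → any? (λ y → any? (λ z → (adj T y x ≟B true) ×-dec ((adj T z x ≟B true) ×-dec (adj T z y ≟B true))) C) B) A
  ... | yes p = let (x , x∈ , p') = find p ; (y , y∈ , p'') = find p' ; (z , z∈ , a , b , c) = find p''
                in x , y , z , x∈ , y∈ , z∈ , a , b , c
  ... | no np = ⊥-elim (nf λ {x} {y} {z} i j l a b c → np (lose i (lose j (lose l (a , b , c)))))

  Robust : ℕ → List (Fin n) → List (Fin n) → List (Fin n) → Set
  Robust δ A B C = ∀ A' B' C' → A' ⊆ A → B' ⊆ B → C' ⊆ C →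
    length A ≤ δ * length A' → length B ≤ δ * length B' → length C ≤ δ * length C' → ¬ TriangleFree A' B' C'

  -- The triples are treated one at a time. One that is not robust has large triangle-free subsets,
  -- to which the family shrinks at the cost of a factor `δ`; triangle-freeness survives all later
  -- shrinking. The first robust triple ends the process.
  dichotomy : ∀ δ .{{_ : NonZero δ}} (ts : List (ℕ × ℕ × ℕ)) → All (λ t → proj₁ t < proj₁ (proj₂ t) × proj₁ (proj₂ t) < proj₂ (proj₂ t)) ts → ∀ W →
    ¬ ¬ ((Σ (ℕ → List (Fin n)) λ W' → Shrink (δ ^ length ts) W W' ×
            (∀ {a b c} → (a , b , c) ∈ ts → TriangleFree (W' a) (W' b) (W' c)))
       ⊎ (Σ (ℕ → List (Fin n)) λ W' → Shrink (δ ^ length ts) W W' ×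
            Σ ℕ λ a → Σ ℕ λ b → Σ ℕ λ c → (a , b , c) ∈ ts × Robust δ (W' a) (W' b) (W' c)))
  dichotomy δ [] _ W ne = ne (inj₁ (W , (λ i → ⊆-refl , ≤-reflexive (sym (*-identityˡ _))) , λ ()))
  dichotomy δ ((a , b , c) ∷ ts) ((a<b , b<c) ∷ lts) W ne = excluded-middle split
    where
    Sparse : Set
    Sparse = Σ (List (Fin n)) λ A → Σ (List (Fin n)) λ B → Σ (List (Fin n)) λ C → A ⊆ W a × B ⊆ W b × C ⊆ W c ×
      length (W a) ≤ δ * length A × length (W b) ≤ δ * length B × length (W c) ≤ δ * length C × TriangleFree A B C
    keep : ∀ {K} .{{_ : NonZero K}} (X : List (Fin n)) → length X ≤ K * length X
    keep {K} X = m≤n*m (length X) K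
    split : Sparse ⊎ ¬ Sparse → ⊥
    split (inj₂ no-sparse) = ne (inj₂ (W , (λ i → ⊆-refl , keep {{m^n≢0 δ (suc (length ts))}} (W i)) , a , b , c , here refl ,
      λ A B C sA sB sC lA lB lC fr → no-sparse (A , B , C , sA , sB , sC , lA , lB , lC , fr)))
    split (inj₁ (A , B , C , sA , sB , sC , lA , lB , lC , fr)) = dichotomy δ ts lts W₁ λ
      { (inj₁ (W' , sh , free)) → ne (inj₁ (W' , Shrink-trans δ (δ ^ length ts) {W} {W₁} {W'} shrink₁ sh , λ
          { (here refl) x∈ y∈ z∈ → fr (subst (_ ∈_) W₁-a (∈-⊆ (proj₁ (sh a)) x∈)) (subst (_ ∈_) W₁-b (∈-⊆ (proj₁ (sh b)) y∈)) (subst (_ ∈_) W₁-c (∈-⊆ (proj₁ (sh c)) z∈))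
          ; (there i) → free i }))
      ; (inj₂ (W' , sh , a' , b' , c' , i , rob)) → ne (inj₂ (W' , Shrink-trans δ (δ ^ length ts) {W} {W₁} {W'} shrink₁ sh , a' , b' , c' , there i , rob)) }
      where
      -- The three indices are distinct by `a<b` and `b<c`, so no replacement is hidden by an
      -- earlier test.
      W₁ : ℕ → List (Fin n)
      W₁ i = if ⌊ i ≟ a ⌋ then A else if ⌊ i ≟ b ⌋ then B else if ⌊ i ≟ c ⌋ then C else W i
      W₁-a : W₁ a ≡ A
      W₁-a = if-yes (a ≟ a) refl
      W₁-b : W₁ b ≡ B
      W₁-b = trans (if-no (b ≟ a) (≢-sym (<⇒≢ a<b))) (if-yes (b ≟ b) refl)
      W₁-c : W₁ c ≡ C
      W₁-c = trans (if-no (c ≟ a) (≢-sym (<⇒≢ (<-trans a<b b<c)))) (trans (if-no (c ≟ b) (≢-sym (<⇒≢ b<c))) (if-yes (c ≟ c) refl))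
      OK : ℕ → List (Fin n) → Set
      OK i X = X ⊆ W i × length (W i) ≤ δ * length X
      ite : ∀ {P : Set} (i : ℕ) (d : Dec P) {X Y} → (P → OK i X) → OK i Y → OK i (if ⌊ d ⌋ then X else Y)
      ite i (yes p) f g = f p
      ite i (no _) f g = g
      shrink₁ : Shrink δ W W₁
      shrink₁ i = ite i (i ≟ a) (λ { refl → sA , lA }) (ite i (i ≟ b) (λ { refl → sB , lB }) (ite i (i ≟ c) (λ { refl → sC , lC }) (⊆-refl , keep (W i))))

-- Chains in a minimal counterexample

*-^ : ∀ a b q → (a * b) ^ q ≡ a ^ q * b ^ q
*-^ a b zero = refl
*-^ a b (suc q) = trans (cong (a * b *_) (*-^ a b q)) (lemma a b (a ^ q) (b ^ q))
  where
  lemma : ∀ a b x y → a * b * (x * y) ≡ a * x * (b * y)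
  lemma = solve-∀

-- In use, `s` is the largest number with `s ^ q < length U`: smaller sets satisfy the bound,
-- whereas `U` has no chain longer than `s`. `κ` says what counts as a linear subset, and `D` how
-- close to `s` the chains of such subsets come.
module Critical {n : ℕ} (T : Tournament n) (U : List (Fin n)) (uniqueU : Unique U) (q s D κ : ℕ)
  (IH : ∀ A → Unique A → length A < length U → Chains.ChainIn T A λ C → length A ≤ length C ^ q)
  (noChain : ∀ C → (∀ {v} → v ∈ C → v ∈ U) → Chains.Chain T C → s < length C → ⊥)
  (s^q<m : s ^ q < length U) (D≢0 : NonZero D) (gap : 2 * κ * D ^ q ≤ suc D ^ q) (2≤κ : 2 ≤ κ) (κ≤m : κ ≤ length U) where

  open Chains T
  open Smoothness T

  private
    instance
      D≢0' : NonZero D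
      D≢0' = D≢0
      κ≢0 : NonZero κ
      κ≢0 = >-nonZero (≤-trans (s≤s z≤n) 2≤κ)
    m = length U
    r = m / κ
    instance
      m≢0 : NonZero m
      m≢0 = >-nonZero (≤-trans (s≤s z≤n) s^q<m)
    m≤2κr : m ≤ κ * (2 * r)
    m≤2κr = ≤-trans (m≤2d[m/d] m κ κ≤m) (≤-reflexive (lemma κ r))
      where
      lemma : ∀ x y → 2 * x * y ≡ x * (2 * y)
      lemma = solve-∀

  -- The induction hypothesis loses a factor κ^(1/q), which (1 + 1/D)^q ≥ 2κ makes up for.
  long-chain : ∀ {A} → A ⊆ U → m ≤ κ * length A → ChainIn A λ C → D * s < suc D * length C
  long-chain {A} sub le = mk (IH B (AllPairs-⊆ (⊆-trans (take-⊆ r A) sub) uniqueU) (subst (_< m) (sym lenB) (m/n<m m κ 2≤κ)))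
    where
    B = take r A
    lenB : length B ≡ r
    lenB = trans (length-take r A) (m≤n⇒m⊓n≡m (≤-trans (/-monoˡ-≤ κ le)
      (≤-reflexive (trans (cong (_/ κ) (*-comm κ (length A))) (m*n/n≡m (length A) κ)))))
    mk : ChainIn B (λ C → length B ≤ length C ^ q) → ChainIn A λ C → D * s < suc D * length C
    mk (C , C⊆ , ch , le') = C , (λ i → ∈-⊆ (take-⊆ r A) (C⊆ i)) , ch , ≰⇒> λ short → n≮n ((D * s) ^ q) (begin-strict
      (D * s) ^ q ≡⟨ *-^ D s q ⟩
      D ^ q * s ^ q <⟨ *-monoʳ-< (D ^ q) {{m^n≢0 D q}} s^q<m ⟩
      D ^ q * m ≤⟨ *-monoʳ-≤ (D ^ q) (≤-trans m≤2κr (*-monoʳ-≤ κ (*-monoʳ-≤ 2 (subst (_≤ length C ^ q) lenB le')))) ⟩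
      D ^ q * (κ * (2 * length C ^ q)) ≡⟨ lemma (D ^ q) κ (length C ^ q) ⟩
      2 * κ * D ^ q * length C ^ q ≤⟨ *-monoˡ-≤ _ gap ⟩
      suc D ^ q * length C ^ q ≡⟨ sym (*-^ (suc D) (length C) q) ⟩
      (suc D * length C) ^ q ≤⟨ ^-monoˡ-≤ q short ⟩
      (D * s) ^ q ∎)
      where
      open ≤-Reasoning
      lemma : ∀ d k c → d * (k * (2 * c)) ≡ 2 * k * d * c
      lemma = solve-∀

  -- The linear set has a chain longer than `D / (D + 1)` times `s`, and `B` contributes the missing
  -- `s / (D + 1)`. The direction `b` tells which of the two chains goes first; either way the
  -- result is longer than `s`.
  no-complete-pair : ∀ {A B} b → A ⊆ U → m ≤ κ * length A → (∀ {v} → v ∈ B → v ∈ U) → Chain B → s ≤ suc D * length B →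
    (∀ {v} → v ∈ A → v ∈ B → ⊥) → (∀ {x y} → x ∈ A → y ∈ B → adj T x y ≡ b) → ⊥
  no-complete-pair {A} {B} b sub le B⊆ chB leB dis complete = go (long-chain sub le) b refl
    where
    too-long : ∀ c → D * s < suc D * c → s < c + length B
    too-long c lt = *-cancelˡ-< (suc D) _ _ (begin-strict
      s + D * s ≡⟨ +-comm s (D * s) ⟩
      D * s + s <⟨ +-mono-<-≤ lt leB ⟩
      suc D * c + suc D * length B ≡⟨ sym (*-distribˡ-+ (suc D) c (length B)) ⟩
      suc D * (c + length B) ∎)
      where open ≤-Reasoning
    go : ChainIn A (λ C → D * s < suc D * length C) → ∀ b' → b ≡ b' → ⊥
    go (C , C⊆ , chC , lt) true refl = noChain (C ++ B) (∈-++-elim (λ i → ∈-⊆ sub (C⊆ i)) B⊆)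
      (Chain-++ chC chB λ i j → complete (C⊆ i) j) (subst (s <_) (sym (length-++ C)) (too-long (length C) lt))
    go (C , C⊆ , chC , lt) false refl = noChain (B ++ C) (∈-++-elim B⊆ (λ i → ∈-⊆ sub (C⊆ i)))
      (Chain-++ chB chC λ {y} {x} i j → trans (tour T y x λ { refl → dis (C⊆ j) i }) (cong not (complete (C⊆ j) i)))
      (subst (s <_) (trans (+-comm (length C) (length B)) (sym (length-++ B))) (too-long (length C) lt))

  s≤Ds : s ≤ D * s
  s≤Ds = m≤n*m s D

  -- The inequality is that of `long-chain` divided by `K`: since it was found, the chain may have
  -- been trimmed down to a `1 / K` fraction.
  Chained : ℕ → (ℕ → List (Fin n)) → ℕ → Set
  Chained K W i = (∀ {v} → v ∈ W i → v ∈ U) × Chain (W i) × D * s < suc D * (K * length (W i))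

  Chaining : List ℕ → ℕ → (ℕ → List (Fin n)) → Set
  Chaining rs ℓ W = Σ (ℕ → List (Fin n)) λ W' → SmoothFamily ℓ W' ×
      (∀ {i} → i ∉ rs → W' i ⊆ W i × length (W i) ≤ 2 ^ length rs * length (W' i)) ×
      (∀ {i} → i ∈ rs → Chained (2 ^ length rs) W' i)

  chaining : ∀ rs k ℓ W → Unique rs → SmoothFamily (2 ^ length rs * ℓ) W →
    (∀ {i} → i ∈ rs → W i ⊆ U × m ≤ k * length (W i)) → k * 2 ^ length rs ≤ κ → Chaining rs ℓ W
  chaining [] k ℓ W _ S _ _ = W , SmoothFamily-weaken {W = W} (≤-reflexive (sym (*-identityˡ ℓ))) S ,
    (λ _ → ⊆-refl , ≤-reflexive (sym (*-identityˡ _))) , λ ()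
  chaining (i ∷ rs) k ℓ W (i∉ ∷ u) S large hk = step (long-chain (proj₁ (large (here refl)))
      (≤-trans (proj₂ (large (here refl))) (*-monoˡ-≤ _ (≤-trans (m≤m*n k (2 ^ length (i ∷ rs)) {{m^n≢0 2 (length (i ∷ rs))}}) hk))))
    where
    P = 2 ^ length rs
    P≢0 : NonZero P
    P≢0 = m^n≢0 2 (length rs)
    step : ChainIn (W i) (λ C → D * s < suc D * length C) → Chaining (i ∷ rs) ℓ W
    step (C , C⊆ , ch , long) = extend (replace (P * ℓ) W i C (SmoothFamily-weaken {W = W} (≤-reflexive (sym (*-assoc 2 P ℓ))) S) C⊆)
      where
      extend : Replaced (P * ℓ) W i C → Chaining (i ∷ rs) ℓ W
      extend (W₁ , W₁i , other , S₁) = finish (chaining rs (k * 2) ℓ W₁ u S₁ large₁ (≤-trans (≤-reflexive (*-assoc k 2 P)) hk))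
        where
        large₁ : ∀ {j} → j ∈ rs → W₁ j ⊆ U × m ≤ k * 2 * length (W₁ j)
        large₁ {j} j∈ = let (sb , h) = other {j} (λ e → All.lookup i∉ j∈ (sym e)) ; (sU , l) = large (there j∈)
                        in ⊆-trans sb sU , ≤-chain-* k 2 l h
        finish : Chaining rs ℓ W₁ → Chaining (i ∷ rs) ℓ W
        finish (W' , S' , rest , chained) = W' , S' ,
          (λ {j} j∉ → let (sb , h) = other {j} (λ e → j∉ (here e)) ; (sb' , h') = rest (λ e → j∉ (there e))
                      in ⊆-trans sb' sb , ≤-chain-* 2 P h h') ,
          λ { {j} (here e) → subst (Chained (2 * P) W') (sym e) head-chained
            ; (there j∈) → let (U∋ , c , l) = chained j∈
                           in U∋ , c , <-≤-trans l (*-monoʳ-≤ (suc D) (*-monoˡ-≤ _ (m≤n*m P 2))) }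
          where
          head-chained : Chained (2 * P) W' i
          head-chained = let (sb , h) = rest {i} (λ j → All.lookup i∉ j refl) in
            (λ v∈ → ∈-⊆ (proj₁ (large (here refl))) (C⊆ (subst (_ ∈_) W₁i (∈-⊆ sb v∈)))) ,
            AllPairs-⊆ sb (subst Chain (sym W₁i) ch) ,
            <-≤-trans long (*-monoʳ-≤ (suc D) (≤-trans (subst (λ X → length X ≤ P * length (W' i)) W₁i h) (*-monoˡ-≤ _ (m≤n*m P 2))))

-- Inequalities for the choice of the exponent

-- (1 + 1/d)^q ≥ 1 + q/d, cleared of denominators.
bernoulli : ∀ d q → d * d ^ q + q * d ^ q ≤ d * suc d ^ q
bernoulli d zero = ≤-reflexive (+-identityʳ (d * 1))
bernoulli d (suc q) = begin
  d * (d * x) + (d * x + q * (d * x)) ≡⟨ e₁ d x q ⟩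
  d * (d * x + q * x) + d * x ≤⟨ +-mono-≤ (*-monoʳ-≤ d (bernoulli d q)) (≤-trans (m≤m+n (d * x) (q * x)) (bernoulli d q)) ⟩
  d * (d * y) + d * y ≡⟨ e₂ d y ⟩
  d * (suc d * y) ∎
  where
  open ≤-Reasoning
  x = d ^ q
  y = suc d ^ q
  e₁ : ∀ d x q → d * (d * x) + (d * x + q * (d * x)) ≡ d * (d * x + q * x) + d * x
  e₁ = solve-∀
  e₂ : ∀ d y → d * (d * y) + d * y ≡ d * (suc d * y)
  e₂ = solve-∀

doubling : ∀ d .{{_ : NonZero d}} → 2 * d ^ d ≤ suc d ^ d
doubling d = *-cancelˡ-≤ d (≤-trans (≤-reflexive (e d (d ^ d))) (bernoulli d d))
  where
  e : ∀ d x → d * (2 * x) ≡ d * x + d * x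
  e = solve-∀

-- The `j`-th power of `doubling`. It yields an exponent `q` for which `(1 + 1/D) ^ q` is at least
-- `2 * κ`.
growth : ∀ d .{{_ : NonZero d}} j → 2 ^ j * d ^ (d * j) ≤ suc d ^ (d * j)
growth d zero = ≤-reflexive (trans (cong (λ z → 1 * d ^ z) (*-zeroʳ d)) (cong (suc d ^_) (sym (*-zeroʳ d))))
growth d (suc j) = begin
  2 * 2 ^ j * d ^ (d * suc j) ≡⟨ cong (2 * 2 ^ j *_) (split d) ⟩
  2 * 2 ^ j * (d ^ d * d ^ (d * j)) ≡⟨ e (2 ^ j) (d ^ d) (d ^ (d * j)) ⟩
  2 * d ^ d * (2 ^ j * d ^ (d * j)) ≤⟨ *-mono-≤ (doubling d) (growth d j) ⟩
  suc d ^ d * suc d ^ (d * j) ≡⟨ sym (split (suc d)) ⟩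
  suc d ^ (d * suc j) ∎
  where
  open ≤-Reasoning
  split : ∀ b → b ^ (d * suc j) ≡ b ^ d * b ^ (d * j)
  split b = trans (cong (b ^_) (*-suc d j)) (^-distribˡ-+-* b d (d * j))
  e : ∀ a b c → 2 * a * (b * c) ≡ 2 * b * (a * c)
  e = solve-∀


integer-root : ∀ m q → 0 < m → 0 < q → Σ ℕ λ s → s ^ q < m × m ≤ suc s ^ q
integer-root m q@(suc q') m>0 _ = search m (≤-trans (n≤1+n m) (m≤m*n (suc m) (suc m ^ q') {{m^n≢0 (suc m) q'}}))
  where
  search : ∀ t → m ≤ suc t ^ q → Σ ℕ λ s → s ^ q < m × m ≤ suc s ^ q
  search zero le = 0 , m>0 , le
  search (suc t) le with m ≤? suc t ^ q
  ... | yes p = search t p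
  ... | no np = suc t , ≰⇒> np , le

-- The backward graph of a super galaxy ordering

step-mono : ∀ {m} (p : Fin (suc m) → ℕ) → (∀ i → p (inject₁ i) < p (fsuc i)) → ∀ r r' → toℕ r < toℕ r' → p r < p r'
step-mono {suc m} p st fzero (fsuc fzero) _ = st fzero
step-mono {suc (suc m)} p st fzero (fsuc (fsuc r')) _ = <-trans (st fzero) (step-mono (p ∘ fsuc) (st ∘ fsuc) fzero (fsuc r') (s≤s z≤n))
step-mono {suc m} p st (fsuc r) (fsuc r') (s≤s lt) = step-mono (p ∘ fsuc) (st ∘ fsuc) r r' lt

pattern 0F = fzero
pattern 1F = fsuc fzero
pattern 2F = fsuc (fsuc fzero)
pattern 3F = fsuc (fsuc (fsuc fzero))
pattern 4F = fsuc (fsuc (fsuc (fsuc fzero)))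

module Anatomy {k : ℕ} (H : Tournament k) (θ : Permutation′ k) (sg : Ordered.SuperGalaxy H θ) where
  open Ordered H θ public
  open SuperGalaxy sg public

  pos-injective : ∀ {u v} → pos u ≡ pos v → u ≡ v
  pos-injective {u} {v} e = trans (sym (inverseˡ θ)) (trans (cong (θ ⟨$⟩ˡ_) (toℕ-injective e)) (inverseˡ θ))

  pos<k : ∀ v → pos v < k
  pos<k v = toℕ<n (θ ⟨$⟩ʳ v)

  -- Numbered from 0: `int i 0F` and `int i 4F` are the centres 1 and 5 of the spider, while `1F`,
  -- `2F`, `3F` give its petals 2, 3, 4.
  int : Fin (length spiders) → Fin 5 → Fin k
  int i 0F = i1 (sp i)
  int i 1F = i2 (sp i)
  int i 2F = i3 (sp i)
  int i 3F = i4 (sp i)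
  int i 4F = i5 (sp i)

  data Tag : Set where
    legA legB : Fin (length spiders) → Tag
    role : Fin (length spiders) → Fin 5 → Tag
    leaf centre : Fin (length stars) → Tag
    other : Tag

  Is : Fin k → Tag → Set
  Is h (legA i) = h ∈ₛ legsA (sp i)
  Is h (legB i) = h ∈ₛ legsB (sp i)
  Is h (role i r) = h ≡ int i r
  Is h (leaf j) = h ∈ₛ leaves (st j)
  Is h (centre j) = h ≡ center (st j)
  Is h other = InX h × (∀ j → ¬ InStar (st j) h)

  base : ∀ i → SpiderBase (sp i)
  base i with spidersOK i
  ... | inj₁ (b , _) = b
  ... | inj₂ (inj₁ (b , _)) = b
  ... | inj₂ (inj₂ (b , _)) = b

  int-mono : ∀ i {r r'} → toℕ r < toℕ r' → int i r ≺ int i r'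
  int-mono i {r} {r'} = step-mono (pos ∘ int i) steps r r'
    where
    steps : ∀ x → pos (int i (inject₁ x)) < pos (int i (fsuc x))
    steps 0F = proj₁ (base i)
    steps 1F = proj₁ (proj₂ (base i))
    steps 2F = proj₁ (proj₂ (proj₂ (base i)))
    steps 3F = proj₁ (proj₂ (proj₂ (proj₂ (base i))))

  int-injective : ∀ i {r r'} → int i r ≡ int i r' → r ≡ r'
  int-injective i {r} {r'} e with <-cmp (toℕ r) (toℕ r')
  ... | tri< lt _ _ = ⊥-elim (n≮n _ (subst (λ z → pos z < pos (int i r')) e (int-mono i {r} {r'} lt)))
  ... | tri≈ _ e' _ = toℕ-injective e'
  ... | tri> _ _ gt = ⊥-elim (n≮n _ (subst (λ z → pos (int i r') < pos z) e (int-mono i {r'} {r} gt)))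

  int-≥ : ∀ i r → pos (int i 0F) ≤ pos (int i r)
  int-≥ i 0F = ≤-refl
  int-≥ i (fsuc r) = <⇒≤ (int-mono i {0F} {fsuc r} (s≤s z≤n))

  int-≤ : ∀ i r → pos (int i r) ≤ pos (int i 4F)
  int-≤ i 0F = <⇒≤ (int-mono i {0F} {4F} (s≤s z≤n))
  int-≤ i 1F = <⇒≤ (int-mono i {1F} {4F} (s≤s (s≤s z≤n)))
  int-≤ i 2F = <⇒≤ (int-mono i {2F} {4F} (s≤s (s≤s (s≤s z≤n))))
  int-≤ i 3F = <⇒≤ (int-mono i {3F} {4F} ≤-refl)
  int-≤ i 4F = ≤-refl

  legsA-side : ∀ i → (∀ l → l ∈ₛ legsA (sp i) → l ≺ int i 0F) ⊎ (∀ l → l ∈ₛ legsA (sp i) → int i 4F ≺ l)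
  legsA-side i with spidersOK i
  ... | inj₁ (_ , f , _) = inj₁ f
  ... | inj₂ (inj₁ (_ , f , _)) = inj₁ f
  ... | inj₂ (inj₂ (_ , f , _)) = inj₂ f

  legsB-side : ∀ i → (∀ l → l ∈ₛ legsB (sp i) → l ≺ int i 0F) ⊎ (∀ l → l ∈ₛ legsB (sp i) → int i 4F ≺ l)
  legsB-side i with spidersOK i
  ... | inj₁ (_ , _ , f , _) = inj₂ f
  ... | inj₂ (inj₁ (_ , _ , f , _)) = inj₁ f
  ... | inj₂ (inj₂ (_ , _ , f , _)) = inj₂ f

  legA≢int : ∀ {i h} r → h ∈ₛ legsA (sp i) → h ≢ int i r
  legA≢int {i} {h} r h∈ refl with legsA-side i
  ... | inj₁ f = <⇒≱ (f h h∈) (int-≥ i r)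
  ... | inj₂ f = <⇒≱ (f h h∈) (int-≤ i r)

  legB≢int : ∀ {i h} r → h ∈ₛ legsB (sp i) → h ≢ int i r
  legB≢int {i} {h} r h∈ refl with legsB-side i
  ... | inj₁ f = <⇒≱ (f h h∈) (int-≥ i r)
  ... | inj₂ f = <⇒≱ (f h h∈) (int-≤ i r)

  int-Interior : ∀ i r → Interior (sp i) (int i r)
  int-Interior i 0F = inj₁ refl
  int-Interior i 1F = inj₂ (inj₁ refl)
  int-Interior i 2F = inj₂ (inj₂ (inj₁ refl))
  int-Interior i 3F = inj₂ (inj₂ (inj₂ (inj₁ refl)))
  int-Interior i 4F = inj₂ (inj₂ (inj₂ (inj₂ refl)))

  Interior-int : ∀ i {h} → Interior (sp i) h → Σ (Fin 5) λ r → h ≡ int i r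
  Interior-int i (inj₁ e) = 0F , e
  Interior-int i (inj₂ (inj₁ e)) = 1F , e
  Interior-int i (inj₂ (inj₂ (inj₁ e))) = 2F , e
  Interior-int i (inj₂ (inj₂ (inj₂ (inj₁ e)))) = 3F , e
  Interior-int i (inj₂ (inj₂ (inj₂ (inj₂ e)))) = 4F , e

  in-legA : ∀ {i h} → h ∈ₛ legsA (sp i) → InSpider (sp i) h
  in-legA = inj₂ ∘ inj₁

  in-legB : ∀ {i h} → h ∈ₛ legsB (sp i) → InSpider (sp i) h
  in-legB = inj₂ ∘ inj₂

  in-role : ∀ {i r h} → h ≡ int i r → InSpider (sp i) h
  in-role {i} {r} refl = inj₁ (int-Interior i r)

  -- An arbitrary order of the kinds of vertices. By symmetry, uniqueness of the kind has to be
  -- checked only for pairs in this order.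
  rank : Tag → ℕ
  rank (legA _) = 0
  rank (legB _) = 1
  rank (role _ _) = 2
  rank (leaf _) = 3
  rank (centre _) = 4
  rank other = 5

  unique-≤ : ∀ {h} t t' → T (rank t ≤ᵇ rank t') → Is h t → Is h t' → t ≡ t'
  unique-≤ (legA i) (legA i') _ p p' = cong legA (spidersDisj i i' _ (in-legA p) (in-legA p'))
  unique-≤ (legA i) (legB i') _ p p' with spidersDisj i i' _ (in-legA p) (in-legB p')
  ... | refl = let (_ , _ , _ , _ , _ , d) = base i in ⊥-elim (d _ p p')
  unique-≤ (legA i) (role i' r) _ p p' with spidersDisj i i' _ (in-legA p) (in-role {i'} {r} p')
  ... | refl = ⊥-elim (legA≢int r p p')
  unique-≤ (legA i) (leaf j) _ p p' = ⊥-elim (starsInX j _ (inj₂ p') i (in-legA p))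
  unique-≤ (legA i) (centre j) _ p p' = ⊥-elim (starsInX j _ (inj₁ p') i (in-legA p))
  unique-≤ (legA i) other _ p p' = ⊥-elim (proj₁ p' i (in-legA p))
  unique-≤ (legB i) (legA i') ()
  unique-≤ (legB i) (legB i') _ p p' = cong legB (spidersDisj i i' _ (in-legB p) (in-legB p'))
  unique-≤ (legB i) (role i' r) _ p p' with spidersDisj i i' _ (in-legB p) (in-role {i'} {r} p')
  ... | refl = ⊥-elim (legB≢int r p p')
  unique-≤ (legB i) (leaf j) _ p p' = ⊥-elim (starsInX j _ (inj₂ p') i (in-legB p))
  unique-≤ (legB i) (centre j) _ p p' = ⊥-elim (starsInX j _ (inj₁ p') i (in-legB p))
  unique-≤ (legB i) other _ p p' = ⊥-elim (proj₁ p' i (in-legB p))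
  unique-≤ (role i r) (legA i') ()
  unique-≤ (role i r) (legB i') ()
  unique-≤ (role i r) (role i' r') _ p p' with spidersDisj i i' _ (in-role {i} {r} p) (in-role {i'} {r'} p')
  ... | refl = cong (role i) (int-injective i (trans (sym p) p'))
  unique-≤ (role i r) (leaf j) _ p p' = ⊥-elim (starsInX j _ (inj₂ p') i (in-role {i} {r} p))
  unique-≤ (role i r) (centre j) _ p p' = ⊥-elim (starsInX j _ (inj₁ p') i (in-role {i} {r} p))
  unique-≤ (role i r) other _ p p' = ⊥-elim (proj₁ p' i (in-role {i} {r} p))
  unique-≤ (leaf j) (leaf j') _ p p' = cong leaf (starsDisj j j' _ (inj₂ p) (inj₂ p'))
  unique-≤ (leaf j) (centre j') _ p refl with starsDisj j j' _ (inj₂ p) (inj₁ refl)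
  ... | refl with starsOK j
  ... | inj₁ ((c∉ , _) , _) = ⊥-elim (c∉ p)
  ... | inj₂ ((c∉ , _) , _) = ⊥-elim (c∉ p)
  unique-≤ (leaf j) other _ p p' = ⊥-elim (proj₂ p' j (inj₂ p))
  unique-≤ (leaf j) (legA i) ()
  unique-≤ (leaf j) (legB i) ()
  unique-≤ (leaf j) (role i r) ()
  unique-≤ (centre j) (legA i) ()
  unique-≤ (centre j) (legB i) ()
  unique-≤ (centre j) (role i r) ()
  unique-≤ (centre j) (leaf j') ()
  unique-≤ (centre j) (centre j') _ p p' = cong centre (starsDisj j j' _ (inj₁ p) (inj₁ p'))
  unique-≤ (centre j) other _ p p' = ⊥-elim (proj₂ p' j (inj₁ p))
  unique-≤ other (legA i) ()
  unique-≤ other (legB i) ()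
  unique-≤ other (role i r) ()
  unique-≤ other (leaf j) ()
  unique-≤ other (centre j) ()
  unique-≤ other other _ p p' = refl

  Is-unique : ∀ {h} t t' → Is h t → Is h t' → t ≡ t'
  Is-unique t t' p p' with ≤-total (rank t) (rank t')
  ... | inj₁ le = unique-≤ t t' (≤⇒≤ᵇ le) p p'
  ... | inj₂ ge = sym (unique-≤ t' t (≤⇒≤ᵇ ge) p' p)

  -- The outcome is pinned down by `tag-is` and `Is-unique` alone; keeping the search opaque
  -- prevents its case tree from unfolding in later types.
  abstract
    classify : ∀ h → Σ Tag (Is h)
    classify h with anyF? (λ i → h ∈ₛ? legsA (sp i)) | anyF? (λ i → h ∈ₛ? legsB (sp i)) | anyF? (λ i → anyF? (λ r → h ≟F int i r))
                  | anyF? (λ j → h ∈ₛ? leaves (st j)) | anyF? (λ j → h ≟F center (st j))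
    ... | yes (i , p) | _ | _ | _ | _ = legA i , p
    ... | no _ | yes (i , p) | _ | _ | _ = legB i , p
    ... | no _ | no _ | yes (i , r , p) | _ | _ = role i r , p
    ... | no _ | no _ | no _ | yes (j , p) | _ = leaf j , p
    ... | no _ | no _ | no _ | no _ | yes (j , p) = centre j , p
    ... | no nA | no nB | no nR | no nL | no nC = other ,
      (λ { i (inj₁ p) → nR (i , Interior-int i p) ; i (inj₂ (inj₁ p)) → nA (i , p) ; i (inj₂ (inj₂ p)) → nB (i , p) }) ,
      λ { j (inj₁ p) → nC (j , p) ; j (inj₂ p) → nL (j , p) }

  tag : Fin k → Tag
  tag h = proj₁ (classify h)

  tag-is : ∀ h → Is h (tag h)
  tag-is h = proj₂ (classify h)

  tag≡ : ∀ {h} t → Is h t → tag h ≡ t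
  tag≡ {h} t p = Is-unique (tag h) t (tag-is h) p

  is : ∀ {h t} → tag h ≡ t → Is h t
  is {h} e = subst (Is h) e (tag-is h)

  -- The backward graph of θ is a disjoint union of stars; Up t t' says that a vertex of kind t hangs from one of kind t'.
  data Up : Tag → Tag → Set where
    upA : ∀ i → Up (legA i) (role i 0F)
    upB : ∀ i → Up (legB i) (role i 4F)
    up3 : ∀ i → Up (role i 3F) (role i 0F)
    up1 : ∀ i → Up (role i 1F) (role i 4F)
    upL : ∀ j → Up (leaf j) (centre j)

  UpV : Fin k → Fin k → Set
  UpV u w = Up (tag u) (tag w)

  mkUp : ∀ {u w} t t' → Is u t → Is w t' → Up t t' → UpV u w
  mkUp t t' p p' up = subst₂ Up (sym (tag≡ t p)) (sym (tag≡ t' p')) up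

  backward⇒up : ∀ u w → Backward u w → UpV u w ⊎ UpV w u
  backward⇒up u w b with backwardCov u w b
  ... | inj₁ (i , u∈ , w∈) with spidersOK i
  ... | inj₁ (_ , _ , _ , f) with proj₁ (f u w u∈ w∈) b
  ... | inj₁ (p , p') = inj₁ (mkUp (role i 3F) (role i 0F) p p' (up3 i))
  ... | inj₂ (inj₁ (p , p')) = inj₂ (mkUp (role i 1F) (role i 4F) p' p (up1 i))
  ... | inj₂ (inj₂ (inj₁ (p , p'))) = inj₂ (mkUp (legA i) (role i 0F) p' p (upA i))
  ... | inj₂ (inj₂ (inj₂ (p , p'))) = inj₁ (mkUp (legB i) (role i 4F) p p' (upB i))
  backward⇒up u w b | inj₁ (i , u∈ , w∈) | inj₂ (inj₁ (_ , _ , _ , f)) with proj₁ (f u w u∈ w∈) b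
  ... | inj₁ (p , p') = inj₂ (mkUp (role i 1F) (role i 4F) p' p (up1 i))
  ... | inj₂ (inj₁ (p , p')) = inj₁ (mkUp (role i 3F) (role i 0F) p p' (up3 i))
  ... | inj₂ (inj₂ (inj₁ (p , p'))) = inj₂ (mkUp (legB i) (role i 4F) p' p (upB i))
  ... | inj₂ (inj₂ (inj₂ (p , p'))) = inj₂ (mkUp (legA i) (role i 0F) p' p (upA i))
  backward⇒up u w b | inj₁ (i , u∈ , w∈) | inj₂ (inj₂ (_ , _ , _ , f)) with proj₁ (f u w u∈ w∈) b
  ... | inj₁ (p , p') = inj₁ (mkUp (role i 3F) (role i 0F) p p' (up3 i))
  ... | inj₂ (inj₁ (p , p')) = inj₂ (mkUp (role i 1F) (role i 4F) p' p (up1 i))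
  ... | inj₂ (inj₂ (inj₁ (p , p'))) = inj₁ (mkUp (legB i) (role i 4F) p p' (upB i))
  ... | inj₂ (inj₂ (inj₂ (p , p'))) = inj₁ (mkUp (legA i) (role i 0F) p p' (upA i))
  backward⇒up u w b | inj₂ (uX , wX) with backwardX u w uX wX b
  ... | j , u∈ , w∈ with starsOK j
  ... | inj₁ (_ , _ , f) = let (p , p') = proj₁ (f u w u∈ w∈) b in inj₂ (mkUp (leaf j) (centre j) p' p (upL j))
  ... | inj₂ (_ , _ , f) = let (p , p') = proj₁ (f u w u∈ w∈) b in inj₁ (mkUp (leaf j) (centre j) p p' (upL j))

  up⇒backward′ : ∀ {t t' u w} → Up t t' → Is u t → Is w t' → Backward u w ⊎ Backward w u
  up⇒backward′ {u = u} {w} (upA i) p p' with spidersOK i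
  ... | inj₁ (_ , _ , _ , f) = inj₂ (proj₂ (f w u (in-role {i} {0F} p') (in-legA p)) (inj₂ (inj₂ (inj₁ (p' , p)))))
  ... | inj₂ (inj₁ (_ , _ , _ , f)) = inj₂ (proj₂ (f w u (in-role {i} {0F} p') (in-legA p)) (inj₂ (inj₂ (inj₂ (p' , p)))))
  ... | inj₂ (inj₂ (_ , _ , _ , f)) = inj₁ (proj₂ (f u w (in-legA p) (in-role {i} {0F} p')) (inj₂ (inj₂ (inj₂ (p , p')))))
  up⇒backward′ {u = u} {w} (upB i) p p' with spidersOK i
  ... | inj₁ (_ , _ , _ , f) = inj₁ (proj₂ (f u w (in-legB p) (in-role {i} {4F} p')) (inj₂ (inj₂ (inj₂ (p , p')))))
  ... | inj₂ (inj₁ (_ , _ , _ , f)) = inj₂ (proj₂ (f w u (in-role {i} {4F} p') (in-legB p)) (inj₂ (inj₂ (inj₁ (p' , p)))))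
  ... | inj₂ (inj₂ (_ , _ , _ , f)) = inj₁ (proj₂ (f u w (in-legB p) (in-role {i} {4F} p')) (inj₂ (inj₂ (inj₁ (p , p')))))
  up⇒backward′ {u = u} {w} (up3 i) p p' with spidersOK i
  ... | inj₁ (_ , _ , _ , f) = inj₁ (proj₂ (f u w (in-role {i} {3F} p) (in-role {i} {0F} p')) (inj₁ (p , p')))
  ... | inj₂ (inj₁ (_ , _ , _ , f)) = inj₁ (proj₂ (f u w (in-role {i} {3F} p) (in-role {i} {0F} p')) (inj₂ (inj₁ (p , p'))))
  ... | inj₂ (inj₂ (_ , _ , _ , f)) = inj₁ (proj₂ (f u w (in-role {i} {3F} p) (in-role {i} {0F} p')) (inj₁ (p , p')))
  up⇒backward′ {u = u} {w} (up1 i) p p' with spidersOK i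
  ... | inj₁ (_ , _ , _ , f) = inj₂ (proj₂ (f w u (in-role {i} {4F} p') (in-role {i} {1F} p)) (inj₂ (inj₁ (p' , p))))
  ... | inj₂ (inj₁ (_ , _ , _ , f)) = inj₂ (proj₂ (f w u (in-role {i} {4F} p') (in-role {i} {1F} p)) (inj₁ (p' , p)))
  ... | inj₂ (inj₂ (_ , _ , _ , f)) = inj₂ (proj₂ (f w u (in-role {i} {4F} p') (in-role {i} {1F} p)) (inj₂ (inj₁ (p' , p))))
  up⇒backward′ {u = u} {w} (upL j) p p' with starsOK j
  ... | inj₁ (_ , _ , f) = inj₂ (proj₂ (f w u (inj₁ p') (inj₂ p)) (p' , p))
  ... | inj₂ (_ , _ , f) = inj₁ (proj₂ (f u w (inj₂ p) (inj₁ p')) (p , p'))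

  up⇒backward : ∀ {u w} → UpV u w → Backward u w ⊎ Backward w u
  up⇒backward {u} {w} up = up⇒backward′ up (tag-is u) (tag-is w)

  forward : ∀ {u w} → u ≺ w → ¬ (UpV u w ⊎ UpV w u) → adj H u w ≡ true
  forward {u} {w} lt no-up = go (adj H w u) refl
    where
    go : ∀ b → adj H w u ≡ b → adj H u w ≡ true
    go true e = ⊥-elim (no-up (swap (backward⇒up w u (e , lt))))
    go false e = trans (tour H u w λ { refl → n≮n _ lt }) (cong not e)

  backward : ∀ {u w} → u ≺ w → UpV u w ⊎ UpV w u → adj H w u ≡ true
  backward {u} {w} lt up = go (resolve up)
    where
    resolve : UpV u w ⊎ UpV w u → Backward u w ⊎ Backward w u
    resolve (inj₁ x) = up⇒backward x
    resolve (inj₂ x) = swap (up⇒backward x)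
    go : Backward u w ⊎ Backward w u → adj H w u ≡ true
    go (inj₁ (_ , gt)) = ⊥-elim (<-asym lt gt)
    go (inj₂ (e , _)) = e

-- Components of the backward graph and runs of leaves

<ᵇ-true : ∀ {m n} → m < n → (m <ᵇ n) ≡ true
<ᵇ-true {m} {n} lt with m <ᵇ n | <⇒<ᵇ lt
... | true | _ = refl

true-<ᵇ : ∀ {m n} → (m <ᵇ n) ≡ true → m < n
true-<ᵇ {m} {n} e = <ᵇ⇒< m n (subst T (sym e) _)

∧-true : ∀ {a b} → a ∧ b ≡ true → a ≡ true × b ≡ true
∧-true {true} {true} _ = refl , refl

module Components {k : ℕ} (H : Tournament k) (θ : Permutation′ k) (sg : Ordered.SuperGalaxy H θ) where
  open Anatomy H θ sg public

  boss : Tag → Fin k → Fin k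
  boss (legA i) _ = int i 0F
  boss (legB i) _ = int i 4F
  boss (role i 1F) _ = int i 4F
  boss (role i 3F) _ = int i 0F
  boss (leaf j) _ = center (st j)
  boss _ h = h

  -- Components of the backward graph are named by their centres.
  star-of : Fin k → Fin k
  star-of h = boss (tag h) h

  tag-int : ∀ i r → tag (int i r) ≡ role i r
  tag-int i r = tag≡ (role i r) refl

  star-of-up : ∀ {u v} → UpV u v → star-of u ≡ v
  star-of-up {u} {v} up = go up refl refl
    where
    go : ∀ {t t'} → Up t t' → tag u ≡ t → tag v ≡ t' → star-of u ≡ v
    go (upA i) e e' = trans (cong (λ t → boss t u) e) (sym (is e'))
    go (upB i) e e' = trans (cong (λ t → boss t u) e) (sym (is e'))
    go (up3 i) e e' = trans (cong (λ t → boss t u) e) (sym (is e'))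
    go (up1 i) e e' = trans (cong (λ t → boss t u) e) (sym (is e'))
    go (upL j) e e' = trans (cong (λ t → boss t u) e) (sym (is e'))

  star-of-top : ∀ {u v} → UpV u v → star-of v ≡ v
  star-of-top {u} {v} up = go up refl
    where
    go : ∀ {t t'} → Up t t' → tag v ≡ t' → star-of v ≡ v
    go (upA i) e = cong (λ t → boss t v) e
    go (upB i) e = cong (λ t → boss t v) e
    go (up3 i) e = cong (λ t → boss t v) e
    go (up1 i) e = cong (λ t → boss t v) e
    go (upL j) e = cong (λ t → boss t v) e

  up-star-of : ∀ u → star-of u ≡ u ⊎ UpV u (star-of u)
  up-star-of u = go (tag u) refl
    where
    up : ∀ t t' → tag u ≡ t → Is (boss t u) t' → Up t t' → star-of u ≡ u ⊎ UpV u (star-of u)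
    up t t' e p x = inj₂ (subst (λ z → UpV u (boss z u)) (sym e) (mkUp t t' (is e) p x))
    go : ∀ t → tag u ≡ t → star-of u ≡ u ⊎ UpV u (star-of u)
    go (legA i) e = up (legA i) (role i 0F) e refl (upA i)
    go (legB i) e = up (legB i) (role i 4F) e refl (upB i)
    go (role i 0F) e = inj₁ (cong (λ t → boss t u) e)
    go (role i 1F) e = up (role i 1F) (role i 4F) e refl (up1 i)
    go (role i 2F) e = inj₁ (cong (λ t → boss t u) e)
    go (role i 3F) e = up (role i 3F) (role i 0F) e refl (up3 i)
    go (role i 4F) e = inj₁ (cong (λ t → boss t u) e)
    go (leaf j) e = up (leaf j) (centre j) e refl (upL j)
    go (centre j) e = inj₁ (cong (λ t → boss t u) e)
    go other e = inj₁ (cong (λ t → boss t u) e)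

  star-of-idem : ∀ u → star-of (star-of u) ≡ star-of u
  star-of-idem u = go (up-star-of u) refl
    where
    go : ∀ {c} → c ≡ u ⊎ UpV u c → c ≡ star-of u → star-of c ≡ c
    go (inj₁ refl) e = sym e
    go (inj₂ up) _ = star-of-top up

  differ⇒no-up : ∀ {u v} → star-of u ≢ star-of v → ¬ (UpV u v ⊎ UpV v u)
  differ⇒no-up ne (inj₁ up) = ne (trans (star-of-up up) (sym (star-of-top up)))
  differ⇒no-up ne (inj₂ up) = ne (trans (star-of-top up) (sym (star-of-up up)))

  leaf-up : ∀ {l c} → star-of l ≡ c → l ≢ c → UpV l c
  leaf-up {l} {c} e ne = go (up-star-of l) e
    where
    go : ∀ {x} → x ≡ l ⊎ UpV l x → x ≡ c → UpV l c
    go (inj₁ e') e = ⊥-elim (ne (trans (sym e') e))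
    go (inj₂ up) refl = up

  leaves-no-up : ∀ {l l' c} → star-of l ≡ c → star-of l' ≡ c → l ≢ c → l' ≢ c → ¬ (UpV l l' ⊎ UpV l' l)
  leaves-no-up e e' ne ne' (inj₁ up) = ne' (trans (sym (star-of-up up)) e)
  leaves-no-up e e' ne ne' (inj₂ up) = ne (trans (sym (star-of-up up)) e')

  -- Legs, leaves and isolated vertices are the ones to be placed in chains. Centres and spider
  -- interiors go into linear sets and separate the runs.
  leafyᵗ : Tag → Bool
  leafyᵗ (role _ _) = false
  leafyᵗ (centre _) = false
  leafyᵗ _ = true

  leafy : Fin k → Bool
  leafy h = leafyᵗ (tag h)

  leafy-int : ∀ i r → leafy (int i r) ≡ false
  leafy-int i r = cong leafyᵗ (tag-int i r)

  boss′ : Tag → Fin k → Fin k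
  boss′ (role i 1F) _ = int i 1F
  boss′ (role i 2F) _ = int i 1F
  boss′ (role i 3F) _ = int i 1F
  boss′ t h = boss t h

  -- The components after reordering the interior of each spider as 4, 1, 3, 5, 2: vertices 2, 3, 4 form a backward triangle.
  comp : Fin k → Fin k
  comp h = boss′ (tag h) h

  -- The interior of a spider is moved as a block: its five vertices take the rank of the first one
  -- and hence share a slot.
  repᵗ : Tag → Fin k → Fin k
  repᵗ (role i _) _ = int i 0F
  repᵗ _ h = h

  rep : Fin k → Fin k
  rep h = repᵗ (tag h) h

  before : Fin k → Fin k → Bool
  before h x = not (leafy x) ∧ (pos x <ᵇ pos h)

  rank-of : Fin k → ℕ
  rank-of h = # (before h) (allFin k)

  -- All vertices of a maximal run of leaves share a slot; every centre, and every spider interior, has its own.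
  slot : Fin k → ℕ
  slot h = 2 * rank-of (rep h) + (if leafy h then 0 else 1)

  rank≤k : ∀ h → rank-of h ≤ k
  rank≤k h = ≤-trans (#≤length (before h) (allFin k)) (≤-reflexive (length-tabulate {n = k} (λ x → x)))

  slot-bound : ∀ h → slot h < 2 * k + 2
  slot-bound h = ≤-trans (s≤s (+-mono-≤ (*-monoʳ-≤ 2 (rank≤k (rep h))) (bit (leafy h)))) (≤-reflexive (sym (+-suc (2 * k) 1)))
    where
    bit : ∀ b → (if b then 0 else 1) ≤ 1
    bit true = z≤n
    bit false = ≤-refl

  before-mono : ∀ {u v} → pos u ≤ pos v → ∀ {x} → before u x ≡ true → before v x ≡ true
  before-mono le e = let (a , b) = ∧-true e in cong₂ _∧_ a (<ᵇ-true (<-≤-trans (true-<ᵇ b) le))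

  rank-mono : ∀ {u v} → pos u ≤ pos v → rank-of u ≤ rank-of v
  rank-mono {u} {v} le = #-weaken (before u) (before v) (allFin k) (λ _ → before-mono le)

  rank-strict : ∀ {u v} → u ≺ v → leafy u ≡ false → rank-of u < rank-of v
  rank-strict {u} {v} lt nl = #-strict (before u) (before v) (allFin k) (λ _ → before-mono (<⇒≤ lt)) (∈-allFin u)
    (trans (cong (λ b → not b ∧ (pos u <ᵇ pos u)) nl) (irreflexive (pos u))) (cong₂ (λ a b → not a ∧ b) nl (<ᵇ-true lt))
    where
    irreflexive : ∀ m → (m <ᵇ m) ≡ false
    irreflexive zero = refl
    irreflexive (suc m) = irreflexive m

  rank-same : ∀ {u v} → pos u ≤ pos v → (∀ x → leafy x ≡ false → pos u ≤ pos x → pos x < pos v → ⊥) → rank-of u ≡ rank-of v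
  rank-same {u} {v} le none = ≤-antisym (rank-mono le) (#-weaken (before v) (before u) (allFin k) λ {x} _ e →
    let (a , b) = ∧-true {not (leafy x)} e
    in cong₂ _∧_ a (<ᵇ-true (≰⇒> λ ge → none x (not-true a) ge (true-<ᵇ b))))

  rep-≤ : ∀ h → pos (rep h) ≤ pos h
  rep-≤ h = go (tag h) refl
    where
    go : ∀ t → tag h ≡ t → pos (repᵗ t h) ≤ pos h
    go (role i r) e = subst (λ z → pos (int i 0F) ≤ pos z) (sym (is e)) (int-≥ i r)
    go (legA _) e = ≤-refl
    go (legB _) e = ≤-refl
    go (leaf _) e = ≤-refl
    go (centre _) e = ≤-refl
    go other e = ≤-refl

  SameInterior : Fin k → Fin k → Set
  SameInterior u v = Σ _ λ i → Σ _ λ r → Σ _ λ r' → tag u ≡ role i r × tag v ≡ role i r'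

  -- The interior of a spider is an interval of θ.
  below-rep : ∀ {u v} → u ≺ v → ¬ SameInterior u v → pos u < pos (rep v)
  below-rep {u} {v} lt out = go (tag v) refl
    where
    go : ∀ t → tag v ≡ t → pos u < pos (repᵗ t v)
    go (role i r) e = ≰⇒> inside
      where
      inside : pos (int i 0F) ≤ pos u → ⊥
      inside le with m≤n⇒m<n∨m≡n le
      ... | inj₂ eq = out (i , 0F , r , tag≡ (role i 0F) (sym (pos-injective eq)) , e)
      ... | inj₁ lt' = let (_ , _ , _ , _ , petal , _) = base i
                           (r' , e') = Interior-int i (inj₂ (weaken (petal u lt' (<-≤-trans lt (subst (λ z → pos z ≤ pos (int i 4F)) (sym (is e)) (int-≤ i r))))))
                       in out (i , r' , r , tag≡ (role i r') e' , e)
        where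
        weaken : Petal (sp i) u → u ≡ i2 (sp i) ⊎ u ≡ i3 (sp i) ⊎ u ≡ i4 (sp i) ⊎ u ≡ i5 (sp i)
        weaken (inj₁ x) = inj₁ x
        weaken (inj₂ (inj₁ x)) = inj₂ (inj₁ x)
        weaken (inj₂ (inj₂ x)) = inj₂ (inj₂ (inj₁ x))
    go (legA _) e = lt
    go (legB _) e = lt
    go (leaf _) e = lt
    go (centre _) e = lt
    go other e = lt

  leafy-rep : ∀ h → leafy (rep h) ≡ leafy h
  leafy-rep h = go (tag h) refl
    where
    go : ∀ t → tag h ≡ t → leafy (repᵗ t h) ≡ leafy h
    go (role i r) e = trans (cong leafyᵗ (tag-int i 0F)) (cong leafyᵗ (sym e))
    go (legA _) e = refl
    go (legB _) e = refl
    go (leaf _) e = refl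
    go (centre _) e = refl
    go other e = refl

  -- Passing a centre or an interior raises the rank, and the parity separates a leafy vertex from a
  -- non-leafy one of the same rank. So outside a spider interior only vertices of one run share a
  -- slot.
  slot-order : ∀ {u v} → u ≺ v → ¬ SameInterior u v → slot u < slot v ⊎ (slot u ≡ slot v × leafy u ≡ true × leafy v ≡ true)
  slot-order {u} {v} lt out = go (leafy u) (leafy v) refl refl
    where
    lt' : rep u ≺ rep v
    lt' = ≤-<-trans (rep-≤ u) (below-rep lt out)
    R = 2 * rank-of (rep u)
    R' = 2 * rank-of (rep v)
    R≤ : R ≤ R'
    R≤ = *-monoʳ-≤ 2 (rank-mono (<⇒≤ lt'))
    go : ∀ b b' → leafy u ≡ b → leafy v ≡ b' → slot u < slot v ⊎ (slot u ≡ slot v × b ≡ true × b' ≡ true)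
    go true true e e' with m≤n⇒m<n∨m≡n R≤
    ... | inj₁ l = inj₁ (subst₂ (λ x y → R + (if x then 0 else 1) < R' + (if y then 0 else 1)) (sym e) (sym e') (+-monoˡ-< 0 l))
    ... | inj₂ q = inj₂ (subst₂ (λ x y → R + (if x then 0 else 1) ≡ R' + (if y then 0 else 1)) (sym e) (sym e') (cong (_+ 0) q) , refl , refl)
    go true false e e' = inj₁ (subst₂ (λ x y → R + (if x then 0 else 1) < R' + (if y then 0 else 1)) (sym e) (sym e')
      (≤-<-trans (+-monoˡ-≤ 0 R≤) (+-monoʳ-< R' (s≤s z≤n))))
    go false b' e e' = inj₁ (subst (λ x → R + (if x then 0 else 1) < slot v) (sym e) (≤-trans (≤-reflexive (trans (cong suc (+-comm R 1)) (sym (*-suc 2 (rank-of (rep u))))))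
      (≤-trans (*-monoʳ-≤ 2 (rank-strict lt' (trans (leafy-rep u) e))) (m≤m+n R' _))))

  rep-leafy : ∀ {h} → leafy h ≡ true → rep h ≡ h
  rep-leafy {h} e = go (tag h) e
    where
    go : ∀ t → leafyᵗ t ≡ true → repᵗ t h ≡ h
    go (legA _) e = refl
    go (legB _) e = refl
    go (leaf _) e = refl
    go other e = refl

  NoneBetween : Fin k → Fin k → Set
  NoneBetween u v = ∀ x → leafy x ≡ false → u ≺ x → x ≺ v → ⊥

  slot-same : ∀ {u v} → leafy u ≡ true → leafy v ≡ true → NoneBetween u v → NoneBetween v u → slot u ≡ slot v
  slot-same {u} {v} lu lv n n' = cong₂ (λ x y → 2 * x + (if y then 0 else 1))
      (subst₂ (λ x y → rank-of x ≡ rank-of y) (sym (rep-leafy lu)) (sym (rep-leafy lv)) (ranks (≤-total (pos u) (pos v))))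
      (trans lu (sym lv))
    where
    one : ∀ {u v} → leafy u ≡ true → NoneBetween u v → pos u ≤ pos v → rank-of u ≡ rank-of v
    one {u} lu n le = rank-same le λ x nl ge lt → n x nl (≤∧≢⇒< ge λ e → true≢false (trans (sym lu) (trans (cong leafy (pos-injective e)) nl))) lt
    ranks : pos u ≤ pos v ⊎ pos v ≤ pos u → rank-of u ≡ rank-of v
    ranks (inj₁ le) = one lu n le
    ranks (inj₂ ge) = sym (one lv n' ge)

  -- Each kind of intruder is excluded by its own condition: star centres between legs by
  -- `centerLegs`, interiors of other spiders between legs by `spiderOrder`, interiors between
  -- leaves by `interiorLv`, other centres between leaves by `galaxyCtr`. The own centre and the own
  -- interior do not intrude because all legs or leaves of one centre lie on the same side of them.
  none-between : ∀ {u v c} → UpV u c → UpV v c → leafy u ≡ true → leafy v ≡ true → NoneBetween u v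
  none-between {u} {v} {c} up up' lu lv x nl u<x x<v = go up up' refl refl refl (tag x) refl nl
    where
    legs : ∀ i → InSpider (sp i) u → InSpider (sp i) v → ∀ i' r → tag x ≡ role i' r →
      ((∀ y → y ≡ u ⊎ y ≡ v → y ≺ int i 0F) ⊎ (∀ y → y ≡ u ⊎ y ≡ v → int i 4F ≺ y)) → ⊥
    legs i u∈ v∈ i' r e side with <-cmp (toℕ i) (toℕ i')
    ... | tri< lt _ _ = <-asym x<v (spiderOrder i i' lt v x v∈ (in-role {i'} {r} (is e)))
    ... | tri> _ _ gt = <-asym u<x (spiderOrder i' i gt x u (in-role {i'} {r} (is e)) u∈)
    ... | tri≈ _ eq _ with toℕ-injective eq
    ... | refl with side
    ... | inj₁ f = <⇒≱ (<-trans x<v (f v (inj₂ refl))) (subst (λ z → pos (int i 0F) ≤ pos z) (sym (is e)) (int-≥ i r))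
    ... | inj₂ f = <⇒≱ (<-trans (f u (inj₁ refl)) u<x) (subst (λ z → pos z ≤ pos (int i 4F)) (sym (is e)) (int-≤ i r))
    side : ∀ {P : Fin k → Set} i → P u → P v → ((∀ l → P l → l ≺ int i 0F) ⊎ (∀ l → P l → int i 4F ≺ l)) →
      ((∀ y → y ≡ u ⊎ y ≡ v → y ≺ int i 0F) ⊎ (∀ y → y ≡ u ⊎ y ≡ v → int i 4F ≺ y))
    side i pu pv (inj₁ f) = inj₁ λ { y (inj₁ refl) → f y pu ; y (inj₂ refl) → f y pv }
    side i pu pv (inj₂ f) = inj₂ λ { y (inj₁ refl) → f y pu ; y (inj₂ refl) → f y pv }
    go : ∀ {t t' t''} → Up t t'' → Up t' t'' → tag u ≡ t → tag v ≡ t' → tag c ≡ t'' → ∀ tx → tag x ≡ tx → leafyᵗ tx ≡ false → ⊥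
    go (upA i) (upA _) e e' _ (centre j) ex _ = centerLegs i j u v (inj₁ (is e , is e')) (inj₁ (subst (u ≺_) (is ex) u<x , subst (_≺ v) (is ex) x<v))
    go (upA i) (upA _) e e' _ (role i' r) ex _ = legs i (in-legA (is e)) (in-legA (is e')) i' r ex (side i (is e) (is e') (legsA-side i))
    go (upB i) (upB _) e e' _ (centre j) ex _ = centerLegs i j u v (inj₂ (is e , is e')) (inj₁ (subst (u ≺_) (is ex) u<x , subst (_≺ v) (is ex) x<v))
    go (upB i) (upB _) e e' _ (role i' r) ex _ = legs i (in-legB (is e)) (in-legB (is e')) i' r ex (side i (is e) (is e') (legsB-side i))
    go (upL j) (upL _) e e' _ (role i r) ex _ = interiorLv i j x u v (subst (Interior (sp i)) (sym (is ex)) (int-Interior i r)) (is e) (is e') (inj₁ (u<x , x<v))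
    go (upL j) (upL _) e e' _ (centre j') ex _ = own (j' ≟F j)
      where
      sides : IsStar (st j) → center (st j) ≡ x → ⊥
      sides (inj₁ (_ , f , _)) eq = <-asym (f v (is e')) (subst (_≺ v) (sym eq) x<v)
      sides (inj₂ (_ , f , _)) eq = <-asym (f u (is e)) (subst (u ≺_) (sym eq) u<x)
      own : Dec (j' ≡ j) → ⊥
      own (no ne) = galaxyCtr j' j ne u v (is e) (is e') (inj₁ (subst (u ≺_) (is ex) u<x , subst (_≺ v) (is ex) x<v))
      own (yes refl) = sides (starsOK j) (sym (is ex))
    go (up3 i) _ e _ _ _ _ _ = true≢false (trans (sym lu) (cong leafyᵗ e))
    go (up1 i) _ e _ _ _ _ _ = true≢false (trans (sym lu) (cong leafyᵗ e))
    go (upA i) (up3 _) _ e' _ _ _ _ = true≢false (trans (sym lv) (cong leafyᵗ e'))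
    go (upB i) (up1 _) _ e' _ _ _ _ = true≢false (trans (sym lv) (cong leafyᵗ e'))

  up⇒slot-same : ∀ {u v c} → UpV u c → UpV v c → leafy u ≡ true → leafy v ≡ true → slot u ≡ slot v
  up⇒slot-same up up' lu lv = slot-same lu lv (none-between up up' lu lv) (none-between up' up lv lu)

-- The reordering of the spider interiors

-- In the zone of slot z the sets numbered 2 a z < 2 b z < 2 c z receive the triangle of a spider,
-- and the gaps after the first two of them receive its centres.
module Reordering {k : ℕ} (H : Tournament k) (θ : Permutation′ k) (sg : Ordered.SuperGalaxy H θ)
  (M : ℕ) (a b c : ℕ → ℕ) (a<b : ∀ z → a z < b z) (b<c : ∀ z → b z < c z) (c<M : ∀ z → 2 * c z < M) where
  open Components H θ sg public

  subᵗ : Tag → ℕ → ℕ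
  subᵗ (role i 0F) z = 2 * a z + 1
  subᵗ (role i 1F) z = 2 * c z
  subᵗ (role i 2F) z = 2 * b z
  subᵗ (role i 3F) z = 2 * a z
  subᵗ (role i 4F) z = 2 * b z + 1
  subᵗ _ z = 0

  spot : Fin k → ℕ
  spot h = slot h * M + subᵗ (tag h) (slot h)

  odd-< : ∀ {x y} → x < y → 2 * x + 1 < 2 * y
  odd-< {x} {y} lt = ≤-trans (≤-reflexive (trans (cong suc (+-comm (2 * x) 1)) (sym (*-suc 2 x)))) (*-monoʳ-≤ 2 lt)

  even-<-odd : ∀ x → 2 * x < 2 * x + 1
  even-<-odd x = ≤-reflexive (sym (+-comm (2 * x) 1))

  even-< : ∀ {x y} → x < y → 2 * x < 2 * y
  even-< {x} lt = <-trans (even-<-odd x) (odd-< lt)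

  sub<M : ∀ t z → subᵗ t z < M
  sub<M (role i 0F) z = <-trans (odd-< (a<b z)) (<-trans (even-< (b<c z)) (c<M z))
  sub<M (role i 1F) z = c<M z
  sub<M (role i 2F) z = <-trans (even-< (b<c z)) (c<M z)
  sub<M (role i 3F) z = <-trans (even-< (a<b z)) (<-trans (even-< (b<c z)) (c<M z))
  sub<M (role i 4F) z = <-trans (odd-< (b<c z)) (c<M z)
  sub<M (legA i) z = ≤-<-trans z≤n (c<M z)
  sub<M (legB i) z = ≤-<-trans z≤n (c<M z)
  sub<M (leaf i) z = ≤-<-trans z≤n (c<M z)
  sub<M (centre i) z = ≤-<-trans z≤n (c<M z)
  sub<M other z = ≤-<-trans z≤n (c<M z)

  spot-bound : ∀ h → spot h < (2 * k + 2) * M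
  spot-bound h = <-≤-trans (+-monoʳ-< (slot h * M) (sub<M (tag h) (slot h)))
    (≤-trans (≤-reflexive (+-comm (slot h * M) M)) (*-monoˡ-≤ M (slot-bound h)))

  spot-leafy : ∀ {h} → leafy h ≡ true → spot h ≡ slot h * M
  spot-leafy {h} e = trans (cong (slot h * M +_) (go (tag h) e)) (+-identityʳ _)
    where
    go : ∀ t → leafyᵗ t ≡ true → subᵗ t (slot h) ≡ 0
    go (legA _) e = refl
    go (legB _) e = refl
    go (leaf _) e = refl
    go other e = refl

  spot-< : ∀ {u v} → slot u < slot v → spot u < spot v
  spot-< {u} {v} lt = <-≤-trans (+-monoʳ-< (slot u * M) (sub<M (tag u) (slot u)))
    (≤-trans (≤-reflexive (+-comm (slot u * M) M)) (≤-trans (*-monoˡ-≤ M lt) (m≤m+n _ _)))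

  -- The second alternative is for leafy vertices of one run: their sets will be blocks of the same
  -- chain, cut in the order of θ.
  Forward : Fin k → Fin k → Set
  Forward u v = adj H u v ≡ true × (spot u < spot v ⊎ (spot u ≡ spot v × leafy u ≡ true × leafy v ≡ true × u ≺ v))

  slot-int : ∀ i r → slot (int i r) ≡ slot (int i 0F)
  slot-int i r = trans (cong (λ t → 2 * rank-of (repᵗ t (int i r)) + (if leafyᵗ t then 0 else 1)) (tag-int i r))
    (sym (cong (λ t → 2 * rank-of (repᵗ t (int i 0F)) + (if leafyᵗ t then 0 else 1)) (tag-int i 0F)))

  spot-int : ∀ i r → spot (int i r) ≡ slot (int i 0F) * M + subᵗ (role i r) (slot (int i 0F))
  spot-int i r = cong₂ (λ s t → s * M + subᵗ t s) (slot-int i r) (tag-int i r)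

  private
    spot-int-< : ∀ i r r' → subᵗ (role i r) (slot (int i 0F)) < subᵗ (role i r') (slot (int i 0F)) → spot (int i r) < spot (int i r')
    spot-int-< i r r' lt = subst₂ _<_ (sym (spot-int i r)) (sym (spot-int i r')) (+-monoʳ-< (slot (int i 0F) * M) lt)

    forward-int : ∀ i r r' → toℕ r < toℕ r' → ¬ Up (role i r) (role i r') → ¬ Up (role i r') (role i r) → adj H (int i r) (int i r') ≡ true
    forward-int i r r' lt n n' = forward (int-mono i {r} {r'} lt) λ
      { (inj₁ up) → n (subst₂ Up (tag-int i r) (tag-int i r') up)
      ; (inj₂ up) → n' (subst₂ Up (tag-int i r') (tag-int i r) up) }

    backward-int : ∀ i r r' → toℕ r < toℕ r' → Up (role i r) (role i r') ⊎ Up (role i r') (role i r) → adj H (int i r') (int i r) ≡ true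
    backward-int i r r' lt up = backward (int-mono i {r} {r'} lt) (move up)
      where
      move : Up (role i r) (role i r') ⊎ Up (role i r') (role i r) → UpV (int i r) (int i r') ⊎ UpV (int i r') (int i r)
      move (inj₁ u) = inj₁ (subst₂ Up (sym (tag-int i r)) (sym (tag-int i r')) u)
      move (inj₂ u) = inj₂ (subst₂ Up (sym (tag-int i r')) (sym (tag-int i r)) u)

    mk : ∀ i r r' → adj H (int i r) (int i r') ≡ true → subᵗ (role i r) (slot (int i 0F)) < subᵗ (role i r') (slot (int i 0F)) → Forward (int i r) (int i r')
    mk i r r' e lt = e , inj₁ (spot-int-< i r r' lt)

    comp-int : ∀ i r → comp (int i r) ≡ boss′ (role i r) (int i r)
    comp-int i r = cong (λ t → boss′ t (int i r)) (tag-int i r)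

  private
    za zb zc : Fin (length spiders) → ℕ
    za i = a (slot (int i 0F))
    zb i = b (slot (int i 0F))
    zc i = c (slot (int i 0F))

  -- Of the ten pairs inside an interior, these seven are the ones not within the triangle. The new
  -- order makes all seven forward, including the two (`F30` and `F41`) that are backward in θ.
  F30 : ∀ i → Forward (int i 3F) (int i 0F)
  F30 i = mk i 3F 0F (backward-int i 0F 3F (s≤s z≤n) (inj₂ (up3 i))) (even-<-odd (za i))
  F04 : ∀ i → Forward (int i 0F) (int i 4F)
  F04 i = mk i 0F 4F (forward-int i 0F 4F (s≤s z≤n) (λ ()) (λ ())) (<-trans (odd-< (a<b (slot (int i 0F)))) (even-<-odd (zb i)))
  F01 : ∀ i → Forward (int i 0F) (int i 1F)
  F01 i = mk i 0F 1F (forward-int i 0F 1F (s≤s z≤n) (λ ()) (λ ())) (odd-< (<-trans (a<b (slot (int i 0F))) (b<c (slot (int i 0F)))))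
  F02 : ∀ i → Forward (int i 0F) (int i 2F)
  F02 i = mk i 0F 2F (forward-int i 0F 2F (s≤s z≤n) (λ ()) (λ ())) (odd-< (a<b (slot (int i 0F))))
  F41 : ∀ i → Forward (int i 4F) (int i 1F)
  F41 i = mk i 4F 1F (backward-int i 1F 4F (s≤s (s≤s z≤n)) (inj₁ (up1 i))) (odd-< (b<c (slot (int i 0F))))
  F24 : ∀ i → Forward (int i 2F) (int i 4F)
  F24 i = mk i 2F 4F (forward-int i 2F 4F (s≤s (s≤s (s≤s z≤n))) (λ ()) (λ ())) (even-<-odd (zb i))
  F34 : ∀ i → Forward (int i 3F) (int i 4F)
  F34 i = mk i 3F 4F (forward-int i 3F 4F ≤-refl (λ ()) (λ ())) (<-trans (even-< (a<b (slot (int i 0F)))) (even-<-odd (zb i)))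

  triangle-arcs : ∀ i → adj H (int i 2F) (int i 3F) ≡ true × adj H (int i 1F) (int i 3F) ≡ true × adj H (int i 1F) (int i 2F) ≡ true
  triangle-arcs i = forward-int i 2F 3F ≤-refl (λ ()) (λ ()) , forward-int i 1F 3F (s≤s (s≤s z≤n)) (λ ()) (λ ()) , forward-int i 1F 2F ≤-refl (λ ()) (λ ())

  private
    inside : ∀ i r r' → comp (int i r) ≢ comp (int i r') → Forward (int i r) (int i r') ⊎ Forward (int i r') (int i r)
    inside i 0F 0F ne = ⊥-elim (ne refl)
    inside i 0F 1F ne = inj₁ (F01 i)
    inside i 0F 2F ne = inj₁ (F02 i)
    inside i 0F 3F ne = inj₂ (F30 i)
    inside i 0F 4F ne = inj₁ (F04 i)
    inside i 1F 0F ne = inj₂ (F01 i)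
    inside i 1F 1F ne = ⊥-elim (ne refl)
    inside i 1F 2F ne = ⊥-elim (ne (trans (comp-int i 1F) (sym (comp-int i 2F))))
    inside i 1F 3F ne = ⊥-elim (ne (trans (comp-int i 1F) (sym (comp-int i 3F))))
    inside i 1F 4F ne = inj₂ (F41 i)
    inside i 2F 0F ne = inj₂ (F02 i)
    inside i 2F 1F ne = ⊥-elim (ne (trans (comp-int i 2F) (sym (comp-int i 1F))))
    inside i 2F 2F ne = ⊥-elim (ne refl)
    inside i 2F 3F ne = ⊥-elim (ne (trans (comp-int i 2F) (sym (comp-int i 3F))))
    inside i 2F 4F ne = inj₁ (F24 i)
    inside i 3F 0F ne = inj₁ (F30 i)
    inside i 3F 1F ne = ⊥-elim (ne (trans (comp-int i 3F) (sym (comp-int i 1F))))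
    inside i 3F 2F ne = ⊥-elim (ne (trans (comp-int i 3F) (sym (comp-int i 2F))))
    inside i 3F 3F ne = ⊥-elim (ne refl)
    inside i 3F 4F ne = inj₁ (F34 i)
    inside i 4F 0F ne = inj₂ (F04 i)
    inside i 4F 1F ne = inj₁ (F41 i)
    inside i 4F 2F ne = inj₂ (F24 i)
    inside i 4F 3F ne = inj₂ (F34 i)
    inside i 4F 4F ne = ⊥-elim (ne refl)

  SameInterior? : ∀ u v → Dec (SameInterior u v)
  SameInterior? u v = go (tag u) (tag v) refl refl
    where
    no-role : ∀ {t} → leafyᵗ t ≡ true ⊎ (Σ _ λ j → t ≡ centre j) → ∀ {i r} → t ≢ role i r
    no-role (inj₁ ()) refl
    no-role (inj₂ (_ , ())) refl
    go : ∀ t t' → tag u ≡ t → tag v ≡ t' → Dec (SameInterior u v)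
    go (role i r) (role i' r') e e' = same (i ≟F i')
      where
      eq-i : ∀ {i i' i'' r r' s s'} → role i r ≡ role i'' s → role i' r' ≡ role i'' s' → i ≡ i'
      eq-i refl refl = refl
      same : Dec (i ≡ i') → Dec (SameInterior u v)
      same (yes refl) = yes (i , r , r' , e , e')
      same (no ne) = no λ { (i'' , _ , _ , q , q') → ne (eq-i (trans (sym e) q) (trans (sym e') q')) }
    go (role i r) (legA _) e e' = no λ { (_ , _ , _ , _ , q) → no-role (inj₁ refl) (trans (sym e') q) }
    go (role i r) (legB _) e e' = no λ { (_ , _ , _ , _ , q) → no-role (inj₁ refl) (trans (sym e') q) }
    go (role i r) (leaf _) e e' = no λ { (_ , _ , _ , _ , q) → no-role (inj₁ refl) (trans (sym e') q) }
    go (role i r) (centre j) e e' = no λ { (_ , _ , _ , _ , q) → no-role (inj₂ (j , refl)) (trans (sym e') q) }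
    go (role i r) other e e' = no λ { (_ , _ , _ , _ , q) → no-role (inj₁ refl) (trans (sym e') q) }
    go (legA _) _ e e' = no λ { (_ , _ , _ , q , _) → no-role (inj₁ refl) (trans (sym e) q) }
    go (legB _) _ e e' = no λ { (_ , _ , _ , q , _) → no-role (inj₁ refl) (trans (sym e) q) }
    go (leaf _) _ e e' = no λ { (_ , _ , _ , q , _) → no-role (inj₁ refl) (trans (sym e) q) }
    go (centre j) _ e e' = no λ { (_ , _ , _ , q , _) → no-role (inj₂ (j , refl)) (trans (sym e) q) }
    go other _ e e' = no λ { (_ , _ , _ , q , _) → no-role (inj₁ refl) (trans (sym e) q) }

  -- The only edges of the backward graph that `comp` tears apart are those between 4 and 1 and
  -- between 2 and 5, and both lie inside one interior.
  up-outside⇒comp : ∀ {u v} → ¬ SameInterior u v → UpV u v → comp u ≡ comp v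
  up-outside⇒comp {u} {v} out up = go up refl refl
    where
    go : ∀ {t t'} → Up t t' → tag u ≡ t → tag v ≡ t' → comp u ≡ comp v
    hang : ∀ {t t'} → tag u ≡ t → tag v ≡ t' → boss′ t' v ≡ v → boss′ t u ≡ v → comp u ≡ comp v
    hang e e' q q' = trans (cong (λ t → boss′ t u) e) (trans q' (sym (trans (cong (λ t → boss′ t v) e') q)))
    go (upA i) e e' = hang e e' refl (sym (is e'))
    go (upB i) e e' = hang e e' refl (sym (is e'))
    go (upL j) e e' = hang e e' refl (sym (is e'))
    go (up3 i) e e' = ⊥-elim (out (i , 3F , 0F , e , e'))
    go (up1 i) e e' = ⊥-elim (out (i , 1F , 4F , e , e'))

  private
    outside : ∀ {u v} → u ≺ v → ¬ SameInterior u v → comp u ≢ comp v → Forward u v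
    outside {u} {v} lt out ne = forward lt no-up , place (slot-order lt out)
      where
      no-up : ¬ (UpV u v ⊎ UpV v u)
      no-up (inj₁ up) = ne (up-outside⇒comp out up)
      no-up (inj₂ up) = ne (sym (up-outside⇒comp (λ { (i , r , r' , e , e') → out (i , r' , r , e' , e) }) up))
      place : slot u < slot v ⊎ (slot u ≡ slot v × leafy u ≡ true × leafy v ≡ true) →
        spot u < spot v ⊎ (spot u ≡ spot v × leafy u ≡ true × leafy v ≡ true × u ≺ v)
      place (inj₁ l) = inj₁ (spot-< l)
      place (inj₂ (e , lu , lv)) = inj₂ (trans (spot-leafy lu) (trans (cong (_* M) e) (sym (spot-leafy lv))) , lu , lv , lt)

  forward-order : ∀ {u v} → comp u ≢ comp v → Forward u v ⊎ Forward v u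
  forward-order {u} {v} ne = go (SameInterior? u v)
    where
    go : Dec (SameInterior u v) → Forward u v ⊎ Forward v u
    go (yes (i , r , r' , e , e')) = subst₂ (λ x y → Forward x y ⊎ Forward y x) (sym (is e)) (sym (is e'))
      (inside i r r' (subst₂ (λ x y → comp x ≢ comp y) (is e) (is e') ne))
    go (no out) = ordered (<-cmp (pos u) (pos v))
      where
      ordered : Tri (u ≺ v) (pos u ≡ pos v) (v ≺ u) → Forward u v ⊎ Forward v u
      ordered (tri< lt _ _) = inj₁ (outside lt out ne)
      ordered (tri≈ _ e _) = ⊥-elim (ne (cong comp (pos-injective e)))
      ordered (tri> _ _ gt) = inj₂ (outside gt (λ { (i , r , r' , e , e') → out (i , r' , r , e' , e) }) (λ e → ne (sym e)))

  -- A vertex `x` names no component, or the petals of a spider (being its vertex 2), or a star with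
  -- centre `x`, possibly without leaves.
  data Shape (x : Fin k) : Set where
    empty : (∀ h → comp h ≢ x) → Shape x
    triangle : ∀ i → (∀ {h} → comp h ≡ x → h ≡ int i 3F ⊎ h ≡ int i 2F ⊎ h ≡ int i 1F) →
      (∀ h → h ≡ int i 3F ⊎ h ≡ int i 2F ⊎ h ≡ int i 1F → comp h ≡ x) → Shape x
    star : comp x ≡ x → (∀ {l} → comp l ≡ x → l ≢ x → leafy l ≡ true × leafy x ≡ false) → (∀ {l} → comp l ≡ x → l ≢ x → UpV l x) → Shape x

  Rootᵗ : Tag → Set
  Rootᵗ (role i 0F) = ⊤
  Rootᵗ (role i 4F) = ⊤
  Rootᵗ (centre j) = ⊤
  Rootᵗ other = ⊤
  Rootᵗ _ = ⊥

  private
    data View (h : Fin k) : Set where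
      root : comp h ≡ h → Rootᵗ (tag h) → View h
      hanging : UpV h (comp h) → leafy h ≡ true → Rootᵗ (tag (comp h)) → View h
      triangular : ∀ i → h ≡ int i 3F ⊎ h ≡ int i 2F ⊎ h ≡ int i 1F → comp h ≡ int i 1F → View h

    view : ∀ h → View h
    view h = go (tag h) refl
      where
      comp≡ : ∀ {t} → tag h ≡ t → comp h ≡ boss′ t h
      comp≡ e = cong (λ t → boss′ t h) e
      at-root : ∀ t → tag h ≡ t → boss′ t h ≡ h → Rootᵗ t → View h
      at-root t e q r = root (trans (comp≡ e) q) (subst Rootᵗ (sym e) r)
      hang : ∀ t t' → tag h ≡ t → Is (boss′ t h) t' → Up t t' → leafyᵗ t ≡ true → Rootᵗ t' → View h
      hang t t' e p up l r = hanging (subst (UpV h) (sym (comp≡ e)) (mkUp t t' (is e) p up)) (trans (cong leafyᵗ e) l)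
        (subst Rootᵗ (sym (trans (cong tag (comp≡ e)) (tag≡ t' p))) r)
      go : ∀ t → tag h ≡ t → View h
      go (legA i) e = hang (legA i) (role i 0F) e refl (upA i) refl tt
      go (legB i) e = hang (legB i) (role i 4F) e refl (upB i) refl tt
      go (role i 0F) e = at-root (role i 0F) e refl tt
      go (role i 1F) e = triangular i (inj₂ (inj₂ (is e))) (comp≡ e)
      go (role i 2F) e = triangular i (inj₂ (inj₁ (is e))) (comp≡ e)
      go (role i 3F) e = triangular i (inj₁ (is e)) (comp≡ e)
      go (role i 4F) e = at-root (role i 4F) e refl tt
      go (leaf j) e = hang (leaf j) (centre j) e refl (upL j) refl tt
      go (centre j) e = at-root (centre j) e refl tt
      go other e = at-root other e refl tt

    up-target : ∀ {t t'} → Up t t' → leafyᵗ t' ≡ false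
    up-target (upA i) = refl
    up-target (upB i) = refl
    up-target (up3 i) = refl
    up-target (up1 i) = refl
    up-target (upL j) = refl

    root-star : ∀ x → Rootᵗ (tag x) → Shape x
    root-star x r = star (self (view x)) (λ e ne → let (_ , l , nl) = members e ne in l , nl) (λ e ne → proj₁ (members e ne))
      where
      not-petal : ∀ i → x ≡ int i 1F → ⊥
      not-petal i e = subst Rootᵗ (trans (cong tag e) (tag-int i 1F)) r
      self : View x → comp x ≡ x
      self (root e _) = e
      self (hanging up _ _) = ⊥-elim (top-down up r)
        where
        top-down : ∀ {t t'} → Up t t' → Rootᵗ t → ⊥
        top-down (up3 i) ()
        top-down (up1 i) ()
      self (triangular i (inj₁ e) _) = ⊥-elim (subst Rootᵗ (trans (cong tag e) (tag-int i 3F)) r)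
      self (triangular i (inj₂ (inj₁ e)) _) = ⊥-elim (subst Rootᵗ (trans (cong tag e) (tag-int i 2F)) r)
      self (triangular i (inj₂ (inj₂ e)) _) = ⊥-elim (not-petal i e)
      members : ∀ {l} → comp l ≡ x → l ≢ x → UpV l x × leafy l ≡ true × leafy x ≡ false
      members {l} e ne = go (view l)
        where
        go : View l → UpV l x × leafy l ≡ true × leafy x ≡ false
        go (root e' _) = ⊥-elim (ne (trans (sym e') e))
        go (hanging up lf _) = subst (UpV l) e up , lf , up-target (subst (UpV l) e up)
        go (triangular i _ e') = ⊥-elim (not-petal i (trans (sym e) e'))

    no-members : ∀ x → ¬ Rootᵗ (tag x) → (∀ i → tag x ≢ role i 1F) → Shape x
    no-members x nr np = empty λ h e → go h e (view h)
      where
      go : ∀ h → comp h ≡ x → View h → ⊥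
      go h e (root e' r) = nr (subst (λ z → Rootᵗ (tag z)) (trans (sym e') e) r)
      go h e (hanging _ _ r) = nr (subst (λ z → Rootᵗ (tag z)) e r)
      go h e (triangular i _ e') = np i (trans (cong tag (trans (sym e) e')) (tag-int i 1F))

    petals : ∀ i {x} → tag x ≡ role i 1F → ∀ {h} → comp h ≡ x → h ≡ int i 3F ⊎ h ≡ int i 2F ⊎ h ≡ int i 1F
    petals i {x} t {h} e = go (view h)
      where
      role-inj : ∀ {i' r r'} → role i' r ≡ role i r' → i' ≡ i
      role-inj refl = refl
      go : View h → h ≡ int i 3F ⊎ h ≡ int i 2F ⊎ h ≡ int i 1F
      go (root e' r) = inj₂ (inj₂ (trans (trans (sym e') e) (is t)))
      go (hanging _ _ r) = ⊥-elim (subst Rootᵗ (trans (cong tag e) t) r)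
      go (triangular i' p e') with role-inj (trans (sym (tag-int i' 1F)) (trans (cong tag (trans (sym e') e)) t))
      ... | refl = p

    conv : ∀ i {x} → tag x ≡ role i 1F → ∀ h → h ≡ int i 3F ⊎ h ≡ int i 2F ⊎ h ≡ int i 1F → comp h ≡ x
    conv i t h (inj₁ refl) = trans (comp-int i 3F) (sym (is t))
    conv i t h (inj₂ (inj₁ refl)) = trans (comp-int i 2F) (sym (is t))
    conv i t h (inj₂ (inj₂ refl)) = trans (comp-int i 1F) (sym (is t))

  shape : ∀ x → Shape x
  shape x = go (tag x) refl
    where
    go : ∀ t → tag x ≡ t → Shape x
    go (legA i) e = no-members x (λ r → subst Rootᵗ e r) (λ i q → case trans (sym e) q of λ ())
    go (legB i) e = no-members x (λ r → subst Rootᵗ e r) (λ i q → case trans (sym e) q of λ ())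
    go (role i 0F) e = root-star x (subst Rootᵗ (sym e) tt)
    go (role i 1F) e = triangle i (petals i e) (conv i e)
    go (role i 2F) e = no-members x (λ r → subst Rootᵗ e r) (λ i q → case trans (sym e) q of λ ())
    go (role i 3F) e = no-members x (λ r → subst Rootᵗ e r) (λ i q → case trans (sym e) q of λ ())
    go (role i 4F) e = root-star x (subst Rootᵗ (sym e) tt)
    go (leaf j) e = no-members x (λ r → subst Rootᵗ e r) (λ i q → case trans (sym e) q of λ ())
    go (centre j) e = root-star x (subst Rootᵗ (sym e) tt)
    go other e = root-star x (subst Rootᵗ (sym e) tt)

-- The two embeddings of H

module OrderedEmbedding {n k : ℕ} (T : Tournament n) (H : Tournament k) where
  open Smoothness T
  open Embedding T H

  Fore : ℕ → (Fin k → List (Fin n)) → Fin k → Fin k → Set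
  Fore ℓ F h h' = Smooth ℓ (F h) (F h') × adj H h h' ≡ true

  embed-ordered : (F : Fin k → List (Fin n)) (comp : Fin k → Fin k) (ℓ : ℕ) → NonZero ℓ → 2 * (k * k) ≤ ℓ →
    (∀ {h h'} → comp h ≢ comp h' → Fore ℓ F h h' ⊎ Fore ℓ F h' h) →
    (∀ c F' → (∀ h → F' h ⊆ F h) → (∀ {h} → comp h ≡ c → length (F h) ≤ 2 * length (F' h)) →
              Σ (Fin k → Fin n) (Realises (λ h → comp h ≡ c) F')) →
    Fin n → Σ (Fin k → Fin n) λ f → ∀ h h' → adj H h h' ≡ adj T (f h) (f h')
  embed-ordered F comp ℓ ℓ≢0 2k²≤ℓ order robust v₀ = embed F comp apart ℓ {{ℓ≢0}} 2k²≤ℓ mostly robust v₀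
    where
    apart : ∀ {h h'} → comp h ≢ comp h' → ∀ {v} → v ∈ F h → v ∈ F h' → ⊥
    apart {h} {h'} ne i j = go (order ne)
      where
      go : Fore ℓ F h h' ⊎ Fore ℓ F h' h → ⊥
      go (inj₁ (S , _)) = dis S i j
      go (inj₂ (S , _)) = dis S j i
    mostly : ∀ {h h'} → comp h ≢ comp h' → ∀ {v} → v ∈ F h → ℓ * # (wrong h h' v) (F h') ≤ length (F h')
    mostly {h} {h'} ne {v} i = go (order ne)
      where
      wrong-true : ∀ x → not (eqᵇ x true) ≡ true → not x ≡ true
      wrong-true false _ = refl
      wrong-false : ∀ x → not (eqᵇ x false) ≡ true → x ≡ true
      wrong-false true _ = refl
      go : Fore ℓ F h h' ⊎ Fore ℓ F h' h → ℓ * # (wrong h h' v) (F h') ≤ length (F h')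
      go (inj₁ (S , e)) = ≤-trans (*-monoʳ-≤ ℓ (#-weaken (wrong h h' v) (λ w → not (adj T v w)) (F h')
        λ {w} _ q → wrong-true (adj T v w) (trans (cong (λ z → not (eqᵇ (adj T v w) z)) (sym e)) q))) (out S i)
      go (inj₂ (S , e)) = ≤-trans (*-monoʳ-≤ ℓ (#-weaken (wrong h h' v) (λ w → not (adj T w v)) (F h')
        λ {w} j q → trans (reverse λ { refl → dis S j i }) (wrong-false (adj T v w) (trans (cong (λ z → not (eqᵇ (adj T v w) z)) (sym e')) q)))) (inn S i)
        where
        e' : adj H h h' ≡ false
        e' = trans (tour H h h' (λ eq → ne (cong comp eq))) (cong not e)

  StarLeaf : (Fin k → Fin k) → Fin k → Fin k → Bool
  StarLeaf comp c l = not ⌊ l ≟F c ⌋ ∧ ⌊ comp l ≟F c ⌋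

  starLeaf-c : ∀ comp c → StarLeaf comp c c ≡ false
  starLeaf-c comp c with c ≟F c
  ... | yes _ = refl
  ... | no ne = ⊥-elim (ne refl)

  starLeaf⇒ : ∀ {comp c l} → StarLeaf comp c l ≡ true → l ≢ c × comp l ≡ c
  starLeaf⇒ {comp} {c} {l} e with l ≟F c | comp l ≟F c
  ... | no ne | yes q = ne , q

  ⇒starLeaf : ∀ {comp c l} → comp l ≡ c → l ≡ c ⊎ StarLeaf comp c l ≡ true
  ⇒starLeaf {comp} {c} {l} e with l ≟F c | comp l ≟F c
  ... | yes q | _ = inj₁ q
  ... | no _ | yes _ = inj₂ refl
  ... | no _ | no ne = ⊥-elim (ne e)

-- Embedding H into a critical set

module Placing {n k : ℕ} (T : Tournament n) (H : Tournament k) (θ : Permutation′ k) (sg : Ordered.SuperGalaxy H θ)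
  (U : List (Fin n)) (uniqueU : Unique U) (q s D κ : ℕ)
  (IH : ∀ A → Unique A → length A < length U → Chains.ChainIn T A λ C → length A ≤ length C ^ q)
  (noChain : ∀ C → (∀ {v} → v ∈ C → v ∈ U) → Chains.Chain T C → s < length C → ⊥)
  (s^q<m : s ^ q < length U) (D≢0 : NonZero D) (gap : 2 * κ * D ^ q ≤ suc D ^ q) (2≤κ : 2 ≤ κ) (κ≤m : κ ≤ length U) where

  open Chains T
  open Smoothness T
  open Critical T U uniqueU q s D κ IH noChain s^q<m D≢0 gap 2≤κ κ≤m
  open Embedding T H
  open OrderedEmbedding T H

  Realisation : Set
  Realisation = Σ (Fin k → Fin n) λ f → ∀ h h' → adj H h h' ≡ adj T (f h) (f h')

  private
    m = length U
    m>0 : 0 < m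
    m>0 = ≤-trans (s≤s z≤n) s^q<m
    v₀ : Fin n
    v₀ = proj₁ (nonempty U m>0)

  Large : ℕ → List (Fin n) → Set
  Large K A = A ⊆ U × m ≤ K * length A

  Large-pos : ∀ {K A} → Large K A → 0 < length A
  Large-pos {K} {A} (_ , le) = n≢0⇒n>0 λ e → <⇒≱ m>0 (≤-trans le (≤-reflexive (trans (cong (K *_) e) (*-zeroʳ K))))

  -- All vertices of `A` that miss `B` are joined to the whole of `B` in one direction. If they made
  -- up more than a `1 / (k + 1)` fraction of `A`, they would be linear and violate
  -- `no-complete-pair` with the chain in `B`.
  few-miss : ∀ c l {A B} K → K * suc k ≤ κ → Large K A → ChainIn B (λ C → s ≤ suc D * length C) → (∀ {v} → v ∈ B → v ∈ U) →
    (∀ {v} → v ∈ A → v ∈ B → ⊥) → suc k * # (not ∘ hits c l B) A ≤ length A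
  few-miss c l {A} {B} K hK (sA , lA) (C , C⊆ , ch , lC) B⊆ d = ≮⇒≥ λ lt →
    no-complete-pair {A₀} {C} (not (adj H c l)) (⊆-trans (filterᵇ-⊆ miss A) sA)
      (≤-trans (≤-chain-* K (suc k) lA (<⇒≤ lt)) (*-monoˡ-≤ (length A₀) hK))
      (λ i → B⊆ (C⊆ i)) ch lC (λ i j → d (∈-⊆ (filterᵇ-⊆ miss A) i) (C⊆ j))
      (λ {x} i j → misses c l B x (not-true (filterᵇ-true miss A i)) (C⊆ j))
    where
    miss : Fin n → Bool
    miss = not ∘ hits c l B
    A₀ = filterᵇ miss A

  module WithoutTriangles (W : ℕ → List (Fin n)) (K ℓ : ℕ) (ℓ≢0 : NonZero ℓ) (2k²≤ℓ : 2 * (k * k) ≤ ℓ) (hK : K * 2 * suc k ≤ κ)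
    (S : SmoothFamily ℓ W) (ix : ℕ → ℕ) (ix-mono : ∀ {p p'} → p < p' → ix p < ix p')
    (large : ∀ {p} → p < k → Large K (W (ix p)))
    (free : ∀ {p p' p''} → p < p' → p' < p'' → p'' < k → TriangleFree (W (ix p)) (W (ix p')) (W (ix p''))) where

    open Components H θ sg

    private
      F : Fin k → List (Fin n)
      F h = W (ix (pos h))

      order : ∀ {h h'} → star-of h ≢ star-of h' → Fore ℓ F h h' ⊎ Fore ℓ F h' h
      order {h} {h'} ne = go (<-cmp (pos h) (pos h'))
        where
        go : Tri (h ≺ h') (pos h ≡ pos h') (h' ≺ h) → Fore ℓ F h h' ⊎ Fore ℓ F h' h
        go (tri< lt _ _) = inj₁ (S (ix-mono lt) , forward lt (differ⇒no-up ne))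
        go (tri≈ _ e _) = ⊥-elim (ne (cong star-of (pos-injective e)))
        go (tri> _ _ gt) = inj₂ (S (ix-mono gt) , forward gt (differ⇒no-up (λ e → ne (sym e))))

      disjoint : ∀ {h h' v} → h ≢ h' → v ∈ F h → v ∈ F h' → ⊥
      disjoint {h} {h'} ne i j = go (<-cmp (pos h) (pos h'))
        where
        go : Tri (h ≺ h') (pos h ≡ pos h') (h' ≺ h) → ⊥
        go (tri< lt _ _) = dis (S (ix-mono lt)) i j
        go (tri≈ _ e _) = ne (pos-injective e)
        go (tri> _ _ gt) = dis (S (ix-mono gt)) j i

      flip-false : ∀ {m} (R : Tournament m) {x y} → x ≢ y → adj R x y ≡ false → adj R y x ≡ true
      flip-false R {x} {y} ne e = trans (tour R y x (λ eq → ne (sym eq))) (cong not e)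

      flip-true : ∀ {m} (R : Tournament m) {x y} → x ≢ y → adj R x y ≡ true → adj R y x ≡ false
      flip-true R {x} {y} ne e = trans (tour R y x (λ eq → ne (sym eq))) (cong not e)

      module Star (c : Fin k) (F' : Fin k → List (Fin n)) (sub : ∀ h → F' h ⊆ F h)
                  (half : ∀ {h} → star-of h ≡ c → length (F h) ≤ 2 * length (F' h)) (top : star-of c ≡ c) where
        isLeaf : Fin k → Bool
        isLeaf = StarLeaf star-of c

        up : ∀ {l} → isLeaf l ≡ true → UpV l c
        up e = let (ne , q) = starLeaf⇒ {star-of} e in leaf-up q ne

        large' : ∀ {h} → star-of h ≡ c → Large (K * 2) (F' h)
        large' {h} e = ⊆-trans (sub h) (proj₁ (large (pos<k h))) , ≤-chain-* K 2 (proj₂ (large (pos<k h))) (half e)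

        leaf≢ : ∀ {l} → isLeaf l ≡ true → l ≢ c
        leaf≢ e = proj₁ (starLeaf⇒ {star-of} e)

        dis' : ∀ {l} → isLeaf l ≡ true → ∀ {v} → v ∈ F' c → v ∈ F' l → ⊥
        dis' {l} e i j = disjoint (leaf≢ e) (∈-⊆ (sub l) j) (∈-⊆ (sub c) i)

        few : ∀ {l} → isLeaf l ≡ true → suc k * # (not ∘ hits c l (F' l)) (F' c) ≤ length (F' c)
        few {l} e = few-miss c l (K * 2) hK (large' top) (chain (long-chain (proj₁ lg) (≤-trans (proj₂ lg) (*-monoˡ-≤ (length (F' l)) (≤-trans (m≤m*n (K * 2) (suc k)) hK)))))
            (∈-⊆ (proj₁ lg)) (dis' e)
          where
          lg = large' (proj₂ (starLeaf⇒ {star-of} e))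
          chain : ChainIn (F' l) (λ C → D * s < suc D * length C) → ChainIn (F' l) (λ C → s ≤ suc D * length C)
          chain (C , C⊆ , ch , lt) = C , C⊆ , ch , ≤-trans s≤Ds (<⇒≤ lt)

        -- Two leaves joined backwards would close a backward triangle with the centre.
        coherent-< : ∀ {l l' a b b'} → isLeaf l ≡ true → isLeaf l' ≡ true → l ≺ l' → a ∈ F' c → b ∈ F' l → b' ∈ F' l' →
          adj T a b ≡ adj H c l → adj T a b' ≡ adj H c l' → adj T b b' ≡ true
        coherent-< {l} {l'} {a} {b} {b'} e e' lt ia ib ib' ab ab' = go (adj T b b') refl
          where
          left : ∀ {x y} → isLeaf x ≡ true → x ≺ c → y ∈ F' x → adj T a y ≡ adj H c x → adj T a y ≡ true
          left ex lx iy q = trans q (backward lx (inj₁ (up ex)))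
          right : ∀ {x y} → isLeaf x ≡ true → c ≺ x → y ∈ F' x → adj T a y ≡ adj H c x → adj T y a ≡ true
          right {x} {y} ex lx iy q = flip-false T (λ { refl → dis' ex ia iy }) (trans q (flip-true H (leaf≢ ex) (backward lx (inj₂ (up ex)))))
          b≢b' : b ≢ b'
          b≢b' refl = disjoint {l} {l'} (λ { refl → n≮n _ lt }) (∈-⊆ (sub l) ib) (∈-⊆ (sub l') ib')
          FA = ∈-⊆ (sub c) ia
          FB = ∈-⊆ (sub l) ib
          FB' = ∈-⊆ (sub l') ib'
          closes : adj T b' b ≡ true → Tri (c ≺ l) (pos c ≡ pos l) (l ≺ c) → Tri (c ≺ l') (pos c ≡ pos l') (l' ≺ c) → ⊥
          closes bb (tri≈ _ eq _) _ = leaf≢ e (sym (pos-injective eq))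
          closes bb _ (tri≈ _ eq _) = leaf≢ e' (sym (pos-injective eq))
          closes bb (tri< x _ _) (tri< y _ _) = free x lt (pos<k l') FA FB FB' (right e x ib ab) (right e' y ib' ab') bb
          closes bb (tri< x _ _) (tri> _ _ y) = <-asym lt (<-trans y x)
          closes bb (tri> _ _ x) (tri< y _ _) = free x y (pos<k l') FB FA FB' (left e x ib ab) bb (right e' y ib' ab')
          closes bb (tri> _ _ x) (tri> _ _ y) = free lt y (pos<k c) FB FB' FA bb (left e x ib ab) (left e' y ib' ab')
          go : ∀ x → adj T b b' ≡ x → x ≡ true
          go true _ = refl
          go false q = ⊥-elim (closes (flip-false T b≢b' q) (<-cmp (pos c) (pos l)) (<-cmp (pos c) (pos l')))

        no-up : ∀ {l l'} → isLeaf l ≡ true → isLeaf l' ≡ true → ¬ (UpV l l' ⊎ UpV l' l)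
        no-up e e' = let (ne , q) = starLeaf⇒ {star-of} e ; (ne' , q') = starLeaf⇒ {star-of} e' in leaves-no-up q q' ne ne'

        coherent : ∀ {l l' a b b'} → isLeaf l ≡ true → isLeaf l' ≡ true → l ≢ l' → a ∈ F' c → b ∈ F' l → b' ∈ F' l' →
          adj T a b ≡ adj H c l → adj T a b' ≡ adj H c l' → adj H l l' ≡ adj T b b'
        coherent {l} {l'} {a} {b} {b'} e e' ne ia ib ib' ab ab' = go (<-cmp (pos l) (pos l'))
          where
          b≢b' : b' ≢ b
          b≢b' refl = disjoint ne (∈-⊆ (sub l) ib) (∈-⊆ (sub l') ib')
          go : Tri (l ≺ l') (pos l ≡ pos l') (l' ≺ l) → adj H l l' ≡ adj T b b'
          go (tri< lt _ _) = trans (forward lt (no-up e e')) (sym (coherent-< e e' lt ia ib ib' ab ab'))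
          go (tri≈ _ eq _) = ⊥-elim (ne (pos-injective eq))
          go (tri> _ _ gt) = trans (flip-true H (λ eq → ne (sym eq)) (forward gt (no-up e' e)))
            (sym (flip-true T b≢b' (coherent-< e' e gt ia ib' ib ab' ab)))

        robust-star : Σ (Fin k → Fin n) (Realises (λ h → star-of h ≡ c) F')
        robust-star = let (f , f∈ , f-adj) = star-robust F' c isLeaf (starLeaf-c star-of c) (Large-pos {K * 2} (large' top)) dis' few coherent
                 in f , (λ e → f∈ (⇒starLeaf {star-of} e)) , λ e e' → f-adj (⇒starLeaf {star-of} e) (⇒starLeaf {star-of} e')

      robust : ∀ c F' → (∀ h → F' h ⊆ F h) → (∀ {h} → star-of h ≡ c → length (F h) ≤ 2 * length (F' h)) →
              Σ (Fin k → Fin n) (Realises (λ h → star-of h ≡ c) F')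
      robust c F' sub half = go (star-of c ≟F c)
        where
        go : Dec (star-of c ≡ c) → Σ (Fin k → Fin n) (Realises (λ h → star-of h ≡ c) F')
        go (yes top) = Star.robust-star c F' sub half top
        go (no ne) = (λ _ → v₀) , (λ {h} e → ⊥-elim (none e)) , λ {h} e _ → ⊥-elim (none e)
          where
          none : ∀ {h} → star-of h ≡ c → ⊥
          none {h} e = ne (trans (cong star-of (sym e)) (trans (star-of-idem h) e))

    realisation : Realisation
    realisation = embed-ordered F star-of ℓ ℓ≢0 2k²≤ℓ order robust v₀

  module WithTriangles (W : ℕ → List (Fin n)) (K P ℓ : ℕ) (k≢0 : NonZero k) (ℓ≢0 : NonZero ℓ) (2k²≤ℓ : 2 * (k * k) ≤ ℓ)
    (hK : K * 2 * suc k ≤ κ) (hD : 8 * k * P ≤ D) (S : SmoothFamily (2 * k * ℓ) W)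
    (M : ℕ) (a b c : ℕ → ℕ) (a<b : ∀ z → a z < b z) (b<c : ∀ z → b z < c z) (c<M : ∀ z → 2 * c z < M) where

    open Reordering H θ sg M a b c a<b b<c c<M

    private
      instance
        k≢0' : NonZero k
        k≢0' = k≢0
        2k≢0 : NonZero (2 * k)
        2k≢0 = m*n≢0 2 k

      -- Leafy vertices of one run share a chain and take different blocks of it, numbered by their
      -- positions in θ; `k` blocks suffice since positions are below `k`.
      cut : Bool → Fin k → List (Fin n)
      cut true h = piece (length (W (spot h)) / k) (pos h) (W (spot h))
      cut false h = W (spot h)

      F : Fin k → List (Fin n)
      F h = cut (leafy h) h

      cut-⊆ : ∀ x h → cut x h ⊆ W (spot h)
      cut-⊆ true h = piece-⊆ (length (W (spot h)) / k) (pos h) (W (spot h))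
      cut-⊆ false h = ⊆-refl

      F-⊆ : ∀ h → F h ⊆ W (spot h)
      F-⊆ h = cut-⊆ (leafy h) h

      F-interior : ∀ {h} → leafy h ≡ false → F h ≡ W (spot h)
      F-interior {h} e = cong (λ x → cut x h) e

    module _ (linear : ∀ h → leafy h ≡ false → Large K (W (spot h)))
      (runs : ∀ h → leafy h ≡ true → Chained P W (spot h) × k ≤ length (W (spot h)))
      (triangles : ∀ i → Robust 2 (W (spot (int i 3F))) (W (spot (int i 2F))) (W (spot (int i 1F)))) where

      private
        F-large : ∀ h → length (W (spot h)) ≤ 2 * k * length (F h)
        F-large h = go (leafy h) refl
          where
          go : ∀ x → leafy h ≡ x → length (W (spot h)) ≤ 2 * k * length (cut x h)
          go true e = subst (λ z → length (W (spot h)) ≤ 2 * k * z) (sym (length-piece (length (W (spot h)) / k) (pos h) (W (spot h))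
              (≤-trans (*-monoˡ-≤ _ (pos<k h)) (≤-trans (≤-reflexive (*-comm k _)) (m/n*n≤m _ k)))))
            (m≤2d[m/d] _ k (proj₂ (runs h e)))
          go false e = m≤n*m _ (2 * k)

        F-pos : ∀ h → 0 < length (F h)
        F-pos h = n≢0⇒n>0 λ e → <⇒≱ (W-pos (leafy h) refl) (≤-trans (F-large h) (≤-reflexive (trans (cong (2 * k *_) e) (*-zeroʳ (2 * k)))))
          where
          W-pos : ∀ x → leafy h ≡ x → 0 < length (W (spot h))
          W-pos true e = ≤-trans (>-nonZero⁻¹ k) (proj₂ (runs h e))
          W-pos false e = Large-pos {K} (linear h e)

        run-forward : ∀ {u v} → leafy u ≡ true → leafy v ≡ true → spot u ≡ spot v → u ≺ v →
          ∀ {x y} → x ∈ F u → y ∈ F v → adj T x y ≡ true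
        run-forward {u} {v} lu lv e lt {x} {y} i j = piece-AllPairs (length (W (spot u)) / k) (W (spot u)) (proj₁ (proj₂ (proj₁ (runs u lu)))) lt
          (subst (λ z → x ∈ cut z u) lu i)
          (subst (λ z → y ∈ piece (length (W z) / k) (pos v) (W z)) (sym e) (subst (λ z → y ∈ cut z v) lv j))

        fore : ∀ {u v} → Forward u v → Fore ℓ F u v
        fore {u} {v} (e , inj₁ lt) = Smooth-⊆ (2 * k) ℓ (S lt) (F-⊆ u) (F-⊆ v) (F-large u) (F-large v) , e
        -- Between blocks of one chain no arc is wrong, so smoothness holds for every `ℓ`; a common
        -- vertex would have an arc to itself.
        fore {u} {v} (e , inj₂ (q , lu , lv , lt)) = smooth
            (λ {x} i → ≤-trans (≤-reflexive (trans (cong (ℓ *_) (#-none _ (F v) λ {y} j → cong not (fw i j))) (*-zeroʳ ℓ))) z≤n)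
            (λ {y} j → ≤-trans (≤-reflexive (trans (cong (ℓ *_) (#-none _ (F u) λ {x} i → cong not (fw i j))) (*-zeroʳ ℓ))) z≤n)
            (λ {x} i j → true≢false (trans (sym (fw i j)) (irrefl T x))) , e
          where
          fw : ∀ {x y} → x ∈ F u → y ∈ F v → adj T x y ≡ true
          fw = run-forward lu lv q lt

        order : ∀ {h h'} → comp h ≢ comp h' → Fore ℓ F h h' ⊎ Fore ℓ F h' h
        order {h} {h'} ne = go (forward-order ne)
          where
          go : Forward h h' ⊎ Forward h' h → Fore ℓ F h h' ⊎ Fore ℓ F h' h
          go (inj₁ x) = inj₁ (fore x)
          go (inj₂ x) = inj₂ (fore x)

        -- Needed inside a star, about which `order` says nothing; `slot-order` puts a leafy and a
        -- non-leafy vertex into different slots.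
        leafy-centre-apart : ∀ {l x} → leafy l ≡ true → leafy x ≡ false → ∀ {v} → v ∈ F x → v ∈ F l → ⊥
        leafy-centre-apart {l} {x} ll lx {v} i j = go (<-cmp (pos l) (pos x))
          where
          v∈x : v ∈ W (spot x)
          v∈x = ∈-⊆ (F-⊆ x) i
          v∈l : v ∈ W (spot l)
          v∈l = ∈-⊆ (F-⊆ l) j
          not-role : ∀ {i r} → tag l ≢ role i r
          not-role e = true≢false (trans (sym ll) (cong leafyᵗ e))
          left : slot l < slot x ⊎ (slot l ≡ slot x × leafy l ≡ true × leafy x ≡ true) → ⊥
          left (inj₁ lt) = dis (S (spot-< lt)) v∈l v∈x
          left (inj₂ (_ , _ , q)) = true≢false (trans (sym q) lx)
          right : slot x < slot l ⊎ (slot x ≡ slot l × leafy x ≡ true × leafy l ≡ true) → ⊥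
          right (inj₁ lt) = dis (S (spot-< lt)) v∈x v∈l
          right (inj₂ (_ , q , _)) = true≢false (trans (sym q) lx)
          go : Tri (l ≺ x) (pos l ≡ pos x) (x ≺ l) → ⊥
          go (tri< lt _ _) = left (slot-order lt λ { (_ , _ , _ , e , _) → not-role e })
          go (tri≈ _ e _) = true≢false (trans (sym ll) (trans (cong leafy (pos-injective e)) lx))
          go (tri> _ _ gt) = right (slot-order gt λ { (_ , _ , _ , _ , e) → not-role e })

        module Star (x : Fin k) (F' : Fin k → List (Fin n)) (sub : ∀ h → F' h ⊆ F h)
                    (half : ∀ {h} → comp h ≡ x → length (F h) ≤ 2 * length (F' h)) (top : comp x ≡ x)
                    (kinds : ∀ {l} → comp l ≡ x → l ≢ x → leafy l ≡ true × leafy x ≡ false)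
                    (ups : ∀ {l} → comp l ≡ x → l ≢ x → UpV l x) where
          isLeaf : Fin k → Bool
          isLeaf = StarLeaf comp x

          member : ∀ {l} → isLeaf l ≡ true → l ≢ x × comp l ≡ x
          member = starLeaf⇒ {comp}

          kind : ∀ {l} → isLeaf l ≡ true → leafy l ≡ true × leafy x ≡ false
          kind e = kinds (proj₂ (member e)) (proj₁ (member e))

          up : ∀ {l} → isLeaf l ≡ true → UpV l x
          up e = ups (proj₂ (member e)) (proj₁ (member e))

          x-pos : 0 < length (F' x)
          x-pos = n≢0⇒n>0 λ e → <⇒≱ (F-pos x) (≤-trans (half top) (≤-reflexive (cong (2 *_) e)))

          dis' : ∀ {l} → isLeaf l ≡ true → ∀ {v} → v ∈ F' x → v ∈ F' l → ⊥
          dis' {l} e i j = leafy-centre-apart (proj₁ (kind e)) (proj₂ (kind e)) (∈-⊆ (sub x) i) (∈-⊆ (sub l) j)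

          few : ∀ {l} → isLeaf l ≡ true → suc k * # (not ∘ hits x l (F' l)) (F' x) ≤ length (F' x)
          few {l} e = few-miss x l (K * 2) hK large (F' l , (λ i → i) , chain , long) (λ i → proj₁ run (∈-⊆ F'⊆W i)) (dis' e)
            where
            run = proj₁ (runs l (proj₁ (kind e)))
            F'⊆W : F' l ⊆ W (spot l)
            F'⊆W = ⊆-trans (sub l) (F-⊆ l)
            chain : Chain (F' l)
            chain = AllPairs-⊆ F'⊆W (proj₁ (proj₂ run))
            large : Large (K * 2) (F' x)
            large = let (sx , lx) = linear x (proj₂ (kind e)) in ⊆-trans (sub x) (⊆-trans (F-⊆ x) sx) ,
              ≤-chain-* K 2 (subst (λ z → m ≤ K * length z) (sym (F-interior (proj₂ (kind e)))) lx) (half top)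
            y = length (F' l)
            -- The origin of `D`: a factor `P` from the replacements, `2 * k` from cutting the chain
            -- into blocks, 2 from the halving in the embedding, and 2 from `suc D ≤ 2 * D` give
            -- `8 * k * P`.
            long : s ≤ suc D * y
            long = ≤-trans (*-cancelˡ-≤ D {{D≢0}} (begin
              D * s ≤⟨ <⇒≤ (proj₂ (proj₂ run)) ⟩
              suc D * (P * length (W (spot l))) ≤⟨ *-mono-≤ sucD≤ (*-monoʳ-≤ P (≤-chain-* (2 * k) 2 (F-large l) (half (proj₂ (member e))))) ⟩
              2 * D * (P * (2 * k * 2 * y)) ≡⟨ regroup D P k y ⟩
              D * (8 * k * P * y) ∎)) (≤-trans (*-monoˡ-≤ y hD) (*-monoˡ-≤ y (n≤1+n D)))
              where
              open ≤-Reasoning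
              sucD≤ : suc D ≤ 2 * D
              sucD≤ = ≤-trans (+-monoˡ-≤ D (>-nonZero⁻¹ D {{D≢0}})) (≤-reflexive (cong (D +_) (sym (+-identityʳ D))))
              regroup : ∀ d p j z → 2 * d * (p * (2 * j * 2 * z)) ≡ d * (8 * j * p * z)
              regroup = solve-∀

          coherent : ∀ {l l' v w w'} → isLeaf l ≡ true → isLeaf l' ≡ true → l ≢ l' → v ∈ F' x → w ∈ F' l → w' ∈ F' l' →
            adj T v w ≡ adj H x l → adj T v w' ≡ adj H x l' → adj H l l' ≡ adj T w w'
          coherent {l} {l'} {v} {w} {w'} e e' ne iv iw iw' _ _ = go (<-cmp (pos l) (pos l'))
            where
            ll = proj₁ (kind e)
            ll' = proj₁ (kind e')
            spots : spot l ≡ spot l'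
            spots = trans (spot-leafy ll) (trans (cong (_* M) (up⇒slot-same (up e) (up e') ll ll')) (sym (spot-leafy ll')))
            jw = ∈-⊆ (sub l) iw
            jw' = ∈-⊆ (sub l') iw'
            no-up : ∀ {l l'} → isLeaf l ≡ true → isLeaf l' ≡ true → ¬ (UpV l l' ⊎ UpV l' l)
            no-up e e' = leaves-no-up (star-of-up (up e)) (star-of-up (up e')) (proj₁ (member e)) (proj₁ (member e'))
            go : Tri (l ≺ l') (pos l ≡ pos l') (l' ≺ l) → adj H l l' ≡ adj T w w'
            go (tri< lt _ _) = trans (forward lt (no-up e e')) (sym (run-forward ll ll' spots lt jw jw'))
            go (tri≈ _ eq _) = ⊥-elim (ne (pos-injective eq))
            go (tri> _ _ gt) = trans (tour H l l' ne) (trans (cong not (trans (forward gt (no-up e' e)) (sym back)))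
              (sym (tour T w w' λ { refl → true≢false (trans (sym back) (irrefl T w)) })))
              where
              back : adj T w' w ≡ true
              back = run-forward ll' ll (sym spots) gt jw' jw

          robust-star : Σ (Fin k → Fin n) (Realises (λ h → comp h ≡ x) F')
          robust-star = let (f , f∈ , f-adj) = star-robust F' x isLeaf (starLeaf-c comp x) x-pos dis' few coherent
                   in f , (λ e → f∈ (⇒starLeaf {comp} e)) , λ e e' → f-adj (⇒starLeaf {comp} e) (⇒starLeaf {comp} e')

        -- Interior vertices are not cut, so half of their sets is still enough for `triangles`.
        -- Vertices 4, 3, 2 of the spider take the points of the backward triangle in this order.
        robust-triangle : ∀ x i → (∀ {h} → comp h ≡ x → h ≡ int i 3F ⊎ h ≡ int i 2F ⊎ h ≡ int i 1F) →
          (F' : Fin k → List (Fin n)) → (∀ h → F' h ⊆ F h) → (∀ {h} → comp h ≡ x → length (F h) ≤ 2 * length (F' h)) →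
          (∀ h → h ≡ int i 3F ⊎ h ≡ int i 2F ⊎ h ≡ int i 1F → comp h ≡ x) →
          Σ (Fin k → Fin n) (Realises (λ h → comp h ≡ x) F')
        robust-triangle x i petals F' sub half conv = build (triangle-in (triangles i (F' A) (F' B) (F' C) (subW A 3F refl) (subW B 2F refl) (subW C 1F refl)
            (halfW A 3F refl (inj₁ refl)) (halfW B 2F refl (inj₂ (inj₁ refl))) (halfW C 1F refl (inj₂ (inj₂ refl)))))
          where
          A = int i 3F
          B = int i 2F
          C = int i 1F
          triangle-in : ¬ TriangleFree (F' A) (F' B) (F' C) → Triangle (F' A) (F' B) (F' C)
          triangle-in = Chains.triangle T {F' A} {F' B} {F' C}
          subW : ∀ h r → h ≡ int i r → F' h ⊆ W (spot h)
          subW h r e = ⊆-trans (sub h) (F-⊆ h)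
          halfW : ∀ h r → h ≡ int i r → (h ≡ int i 3F ⊎ h ≡ int i 2F ⊎ h ≡ int i 1F) → length (W (spot h)) ≤ 2 * length (F' h)
          halfW h r e p = subst (λ z → length z ≤ 2 * length (F' h)) (F-interior (trans (cong leafy e) (leafy-int i r))) (half (conv h p))
          build : Triangle (F' A) (F' B) (F' C) → Σ (Fin k → Fin n) (Realises (λ h → comp h ≡ x) F')
          build (p , q , r , p∈ , q∈ , r∈ , qp , rp , rq) = f , (λ e → f∈ (petals e)) , λ e e' → f-adj (petals e) (petals e')
            where
            f : Fin k → Fin n
            f = update (update (λ _ → p) B q) C r
            B≢C : B ≢ C
            B≢C e = case int-injective i {2F} {1F} e of λ ()
            A≢C : A ≢ C
            A≢C e = case int-injective i {3F} {1F} e of λ ()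
            A≢B : A ≢ B
            A≢B e = case int-injective i {3F} {2F} e of λ ()
            fA : f A ≡ p
            fA = trans (update-other (update (λ _ → p) B q) C r A≢C) (update-other (λ _ → p) B q A≢B)
            fB : f B ≡ q
            fB = trans (update-other (update (λ _ → p) B q) C r B≢C) (update-same (λ _ → p) B q)
            fC : f C ≡ r
            fC = update-same (update (λ _ → p) B q) C r
            f∈ : ∀ {h} → h ≡ A ⊎ h ≡ B ⊎ h ≡ C → f h ∈ F' h
            f∈ (inj₁ refl) = subst (_∈ F' A) (sym fA) p∈
            f∈ (inj₂ (inj₁ refl)) = subst (_∈ F' B) (sym fB) q∈
            f∈ (inj₂ (inj₂ refl)) = subst (_∈ F' C) (sym fC) r∈
            down : ∀ {h h' v v'} → h ≢ h' → f h ≡ v → f h' ≡ v' → adj H h h' ≡ true → adj T v v' ≡ true →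
              adj H h h' ≡ adj T (f h) (f h') × adj H h' h ≡ adj T (f h') (f h)
            down {h} {h'} {v} {v'} ne e e' a a' = trans a (sym ft) ,
              trans (tour H h' h (λ q → ne (sym q))) (trans (cong not (trans a (sym ft)))
                (sym (tour T (f h') (f h) λ q → true≢false (trans (sym ft) (trans (cong (adj T (f h)) q) (irrefl T (f h)))))))
              where
              ft : adj T (f h) (f h') ≡ true
              ft = trans (cong₂ (adj T) e e') a'
            BA = down (λ q → A≢B (sym q)) fB fA (proj₁ (triangle-arcs i)) qp
            CA = down (λ q → A≢C (sym q)) fC fA (proj₁ (proj₂ (triangle-arcs i))) rp
            CB = down (λ q → B≢C (sym q)) fC fB (proj₂ (proj₂ (triangle-arcs i))) rq
            f-adj : ∀ {h h'} → h ≡ A ⊎ h ≡ B ⊎ h ≡ C → h' ≡ A ⊎ h' ≡ B ⊎ h' ≡ C → adj H h h' ≡ adj T (f h) (f h')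
            f-adj (inj₁ refl) (inj₁ refl) = trans (irrefl H A) (sym (irrefl T (f A)))
            f-adj (inj₁ refl) (inj₂ (inj₁ refl)) = proj₂ BA
            f-adj (inj₁ refl) (inj₂ (inj₂ refl)) = proj₂ CA
            f-adj (inj₂ (inj₁ refl)) (inj₁ refl) = proj₁ BA
            f-adj (inj₂ (inj₁ refl)) (inj₂ (inj₁ refl)) = trans (irrefl H B) (sym (irrefl T (f B)))
            f-adj (inj₂ (inj₁ refl)) (inj₂ (inj₂ refl)) = proj₂ CB
            f-adj (inj₂ (inj₂ refl)) (inj₁ refl) = proj₁ CA
            f-adj (inj₂ (inj₂ refl)) (inj₂ (inj₁ refl)) = proj₁ CB
            f-adj (inj₂ (inj₂ refl)) (inj₂ (inj₂ refl)) = trans (irrefl H C) (sym (irrefl T (f C)))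

        robust : ∀ x F' → (∀ h → F' h ⊆ F h) → (∀ {h} → comp h ≡ x → length (F h) ≤ 2 * length (F' h)) →
              Σ (Fin k → Fin n) (Realises (λ h → comp h ≡ x) F')
        robust x F' sub half = go (shape x)
          where
          go : Shape x → Σ (Fin k → Fin n) (Realises (λ h → comp h ≡ x) F')
          go (empty none) = (λ _ → v₀) , (λ {h} e → ⊥-elim (none h e)) , λ {h} e _ → ⊥-elim (none h e)
          go (star top kinds ups) = Star.robust-star x F' sub half top kinds ups
          go (triangle i petals conv) = robust-triangle x i petals F' sub half conv

      realisation : Realisation
      realisation = embed-ordered F comp ℓ ℓ≢0 2k²≤ℓ order robust v₀

-- The induction

n<2^n : ∀ n → n < 2 ^ n
n<2^n zero = s≤s z≤n
n<2^n (suc n) = ≤-trans (+-mono-≤ (m^n>0 2 n) (n<2^n n)) (+-monoʳ-≤ (2 ^ n) (m≤m+n (2 ^ n) 0))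

[zM+x]/M : ∀ z M x .{{_ : NonZero M}} → x < M → (z * M + x) / M ≡ z
[zM+x]/M z M x lt = trans (+-distrib-/-∣ˡ x (divides z refl)) (trans (cong₂ _+_ (m*n/n≡m z M) (m<n⇒m/n≡0 lt)) (+-identityʳ z))

-- Every zone is handled under double negation. Because there are finitely many, the results for all
-- zones may be assumed simultaneously.
finite-choice : ∀ (P : ℕ → Set) Z → (∀ z → z < Z → ¬ ¬ P z) → ¬ ¬ (∀ z → z < Z → P z)
finite-choice P zero f k = k (λ z ())
finite-choice P (suc Z) f k = f Z ≤-refl λ p → finite-choice P Z (λ z lt → f z (m<n⇒m<1+n lt)) λ g →
  k λ z lt → case m≤n⇒m<n∨m≡n (≤-pred lt) of λ { (inj₁ l) → g z l ; (inj₂ refl) → p }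

triples : ℕ → List (ℕ × ℕ × ℕ)
triples k = filter (λ t → (proj₁ t <? proj₁ (proj₂ t)) ×-dec (proj₁ (proj₂ t) <? proj₂ (proj₂ t)))
  (cartesianProduct (upTo k) (cartesianProduct (upTo k) (upTo k)))

∈-triples⁺ : ∀ {k u v w} → u < v → v < w → w < k → (u , v , w) ∈ triples k
∈-triples⁺ {k} {u} {v} {w} p q r = ∈-filter⁺ _ (∈-cartesianProduct⁺ (∈-upTo⁺ (<-trans p (<-trans q r)))
  (∈-cartesianProduct⁺ (∈-upTo⁺ (<-trans q r)) (∈-upTo⁺ r))) (p , q)

∈-triples⁻ : ∀ {k u v w} → (u , v , w) ∈ triples k → u < v × v < w × w < k
∈-triples⁻ {k} {u} {v} {w} i =
  let (j , p , q) = ∈-filter⁻ (λ t → (proj₁ t <? proj₁ (proj₂ t)) ×-dec (proj₁ (proj₂ t) <? proj₂ (proj₂ t)))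
                      {xs = cartesianProduct (upTo k) (cartesianProduct (upTo k) (upTo k))} i
      (_ , j') = ∈-cartesianProduct⁻ (upTo k) (cartesianProduct (upTo k) (upTo k)) j
      (_ , j'') = ∈-cartesianProduct⁻ (upTo k) (upTo k) j'
  in p , q , ∈-upTo⁻ j''

nth : ∀ {A : Set} → List (List A) → ℕ → List A
nth [] i = []
nth (E ∷ Es) zero = E
nth (E ∷ Es) (suc i) = nth Es i

nth-All : ∀ {A : Set} {Q : List A → Set} {Es} → All Q Es → ∀ {i} → i < length Es → Q (nth Es i)
nth-All (q ∷ qs) {zero} lt = q
nth-All (q ∷ qs) {suc i} (s≤s lt) = nth-All qs lt

-- Indices out of range give `[]`, which the first two hypotheses relate to every list; so a finite
-- structure becomes a family on all of ℕ.
nth-AllPairs : ∀ {A : Set} {R : List A → List A → Set} {Es} → (∀ X → R X []) → (∀ X → R [] X) → AllPairs R Es → ∀ {i j} → i < j → R (nth Es i) (nth Es j)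
nth-AllPairs e e' [] lt = e []
nth-AllPairs {R = R} e e' (_∷_ {E} {Es} h hs) {zero} {suc j} lt = go (j <? length Es)
  where
  out-of-range : ∀ {A : Set} (Es : List (List A)) j → ¬ (j < length Es) → nth Es j ≡ []
  out-of-range [] j n = refl
  out-of-range (E ∷ Es) zero n = ⊥-elim (n (s≤s z≤n))
  out-of-range (E ∷ Es) (suc j) n = out-of-range Es j (λ l → n (s≤s l))
  go : Dec (j < length Es) → R E (nth Es j)
  go (yes l) = nth-All h l
  go (no n) = subst (R E) (sym (out-of-range Es j n)) (e E)
nth-AllPairs e e' (h ∷ hs) {suc i} {suc j} (s≤s lt) = nth-AllPairs e e' hs lt

-- There are Z slots of M sets each. The chains cost every set a factor P and the embedding a further factor 2, so
-- triples of sets must be robust with constant δ = 2P; making them so costs a factor Δ.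
module Constants (k : ℕ) where
  M Z N P δ Δ ℓ ℓ₁ ℓ₀ κₛ K κ D m₀ q : ℕ
  M = 2 * k
  Z = 2 * k + 2
  N = Z * M
  P = 2 ^ suc k
  δ = P * 2
  Δ = δ ^ length (triples k)
  ℓ = 2 * (k * k)
  -- `P` pays for replacing `k + 1` sets by chains, and `2 * k` for cutting chains into blocks.
  ℓ₁ = P * (2 * k * ℓ)
  ℓ₀ = Δ * ℓ₁
  κₛ = structureConst k N ℓ₀
  K = κₛ * Δ
  -- A linear set loses at most `K * P` before the embedding and a factor 2 in it; `suc k` is the
  -- pigeonhole in `few-miss`.
  κ = K * P * 2 * suc k
  D = 8 * k * P
  -- The last summand gives `U` a chain of length `2 * P * k`. Hence `s` is at least that, and even
  -- the trimmed chains have `k` vertices to be cut into blocks.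
  m₀ = κₛ + κ + 2 ^ (2 * P * k)
  -- Chosen for `growth` with `j = 2 * κ + m₀`, whose `2 ^ j` exceeds `2 * κ`. The summand `m₀`
  -- makes `q ≥ m₀`, so sets of at most `m₀` vertices have fewer than `2 ^ q`.
  q = D * (2 * κ + m₀)

module Step {n k : ℕ} (T : Tournament n) (H : Tournament k) (θ : Permutation′ k) (sg : Ordered.SuperGalaxy H θ)
  (free : ¬ ContainsInduced T H) (U : List (Fin n)) (uniqueU : Unique U) (s : ℕ) (k≢0 : NonZero k) where

  open Constants k
  open Chains T
  open Smoothness T
  open SmoothPairs T H free

  module _ (IH : ∀ A → Unique A → length A < length U → ChainIn A λ C → length A ≤ length C ^ q)
    (noChain : ∀ C → (∀ {v} → v ∈ C → v ∈ U) → Chain C → s < length C → ⊥)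
    (s^q<m : s ^ q < length U) (m₀≤m : m₀ ≤ length U) where

    private
      instance
        k≢0' : NonZero k
        k≢0' = k≢0
        M≢0 : NonZero M
        M≢0 = m*n≢0 2 k
        P≢0 : NonZero P
        P≢0 = m^n≢0 2 (suc k)
        δ≢0 : NonZero δ
        δ≢0 = m*n≢0 P 2
        Δ≢0 : NonZero Δ
        Δ≢0 = m^n≢0 δ (length (triples k))
        ℓ≢0 : NonZero ℓ
        ℓ≢0 = m*n≢0 2 (k * k) {{_}} {{m*n≢0 k k}}
        2kℓ≢0 : NonZero (2 * k * ℓ)
        2kℓ≢0 = m*n≢0 (2 * k) ℓ
        ℓ₁≢0 : NonZero ℓ₁
        ℓ₁≢0 = m*n≢0 P (2 * k * ℓ)
        ℓ₀≢0 : NonZero ℓ₀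
        ℓ₀≢0 = m*n≢0 Δ ℓ₁
        κₛ≢0 : NonZero κₛ
        κₛ≢0 = structureConst≢0 N ℓ₀
        K≢0 : NonZero K
        K≢0 = m*n≢0 κₛ Δ
        KP≢0 : NonZero (K * P)
        KP≢0 = m*n≢0 K P
        8k≢0 : NonZero (8 * k)
        8k≢0 = m*n≢0 8 k
        D≢0 : NonZero D
        D≢0 = m*n≢0 (8 * k) P

      m = length U

      κₛ≤m : κₛ ≤ m
      κₛ≤m = ≤-trans (≤-trans (m≤m+n κₛ κ) (m≤m+n _ _)) m₀≤m
      κ≤m : κ ≤ m
      κ≤m = ≤-trans (≤-trans (m≤n+m κ κₛ) (m≤m+n _ _)) m₀≤m
      2≤κ : 2 ≤ κ
      2≤κ = ≤-trans (m≤n*m 2 (K * P)) (m≤m*n _ (suc k))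
      gap : 2 * κ * D ^ q ≤ suc D ^ q
      gap = ≤-trans (*-monoˡ-≤ (D ^ q) (≤-trans (m≤m+n (2 * κ) m₀) (<⇒≤ (n<2^n (2 * κ + m₀))))) (growth D (2 * κ + m₀))

      2Pk≤s : 2 * P * k ≤ s
      2Pk≤s = ≮⇒≥ λ lt → let (C , C⊆ , ch , e) = log-chain (2 * P * k) U uniqueU (≤-trans (m≤n+m _ (κₛ + κ)) m₀≤m)
                         in noChain C C⊆ ch (subst (s <_) (sym e) lt)

    open Critical T U uniqueU q s D κ IH noChain s^q<m D≢0 gap 2≤κ κ≤m
    open Placing T H θ sg U uniqueU q s D κ IH noChain s^q<m D≢0 gap 2≤κ κ≤m

    private
      absurd : Realisation → ⊥
      absurd (f , e) = free (realises⇒contains f e)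

      module _ (E : ℕ → List (Fin n)) (SE : SmoothFamily ℓ₀ E) (largeE : ∀ {i} → i < N → E i ⊆ U × m ≤ κₛ * length (E i)) where

        -- Only even places are tested for triangles. The odd ones stay free for the two centres of
        -- a spider, whichever triple turns out to be robust.
        cell : ℕ → ℕ → ℕ
        cell z x = z * M + 2 * x

        cell-< : ∀ {z x} → z < Z → x < k → cell z x < N
        cell-< {z} {x} lz lx = <-≤-trans (+-monoʳ-< (z * M) (*-monoʳ-< 2 lx)) (≤-trans (≤-reflexive (+-comm (z * M) M)) (*-monoˡ-≤ M lz))

        -- Each zone gets its own shrunken copy of the whole family, of which only the sets inside
        -- the zone are used later. So the losses of different zones do not accumulate.
        RedZone : ℕ → Set
        RedZone z = Σ (ℕ → List (Fin n)) λ W → Shrink Δ E W × Σ ℕ λ u → Σ ℕ λ v → Σ ℕ λ w → u < v × v < w × w < k ×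
          Robust δ (W (cell z u)) (W (cell z v)) (W (cell z w))

        at : ℕ → ℕ × ℕ × ℕ → ℕ × ℕ × ℕ
        at z (u , v , w) = cell z u , cell z v , cell z w

        zone-triples : ℕ → List (ℕ × ℕ × ℕ)
        zone-triples z = map (at z) (triples k)

        large-shrunk : ∀ {W} → Shrink Δ E W → ∀ {i} → i < N → Large K (W i)
        large-shrunk sh {i} lt = let (sU , l) = largeE lt ; (sb , l') = sh i in ⊆-trans sb sU , ≤-chain-* κₛ Δ l l'

        blue-absurd : ∀ z → z < Z → ∀ W → Shrink Δ E W → (∀ {a b c} → (a , b , c) ∈ zone-triples z → TriangleFree (W a) (W b) (W c)) → ⊥
        blue-absurd z lz W sh fr = absurd (WithoutTriangles.realisation W K ℓ₁ ℓ₁≢0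
          (≤-trans (m≤n*m ℓ (2 * k)) (m≤n*m (2 * k * ℓ) P))
          (*-monoˡ-≤ (suc k) (*-monoˡ-≤ 2 (m≤m*n K P)))
          (SmoothFamily-Shrink Δ ℓ₁ {E} {W} sh SE) (cell z) (λ lt → +-monoʳ-< (z * M) (*-monoʳ-< 2 lt))
          (λ lt → large-shrunk {W} sh (cell-< lz lt))
          (λ p q r → fr (∈-map⁺ (at z) (∈-triples⁺ p q r))))

        red-zone : ∀ z → z < Z → ¬ ¬ RedZone z
        red-zone z lz no-red = dichotomy δ (zone-triples z) ordered E λ
          { (inj₁ (W , sh , fr)) → blue-absurd z lz W (subst (λ t → Shrink (δ ^ t) E W) len sh) fr
          ; (inj₂ (W , sh , a , b , c , i , rob)) → locate W (subst (λ t → Shrink (δ ^ t) E W) len sh) (∈-map⁻ (at z) i) rob }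
          where
          len : length (zone-triples z) ≡ length (triples k)
          len = length-map (at z) (triples k)
          ordered : All (λ t → proj₁ t < proj₁ (proj₂ t) × proj₁ (proj₂ t) < proj₂ (proj₂ t)) (zone-triples z)
          ordered = All.tabulate λ i → let ((u , v , w) , j , e) = ∈-map⁻ (at z) i ; (p , q , _) = ∈-triples⁻ {k} j in
            subst (λ t → proj₁ t < proj₁ (proj₂ t) × proj₁ (proj₂ t) < proj₂ (proj₂ t)) (sym e)
              (+-monoʳ-< (z * M) (*-monoʳ-< 2 p) , +-monoʳ-< (z * M) (*-monoʳ-< 2 q))
          locate : ∀ W → Shrink Δ E W → ∀ {a b c} → (Σ _ λ t → t ∈ triples k × (a , b , c) ≡ at z t) → Robust δ (W a) (W b) (W c) → ⊥
          locate W sh ((u , v , w) , j , refl) rob = let (p , q , r) = ∈-triples⁻ {k} j in no-red (W , sh , u , v , w , p , q , r , rob)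

        module _ (red : ∀ z → z < Z → RedZone z) where

          -- Slots z ≥ Z do not occur and are sent to zone 0.
          zone-of : ∀ z → Σ ℕ λ z' → RedZone z' × (z < Z → z' ≡ z)
          zone-of z = go (z <? Z)
            where
            go : Dec (z < Z) → Σ ℕ λ z' → RedZone z' × (z < Z → z' ≡ z)
            go (yes lt) = z , red z lt , λ _ → refl
            go (no n) = 0 , red 0 (≤-trans (s≤s z≤n) (m≤n+m 2 (2 * k))) , λ lt → ⊥-elim (n lt)

          fam : ∀ z → ℕ → List (Fin n)
          fam z = proj₁ (proj₁ (proj₂ (zone-of z)))

          a b c : ℕ → ℕ
          a z = proj₁ (proj₂ (proj₂ (proj₁ (proj₂ (zone-of z)))))
          b z = proj₁ (proj₂ (proj₂ (proj₂ (proj₁ (proj₂ (zone-of z))))))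
          c z = proj₁ (proj₂ (proj₂ (proj₂ (proj₂ (proj₁ (proj₂ (zone-of z)))))))

          facts : ∀ z → a z < b z × b z < c z × c z < k ×
            Robust δ (fam z (cell (proj₁ (zone-of z)) (a z))) (fam z (cell (proj₁ (zone-of z)) (b z))) (fam z (cell (proj₁ (zone-of z)) (c z)))
          facts z = proj₂ (proj₂ (proj₂ (proj₂ (proj₂ (proj₁ (proj₂ (zone-of z)))))))

          W₁ : ℕ → List (Fin n)
          W₁ i = fam (i / M) i

          shrink₁ : Shrink Δ E W₁
          shrink₁ i = proj₁ (proj₂ (proj₁ (proj₂ (zone-of (i / M))))) i

          W₁-cell : ∀ z {x} → x < k → W₁ (cell z x) ≡ fam z (cell z x)
          W₁-cell z {x} lt = cong (λ y → fam y (cell z x)) ([zM+x]/M z M (2 * x) (*-monoʳ-< 2 lt))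

          robust₁ : ∀ z → z < Z → Robust δ (W₁ (cell z (a z))) (W₁ (cell z (b z))) (W₁ (cell z (c z)))
          robust₁ z lt = let (p , q , r , rob) = facts z in
            subst₂ (λ X Y → Robust δ X Y (W₁ (cell z (c z)))) (sym (W₁-cell z (<-trans p (<-trans q r)))) (sym (W₁-cell z (<-trans q r)))
              (subst (λ X → Robust δ (fam z (cell z (a z))) (fam z (cell z (b z))) X) (sym (W₁-cell z r))
                (subst (λ z' → Robust δ (fam z (cell z' (a z))) (fam z (cell z' (b z))) (fam z (cell z' (c z)))) (proj₂ (proj₂ (zone-of z)) lt) rob))

          open Reordering H θ sg M a b c (λ z → proj₁ (facts z)) (λ z → proj₁ (proj₂ (facts z))) (λ z → *-monoʳ-< 2 (proj₁ (proj₂ (proj₂ (facts z)))))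

          -- Runs of leaves have even slots, centres and interiors odd ones.
          runs : List ℕ
          runs = map (λ j → 2 * j * M) (upTo (suc k))

          length-runs : length runs ≡ suc k
          length-runs = trans (length-map _ (upTo (suc k))) (length-upTo (suc k))

          unique-runs : Unique runs
          unique-runs = Unique-map⁺ (λ {x} {y} e → *-cancelˡ-≡ x y 2 (*-cancelʳ-≡ (2 * x) (2 * y) M e)) (upTo⁺ (suc k))

          spot/M : ∀ h → spot h / M ≡ slot h
          spot/M h = [zM+x]/M (slot h) M _ (sub<M (tag h) (slot h))

          centre∉runs : ∀ {h} → leafy h ≡ false → spot h ∉ runs
          centre∉runs {h} e i = let (j , _ , q) = ∈-map⁻ (λ j → 2 * j * M) {xs = upTo (suc k)} i in
            even≢odd j (rank-of (rep h)) (sym (trans (sym slot-odd) (trans (sym (spot/M h)) (trans (cong (_/ M) q) (m*n/n≡m (2 * j) M)))))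
            where
            slot-odd : slot h ≡ suc (2 * rank-of (rep h))
            slot-odd = trans (cong (λ x → 2 * rank-of (rep h) + (if x then 0 else 1)) e) (+-comm _ 1)

          leafy∈runs : ∀ {h} → leafy h ≡ true → spot h ∈ runs
          leafy∈runs {h} e = subst (_∈ runs) (sym (trans (spot-leafy e) (cong (_* M) slot-even))) (∈-map⁺ (λ j → 2 * j * M) (∈-upTo⁺ (s≤s (rank≤k (rep h)))))
            where
            slot-even : slot h ≡ 2 * rank-of (rep h)
            slot-even = trans (cong (λ x → 2 * rank-of (rep h) + (if x then 0 else 1)) e) (+-identityʳ _)

          run<N : ∀ {i} → i ∈ runs → i < N
          run<N {i} i∈ = let (j , j∈ , e) = ∈-map⁻ (λ j → 2 * j * M) {xs = upTo (suc k)} i∈ in subst (_< N) (sym e)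
            (*-monoˡ-< M (≤-<-trans (*-monoʳ-≤ 2 (≤-pred (∈-upTo⁻ j∈))) (m<m+n (2 * k) (s≤s z≤n))))

          chained : Chaining runs (2 * k * ℓ) W₁
          chained = chaining runs K (2 * k * ℓ) W₁ unique-runs
            (subst (λ t → SmoothFamily (2 ^ t * (2 * k * ℓ)) W₁) (sym length-runs) (SmoothFamily-Shrink Δ ℓ₁ {E} {W₁} shrink₁ SE))
            (λ i∈ → large-shrunk {W₁} shrink₁ (run<N i∈))
            (subst (λ t → K * 2 ^ t ≤ κ) (sym length-runs) (≤-trans (m≤m*n (K * P) 2) (m≤m*n (K * P * 2) (suc k))))

          finish : Chaining runs (2 * k * ℓ) W₁ → ⊥
          finish (W , S , rest , chains) = absurd (WithTriangles.realisation W (K * P) P ℓ k≢0 ℓ≢0 ≤-refl ≤-refl ≤-refl S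
              M a b c (λ z → proj₁ (facts z)) (λ z → proj₁ (proj₂ (facts z))) (λ z → *-monoʳ-< 2 (proj₁ (proj₂ (proj₂ (facts z)))))
              linear run robust₂)
            where
            rest' : ∀ {i} → i ∉ runs → W i ⊆ W₁ i × length (W₁ i) ≤ P * length (W i)
            rest' {i} i∉ = subst (λ t → W i ⊆ W₁ i × length (W₁ i) ≤ 2 ^ t * length (W i)) length-runs (rest i∉)
            linear : ∀ h → leafy h ≡ false → Large (K * P) (W (spot h))
            linear h e = let (sb , l) = rest' (centre∉runs e) ; (sU , l') = large-shrunk {W₁} shrink₁ (spot-bound h)
                         in ⊆-trans sb sU , ≤-chain-* K P l' l
            run : ∀ h → leafy h ≡ true → Chained P W (spot h) × k ≤ length (W (spot h))
            run h e = ch , <⇒≤ (*-cancelˡ-< (2 * P) k _ (≤-<-trans 2Pk≤s (*-cancelˡ-< D s _ (<-≤-trans (proj₂ (proj₂ ch)) (begin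
                suc D * (P * x) ≤⟨ *-monoˡ-≤ (P * x) (+-monoˡ-≤ D (>-nonZero⁻¹ D)) ⟩
                (D + D) * (P * x) ≡⟨ regroup D P x ⟩
                D * (2 * P * x) ∎)))))
              where
              open ≤-Reasoning
              x = length (W (spot h))
              ch : Chained P W (spot h)
              ch = subst (λ t → Chained (2 ^ t) W (spot h)) length-runs (chains (leafy∈runs e))
              regroup : ∀ d p x → (d + d) * (p * x) ≡ d * (2 * p * x)
              regroup = solve-∀
            robust₂ : ∀ i → Robust 2 (W (spot (int i 3F))) (W (spot (int i 2F))) (W (spot (int i 1F)))
            robust₂ i A B C sA sB sC lA lB lC = rob A B C (up 3F sA) (up 2F sB) (up 1F sC) (down 3F A lA) (down 2F B lB) (down 1F C lC)
              where
              z = slot (int i 0F)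
              rob : Robust δ (W₁ (spot (int i 3F))) (W₁ (spot (int i 2F))) (W₁ (spot (int i 1F)))
              rob = subst₂ (λ x y → Robust δ (W₁ x) (W₁ y) (W₁ (spot (int i 1F)))) (sym (spot-int i 3F)) (sym (spot-int i 2F))
                (subst (λ y → Robust δ (W₁ (cell z (a z))) (W₁ (cell z (b z))) (W₁ y)) (sym (spot-int i 1F)) (robust₁ z (slot-bound (int i 0F))))
              up : ∀ r {X : List (Fin n)} → X ⊆ W (spot (int i r)) → X ⊆ W₁ (spot (int i r))
              up r s = ⊆-trans s (proj₁ (rest' (centre∉runs (leafy-int i r))))
              down : ∀ r (X : List (Fin n)) → length (W (spot (int i r))) ≤ 2 * length X → length (W₁ (spot (int i r))) ≤ δ * length X
              down r X l = ≤-chain-* P 2 (proj₂ (rest' (centre∉runs (leafy-int i r)))) l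

          red-absurd : ⊥
          red-absurd = finish chained

      structured : Structure (2 ^ N) ℓ₀ κₛ U → ⊥
      structured (Es , len , all , sm) = finite-choice (RedZone E SE largeE) Z (red-zone E SE largeE) (red-absurd E SE largeE)
        where
        E = nth Es
        SE : SmoothFamily ℓ₀ E
        SE = nth-AllPairs {R = Smooth ℓ₀} (λ X → smooth (λ _ → ≤-reflexive (*-zeroʳ ℓ₀)) (λ ()) (λ _ ()))
          (λ X → smooth (λ ()) (λ _ → ≤-reflexive (*-zeroʳ ℓ₀)) (λ ())) sm
        -- Of the `2 ^ N` sets of the structure only the first `N` have to be large.
        largeE : ∀ {i} → i < N → E i ⊆ U × m ≤ κₛ * length (E i)
        largeE lt = nth-All all (subst (_ <_) (sym len) (<-trans lt (n<2^n N)))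

    contradiction : ⊥
    contradiction = smooth-structure N ℓ₀ U uniqueU κₛ≤m structured

-- From chains to transitive subtournaments

AllPairs-lookup : ∀ {A : Set} {R : A → A → Set} {xs} → AllPairs R xs → ∀ i j → toℕ i < toℕ j → R (lookup xs i) (lookup xs j)
AllPairs-lookup (h ∷ hs) fzero (fsuc j) _ = All.lookup h (∈-lookup j)
AllPairs-lookup (h ∷ hs) (fsuc i) (fsuc j) (s≤s lt) = AllPairs-lookup hs i j lt

module _ {n : ℕ} (T : Tournament n) where
  open Chains T

  -- Every arc raises the position in the chain, so a directed walk cannot close up.
  chain⇒transitive : ∀ C → Chain C → HasTransitiveSub T (length C)
  chain⇒transitive C ch = lookup C , inj , acyclic
    where
    increasing : ∀ {i j} → adj T (lookup C i) (lookup C j) ≡ true → toℕ i < toℕ j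
    increasing {i} {j} e = go (<-cmp (toℕ i) (toℕ j))
      where
      go : Tri (toℕ i < toℕ j) (toℕ i ≡ toℕ j) (toℕ j < toℕ i) → toℕ i < toℕ j
      go (tri< lt _ _) = lt
      go (tri≈ _ q _) = ⊥-elim (true≢false (trans (sym (subst (λ z → adj T (lookup C i) (lookup C z) ≡ true) (sym (toℕ-injective q)) e)) (irrefl T _)))
      go (tri> _ ne gt) = ⊥-elim (true≢false (trans (sym e) (trans (tour T _ _ different) (cong not back))))
        where
        back : adj T (lookup C j) (lookup C i) ≡ true
        back = AllPairs-lookup ch j i gt
        different : lookup C i ≢ lookup C j
        different q = true≢false (trans (sym back) (trans (cong (adj T (lookup C j)) q) (irrefl T _)))
    inj : Injective _≡_ _≡_ (lookup C)
    inj {i} {j} q = go (<-cmp (toℕ i) (toℕ j))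
      where
      loop : ∀ i j → toℕ i < toℕ j → lookup C i ≡ lookup C j → ⊥
      loop i j lt q = true≢false (trans (sym (AllPairs-lookup ch i j lt)) (trans (cong (adj T (lookup C i)) (sym q)) (irrefl T _)))
      go : Tri (toℕ i < toℕ j) (toℕ i ≡ toℕ j) (toℕ j < toℕ i) → i ≡ j
      go (tri< lt _ _) = ⊥-elim (loop i j lt q)
      go (tri≈ _ e _) = toℕ-injective e
      go (tri> _ _ gt) = ⊥-elim (loop j i gt (sym q))
    acyclic : IsTransitive (induce T (lookup C) inj)
    acyclic (k , c , step , close) = n≮n _ (<-≤-trans (increasing close) (climb k c step))
      where
      climb : ∀ k (c : Fin (suc k) → Fin (length C)) → (∀ i → Arc (induce T (lookup C) inj) (c (inject₁ i)) (c (fsuc i))) →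
        toℕ (c fzero) ≤ toℕ (c (fromℕ k))
      climb zero c _ = ≤-refl
      climb (suc k) c step = ≤-trans (<⇒≤ (increasing (step fzero))) (climb k (c ∘ fsuc) (step ∘ fsuc))

  -- Any two vertices form a chain of length 2, which is long enough for sets of size at most
  -- `2 ^ q`.
  short-chain : ∀ q .{{_ : NonZero q}} U → Unique U → length U ≤ 2 ^ q → ChainIn U λ C → length U ≤ length C ^ q
  short-chain q [] _ _ = [] , (λ ()) , [] , z≤n
  short-chain q (x ∷ []) _ _ = x ∷ [] , (λ i → i) , [] ∷ [] , ≤-reflexive (sym (^-zeroˡ q))
  short-chain q (x ∷ y ∷ U) ((x≢y ∷ _) ∷ _) le = go (adj T x y) refl
    where
    go : ∀ b → adj T x y ≡ b → ChainIn (x ∷ y ∷ U) λ C → length (x ∷ y ∷ U) ≤ length C ^ q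
    go true e = x ∷ y ∷ [] , (λ { (here p) → here p ; (there (here p)) → there (here p) }) , (e ∷ []) ∷ [] ∷ [] , le
    go false e = y ∷ x ∷ [] , (λ { (here p) → there (here p) ; (there (here p)) → here p }) ,
      (trans (tour T y x (λ q → x≢y (sym q))) (cong not e) ∷ []) ∷ [] ∷ [] , le

module Main {k : ℕ} (H : Tournament k) (θ : Permutation′ k) (sg : Ordered.SuperGalaxy H θ) (k≢0 : NonZero k) where
  open Constants k

  D≢0 : NonZero D
  D≢0 = m*n≢0 (8 * k) P {{m*n≢0 8 k {{_}} {{k≢0}}}} {{m^n≢0 2 (suc k)}}

  m₀≢0 : NonZero m₀
  m₀≢0 = >-nonZero (≤-trans (m^n>0 2 (2 * P * k)) (m≤n+m _ (κₛ + κ)))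

  m₀≤q : m₀ ≤ q
  m₀≤q = ≤-trans (m≤n+m m₀ (2 * κ)) (m≤n*m (2 * κ + m₀) D {{D≢0}})

  q≢0 : NonZero q
  q≢0 = >-nonZero (≤-trans (>-nonZero⁻¹ m₀ {{m₀≢0}}) m₀≤q)

  module _ {n : ℕ} (T : Tournament n) (free : ¬ ContainsInduced T H) where
    open Chains T

    -- With `s ^ q < length U ≤ (s + 1) ^ q`, a chain of length `s + 1` is exactly what is wanted.
    -- If the search finds none, `U` is critical, which is impossible.
    transitive-root : ∀ U → Unique U → Acc _<_ (length U) → ChainIn U λ C → length U ≤ length C ^ q
    transitive-root U uniqueU (acc smaller) = go (length U ≤? m₀)
      where
      IH : ∀ A → Unique A → length A < length U → ChainIn A λ C → length A ≤ length C ^ q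
      IH A uA lt = transitive-root A uA (smaller lt)
      go : Dec (length U ≤ m₀) → ChainIn U λ C → length U ≤ length C ^ q
      go (yes small) = short-chain T q {{q≢0}} U uniqueU (≤-trans small (≤-trans m₀≤q (<⇒≤ (n<2^n q))))
      go (no big) = search (integer-root (length U) q (≤-<-trans z≤n (≰⇒> big)) (>-nonZero⁻¹ q {{q≢0}}))
        where
        search : (Σ ℕ λ s → s ^ q < length U × length U ≤ suc s ^ q) → ChainIn U λ C → length U ≤ length C ^ q
        search (s , lo , hi) = found (hasChain? (suc s) U)
          where
          found : Dec (HasChain (suc s) U) → ChainIn U λ C → length U ≤ length C ^ q
          found (yes h) = let (C , C⊆ , ch , e) = HasChain⇒ (suc s) U h in C , C⊆ , ch , subst (λ z → length U ≤ z ^ q) (sym e) hi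
          found (no none) = ⊥-elim (Step.contradiction T H θ sg free U uniqueU s k≢0 IH
            (λ C C⊆ ch lt → none (⇒HasChain (suc s) U C C⊆ ch lt)) lo (<⇒≤ (≰⇒> big)))

    large-transitive : Σ ℕ λ m → HasTransitiveSub T m × n ^ 1 ≤ m ^ q
    large-transitive = let (C , _ , ch , le) = transitive-root (allFin n) (allFin⁺ n) (<-wellFounded _)
      in length C , chain⇒transitive T C ch ,
         subst (_≤ length C ^ q) (trans (length-tabulate {n = n} (λ x → x)) (sym (^-identityʳ n))) le

theorem3 : ∀ {k : ℕ} (H : Tournament k) → GalaxyWithSpiders H → ErdosHajnal H
theorem3 {zero} H _ = 1 , 1 , s≤s z≤n , s≤s z≤n , λ n T free → ⊥-elim (free ((λ ()) , (λ {i} → λ { {()} }) , λ ()))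
theorem3 {suc k} H (θ , sg , _) = 1 , Constants.q (suc k) , s≤s z≤n , >-nonZero⁻¹ _ {{Main.q≢0 H θ sg _}} ,
  λ n T free → Main.large-transitive H θ sg _ T free
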